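{- Define power series $\rho^{(k)}(\mathbf u)$ in $\mathbf u=(u_1,u_2,\dots)$ for $k\ge0$ by the generating series $$\sum_{k=0}^\infty\rho^{(k)}(\mathbf u)\,\frac{v^k}{k!}\;=\;\int_v^{v+1}e^{U(t)-U(t-1)}\,dt,\qquad U(t)=\sum_{n\ge1}u_nt^n,$$ and let $\rho^{(k)}_{i,j}$ for $i,j\ge0$ be the part of $\rho^{(k)}$ of degree $j$ and weight $i+2j+k$, where $u_\ell$ has degree $1$ and weight $\ell+1$. Define the operator $\rho_{i,j}:\mathcal R\to\mathcal R$ by $$\rho_{i,j}=\sum_{k=0}^\infty Q_k\,\rho^{(k)}_{i,j}\Bigl(\frac{\partial}{\partial p_1},\frac{\partial}{\partial p_2},\dots\Bigr).$$ Then for every $f\in\mathcal R$ $$\langle\widetilde T_p\,f\rangle_q\;=\;\sum_{i,j\ge0}\langle\rho_{i,j}(f)\rangle_q\;G^{(j)}_{p+i+1}\qquad\text{for all odd }p\ge1.$$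
   Context: Define $\beta_k\in\mathbb Q$ by $\frac{z/2}{\sinh(z/2)}=\sum_{k\ge0}\beta_kz^k$. For a partition $\lambda$ put $Q_0(\lambda)=1$ and $Q_k(\lambda)=\frac{1}{(k-1)!}\sum_{i\ge1}\bigl[(\lambda_i-i+\tfrac12)^{k-1}-(-i+\tfrac12)^{k-1}\bigr]+\beta_k$ for $k\ge1$. Let $\mathcal R=\mathbb Q[Q_1,Q_2,\dots]$ be the polynomial ring in these symbols ($Q_0=1$); elements of $\mathcal R$ are regarded as functions on the set of all partitions. Put $p_\ell=\ell!\,Q_{\ell+1}$ for $\ell\ge1$, so $\frac{\partial}{\partial p_\ell}=\frac1{\ell!}\frac{\partial}{\partial Q_{\ell+1}}$ as derivations of $\mathcal R$; in $\rho_{i,j}$ the multiplication by $Q_k$ is applied after the derivations. The $q$-bracket of a function $f$ on partitions is $\langle f\rangle_q=\sum_\lambda f(\lambda)q^{|\lambda|}\big/\sum_\lambda q^{|\lambda|}\in\mathbb Q[[q]]$. For $p\ge1$ odd, $\widetilde T_p(\lambda)=\sum_{\xi\in Y_\lambda}h(\xi)^{p-1}+\frac12\zeta(-p)$, where $Y_\lambda$ is the Young diagram of $\lambda$ and $h(\xi)$ the hook-length of the cell $\xi$. $G_k=-\frac{B_k}{2k}+\sum_{n\ge1}\sigma_{k-1}(n)q^n$ for $k\ge2$ even, $G_k=0$ for $k$ odd, and $G_k^{(j)}=\bigl(q\frac{d}{dq}\bigr)^jG_k$. -}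

module Defs where

open import Algebra.Definitions.RawSemiring using () renaming (_^_ to pow)
open import Data.Bool.Base using (Bool; if_then_else_)
open import Data.Fin.Base using (Fin; toℕ)
open import Data.Integer.Base using (+_)
open import Data.List.Base
  using (List; []; _∷_; _++_; map; foldr; concatMap; filter; mapMaybe; length; lookup;
         upTo; allFin; cartesianProductWith)
open import Data.List.Relation.Unary.All as All using (All; []; _∷_)
import Data.List.Relation.Unary.All.Properties as All
open import Data.List.Relation.Unary.Linked using (Linked; linked?)
open import Data.Maybe.Base using (Maybe; just; nothing)
open import Data.Nat.Base as ℕ using (ℕ; zero; suc; _∸_; _≤_; _<_; _≥_; _⊔_; _!; NonZero)
open import Data.Nat.Divisibility using (_∣?_)
open import Data.Nat.GeneralisedArithmetic using (fold)
open import Data.Nat.ListAction using (sum)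
import Data.Nat.Properties as ℕ
open import Data.Nat.Tactic.RingSolver using (solve-∀)
open import Data.Product.Base using (_×_; _,_; proj₂; map₂; ∃)
open import Data.Rational.Base using (ℚ; 0ℚ; 1ℚ; ½; _+_; _*_; _-_; -_; _/_; +-*-rawSemiring)
open import Data.Sum.Base using (_⊎_)
open import Function.Base using (_∘_; id)
open import Relation.Binary.PropositionalEquality
  using (_≡_; _≗_; refl; sym; trans; cong; cong₂; subst)
open import Relation.Nullary using (yes; no; does; contradiction)
open import Relation.Nullary.Decidable using (_×-dec_)

------------------------------------------------------------------------
-- Rational numbers

infixr 8 _^_

_^_ : ℚ → ℕ → ℚ
_^_ = pow +-*-rawSemiring

fromℕ : ℕ → ℚ
fromℕ n = + n / 1

1/ℕ : (n : ℕ) .{{_ : NonZero n}} → ℚ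
1/ℕ n = + 1 / n

1/_! : ℕ → ℚ
1/ n ! = 1/ℕ (n !) {{n ℕ.!≢0}}

∑ : {A : Set} → List A → (A → ℚ) → ℚ
∑ xs f = foldr _+_ 0ℚ (map f xs)

infix 5 ∑
syntax ∑ xs (λ x → e) = ∑[ x ∈ xs ] e

even : ℕ → Bool
even n = does (2 ∣? n)

------------------------------------------------------------------------
-- Formal power series in one variable over ℚ

Series : Set
Series = ℕ → ℚ

0ˢ 1ˢ : Series
0ˢ _ = 0ℚ
1ˢ zero    = 1ℚ
1ˢ (suc _) = 0ℚ

infixl 7 _⊛_

_⊛_ : Series → Series → Series
(a ⊛ b) n = ∑[ i ∈ upTo (suc n) ] (a i * b (n ∸ i))

-- The inverse of a series c with c₀ = 1, as the geometric series Σₘ xᵐ for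
-- x = 1 - c.  Since x₀ = 0, only m ≤ n contribute to the coefficient at n.
recip : Series → Series
recip c n = ∑[ m ∈ upTo (suc n) ] fold 1ˢ (x ⊛_) m n
  where
  x : Series
  x i = 1ˢ i - c i

-- The operator q d/dq.
𝐷 : Series → Series
𝐷 a n = fromℕ n * a n

-- s = Σ_{i,j≥0} a i j, where all but finitely many a i j vanish.
IsFiniteSum : (ℕ → ℕ → Series) → Series → Set
IsFiniteSum a s = ∃ λ N →
  (∀ i j → N ≤ i ⊎ N ≤ j → a i j ≗ 0ˢ) ×
  (∀ n → s n ≡ ∑[ i ∈ upTo N ] ∑[ j ∈ upTo N ] a i j n)

------------------------------------------------------------------------
-- The numbers β_k and B_k, zeta values and Eisenstein series

-- sinh(z/2) / (z/2) = Σ_{n even} (z/2)ⁿ / (n+1)!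
sinhc½ : Series
sinhc½ n = if even n then ½ ^ n * 1/ suc n ! else 0ℚ

β : Series
β = recip sinhc½

-- z / (eᶻ - 1) = Σₙ Bₙ zⁿ / n!
bernoulli : ℕ → ℚ
bernoulli n = fromℕ (n !) * recip (λ m → 1/ suc m !) n

-- ζ(-p) for p ≥ 1, by its classical evaluation -B_{p+1} / (p+1).
ζ⁻ : ℕ → ℚ
ζ⁻ p = - (bernoulli (suc p) * 1/ℕ (suc p))

σ : ℕ → ℕ → ℕ
σ r n = sum (map (ℕ._^ r) (filter (_∣? n) (map suc (upTo n))))

-- G 0 is not part of the definition; it is set to 0 and never used.
G : ℕ → Series
G zero    _ = 0ℚ
G (suc k) n = if even (suc k) then coefficient n else 0ℚ
  where
  coefficient : ℕ → ℚ
  coefficient zero    = - (bernoulli (suc k) * 1/ℕ (2 ℕ.* suc k))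
  coefficient (suc n) = fromℕ (σ k (suc n))

-- The j-th derivative G_k^{(j)}.
G⁽_⁾ : ℕ → ℕ → Series
G⁽ j ⁾ k = fold (G k) 𝐷 j

------------------------------------------------------------------------
-- Partitions and the q-bracket

record Partition : Set where
  constructor mkPartition
  field
    parts      : List ℕ
    decreasing : Linked _≥_ parts
    positive   : All (0 <_) parts

open Partition public

partition? : List ℕ → Maybe Partition
partition? xs with linked? ℕ._≥?_ xs | All.all? (0 ℕ.<?_) xs
... | yes d | yes p = just (mkPartition xs d p)
... | _     | _     = nothing

-- All lists of length l with entries ≤ b, each once.
lists : ℕ → ℕ → List (List ℕ)
lists zero    b = [] ∷ []
lists (suc l) b = cartesianProductWith _∷_ (upTo (suc b)) (lists l b)

-- All partitions of n, each once: there are at most n parts, each at most n.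
partitions : ℕ → List Partition
partitions n =
  mapMaybe partition?
    (filter (λ xs → sum xs ℕ.≟ n) (concatMap (λ l → lists l n) (upTo (suc n))))

⟨_⟩ : (Partition → ℚ) → Series
⟨ f ⟩ = (λ n → ∑[ μ ∈ partitions n ] f μ) ⊛ recip (λ n → ∑[ μ ∈ partitions n ] 1ℚ)

-- The function Q_k.  The row with index i, counted from 0, is λ_{i+1}; the
-- summands of the defining sum beyond the last part vanish.
Qᶠ : ℕ → Partition → ℚ
Qᶠ zero    μ = 1ℚ
Qᶠ (suc k) μ =
  1/ k ! * (∑[ i ∈ allFin (length (parts μ)) ]
              ((fromℕ (lookup (parts μ) i) + x i) ^ k - x i ^ k))
  + β (suc k)
  where
  x : Fin (length (parts μ)) → ℚ
  x i = - fromℕ (suc (toℕ i)) + ½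

-- The number of λ_i > j, that is, the part of the conjugate partition with
-- index j counted from 0.
column : Partition → ℕ → ℕ
column μ j = length (filter (j ℕ.<?_) (parts μ))

-- The hook-length arm + leg + 1 of the cell (i , j); rows and columns are
-- counted from 0.
hook : (μ : Partition) → Fin (length (parts μ)) → ℕ → ℕ
hook μ i j = (lookup (parts μ) i ∸ suc j) ℕ.+ (column μ j ∸ suc (toℕ i)) ℕ.+ 1

T̃ : ℕ → Partition → ℚ
T̃ p μ =
  (∑[ i ∈ allFin (length (parts μ)) ] ∑[ j ∈ upTo (lookup (parts μ) i) ]
     fromℕ (hook μ i j) ^ (p ∸ 1))
  + ½ * ζ⁻ p

------------------------------------------------------------------------
-- Monomials in countably many variables x₁, x₂, …

-- A list e₁ ∷ e₂ ∷ … ∷ eₙ ∷ [] stands for x₁^e₁ x₂^e₂ ⋯ xₙ^eₙ, so trailing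
-- zeros are immaterial.
Monomial : Set
Monomial = List ℕ

degree : Monomial → ℕ
degree = sum

-- The weight when xₙ has weight w + n - 1 for n ≥ 1.
weightFrom : ℕ → Monomial → ℕ
weightFrom w []      = 0
weightFrom w (e ∷ m) = w ℕ.* e ℕ.+ weightFrom (suc w) m

------------------------------------------------------------------------
-- The polynomial ring 𝓡 in Q₁, Q₂, …

-- A polynomial is written as a finite sum of terms c · Q^m with xₖ = Qₖ.
-- Different lists may represent the same polynomial.
𝓡 : Set
𝓡 = List (ℚ × Monomial)

eval : 𝓡 → Partition → ℚ
eval f μ = ∑ f λ { (c , m) → c * evalᴹ 1 m }
  where
  evalᴹ : ℕ → Monomial → ℚ
  evalᴹ k []      = 1ℚ
  evalᴹ k (e ∷ m) = Qᶠ k μ ^ e * evalᴹ (suc k) m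

scale : ℚ → 𝓡 → 𝓡
scale a = map λ { (c , m) → (a * c , m) }

-- Multiplication by Q_k, with Q₀ = 1.
Q·_ : ℕ → 𝓡 → 𝓡
(Q· zero)    = id
(Q· (suc k)) = map (map₂ (raise k))
  where
  raise : ℕ → Monomial → Monomial
  raise zero    []      = 1 ∷ []
  raise zero    (e ∷ m) = suc e ∷ m
  raise (suc k) []      = 0 ∷ raise k []
  raise (suc k) (e ∷ m) = e ∷ raise k m

∂ᴹ : ℕ → Monomial → 𝓡
∂ᴹ l       []          = []
∂ᴹ zero    (zero  ∷ m) = []
∂ᴹ zero    (suc e ∷ m) = (fromℕ (suc e) , e ∷ m) ∷ []
∂ᴹ (suc l) (e     ∷ m) = map (map₂ (e ∷_)) (∂ᴹ l m)

-- The derivation ∂/∂Q_{l+1}.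
∂/∂Q₁₊ : ℕ → 𝓡 → 𝓡
∂/∂Q₁₊ l = concatMap λ { (c , m) → scale c (∂ᴹ l m) }

∂/∂p : ℕ → 𝓡 → 𝓡
∂/∂p l f = scale (1/ l !) (∂/∂Q₁₊ l f)

-- The operator (∂/∂p_l)^e₁ (∂/∂p_{l+1})^e₂ ⋯
∂/∂p^From : ℕ → Monomial → 𝓡 → 𝓡
∂/∂p^From l []      f = f
∂/∂p^From l (e ∷ m) f = fold (∂/∂p^From (suc l) m f) (∂/∂p l) e

-- The monomial u^m evaluated at u_l = ∂/∂p_l.
∂/∂p^ : Monomial → 𝓡 → 𝓡
∂/∂p^ = ∂/∂p^From 1

-- An upper bound for the weights of the terms of f, where Q_k has weight k.
weightBound : 𝓡 → ℕ
weightBound = foldr (λ { (c , m) w → weightFrom 1 m ⊔ w }) 0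

------------------------------------------------------------------------
-- Polynomials in one variable over ℚ

-- Coefficient lists, constant term first.
Poly : Set
Poly = List ℚ

infixl 6 _+ᴾ_ _-ᴾ_
infixl 7 _*ᴾ_ _·ᴾ_
infixr 8 _^ᴾ_

_+ᴾ_ : Poly → Poly → Poly
[]      +ᴾ g       = g
(a ∷ f) +ᴾ []      = a ∷ f
(a ∷ f) +ᴾ (b ∷ g) = (a + b) ∷ (f +ᴾ g)

_·ᴾ_ : ℚ → Poly → Poly
a ·ᴾ f = map (a *_) f

_-ᴾ_ : Poly → Poly → Poly
f -ᴾ g = f +ᴾ (- 1ℚ) ·ᴾ g

_*ᴾ_ : Poly → Poly → Poly
[]      *ᴾ g = []
(a ∷ f) *ᴾ g = a ·ᴾ g +ᴾ (0ℚ ∷ f *ᴾ g)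

_^ᴾ_ : Poly → ℕ → Poly
f ^ᴾ n = fold (1ℚ ∷ []) (f *ᴾ_) n

∑ᴾ : {A : Set} → List A → (A → Poly) → Poly
∑ᴾ xs f = foldr _+ᴾ_ [] (map f xs)

infix 5 ∑ᴾ
syntax ∑ᴾ xs (λ x → e) = ∑ᴾ[ x ∈ xs ] e

coeff : ℕ → Poly → ℚ
coeff n       []      = 0ℚ
coeff zero    (a ∷ f) = a
coeff (suc n) (a ∷ f) = coeff n f

_at_ : Poly → Poly → Poly
[]      at g = []
(a ∷ f) at g = (a ∷ []) +ᴾ g *ᴾ (f at g)

X : Poly
X = 0ℚ ∷ 1ℚ ∷ []

antiderivative : Poly → Poly
antiderivative f = 0ℚ ∷ go 0 f
  where
  go : ℕ → Poly → Poly
  go n []      = []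
  go n (a ∷ f) = a * 1/ℕ (suc n) ∷ go (suc n) f

-- ∫_v^{v+1} f(t) dt as a polynomial in v.
∫₁ : Poly → Poly
∫₁ f = antiderivative f at (X +ᴾ (1ℚ ∷ [])) -ᴾ antiderivative f

------------------------------------------------------------------------
-- Formal power series in u₁, u₂, … over ℚ[t], by their coefficients

SeriesU : Set
SeriesU = Monomial → Poly

-- All pairs of monomials with product m.
splits : Monomial → List (Monomial × Monomial)
splits []      = ([] , []) ∷ []
splits (e ∷ m) =
  cartesianProductWith (λ { d (a , b) → (d ∷ a , (e ∸ d) ∷ b) }) (upTo (suc e)) (splits m)

infixl 7 _*ᵁ_

_*ᵁ_ : SeriesU → SeriesU → SeriesU
(F *ᵁ H) m = ∑ᴾ (splits m) λ { (a , b) → F a *ᴾ H b }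

1ᵁ : SeriesU
1ᵁ m = if degree m ℕ.≡ᵇ 0 then 1ℚ ∷ [] else []

-- e^F for a series F without constant term.  As Fⁿ has only terms of degree
-- at least n, the summands Fⁿ/n! with n > degree m do not contribute at m.
exp : SeriesU → SeriesU
exp F m = ∑ᴾ[ n ∈ upTo (suc (degree m)) ] 1/ n ! ·ᴾ fold 1ᵁ (F *ᵁ_) n m

-- Σ_{n≥0} a n · u_{n+1}
linear : (ℕ → Poly) → SeriesU
linear a []                = []
linear a (0 ∷ m)           = linear (a ∘ suc) m
linear a (1 ∷ m)           = if degree m ℕ.≡ᵇ 0 then a 0 else []
linear a (suc (suc _) ∷ m) = []

-- U(g) = Σ_{n≥1} uₙ gⁿ for a polynomial g in t.
U : Poly → SeriesU
U g = linear (λ n → g ^ᴾ suc n)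

-- The coefficient of u^m in ρ^{(k)}(u).
ρ⁽_⁾ : ℕ → Monomial → ℚ
ρ⁽ k ⁾ m =
  fromℕ (k !) * coeff k (∫₁ (exp (λ m′ → U X m′ -ᴾ U (X -ᴾ (1ℚ ∷ [])) m′) m))

------------------------------------------------------------------------
-- The operators ρ_{i,j}

-- All monomials in the u_l of degree j and weight w, each once, where u_l has
-- weight l + 1: they involve only u₁, …, u_w, with exponents at most j.
monomials : ℕ → ℕ → List Monomial
monomials j w =
  filter (λ m → (degree m ℕ.≟ j) ×-dec (weightFrom 2 m ℕ.≟ w)) (lists w j)

-- Q_k ρ^{(k)}_{i,j}(∂/∂p₁, ∂/∂p₂, …) f
ρ-summand : ℕ → ℕ → ℕ → 𝓡 → 𝓡
ρ-summand i j k f =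
  (Q· k) (concatMap (λ m → scale (ρ⁽ k ⁾ m) (∂/∂p^ m f))
                    (monomials j (i ℕ.+ 2 ℕ.* j ℕ.+ k)))

-- The sum over all k ≥ 0; it may be cut off by ρ-summand-vanishes below.
ρ : ℕ → ℕ → 𝓡 → 𝓡
ρ i j f = concatMap (λ k → ρ-summand i j k f) (upTo (suc (weightBound f)))

private
  -- All terms of f have weight at most B - a.
  Below : ℕ → ℕ → 𝓡 → Set
  Below B a = All λ t → weightFrom 1 (proj₂ t) ℕ.+ a ≤ B

  below-weightBound : ∀ f → Below (weightBound f) 0 f
  below-weightBound []            = []
  below-weightBound ((c , m) ∷ f) =
    subst (_≤ weightFrom 1 m ⊔ weightBound f) (sym (ℕ.+-identityʳ _)) (ℕ.m≤m⊔n _ _) ∷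
    All.map (λ le → ℕ.≤-trans le (ℕ.m≤n⊔m _ _)) (below-weightBound f)

  below-scale : ∀ {B a} c f → Below B a f → Below B a (scale c f)
  below-scale c f = All.map⁺ ∘ All.map id

  ∂ᴹ-weight : ∀ l w m →
    All (λ t → weightFrom w (proj₂ t) ℕ.+ (w ℕ.+ l) ≡ weightFrom w m) (∂ᴹ l m)
  ∂ᴹ-weight l       w []          = []
  ∂ᴹ-weight zero    w (zero  ∷ m) = []
  ∂ᴹ-weight zero    w (suc e ∷ m) = lemma w e (weightFrom (suc w) m) ∷ []
    where
    lemma : ∀ w e x → w ℕ.* e ℕ.+ x ℕ.+ (w ℕ.+ 0) ≡ w ℕ.* suc e ℕ.+ x
    lemma = solve-∀
  ∂ᴹ-weight (suc l) w (e ∷ m) =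
    All.map⁺ (All.map (λ {t} eq →
      trans (lemma (w ℕ.* e) (weightFrom (suc w) (proj₂ t)) w l) (cong (w ℕ.* e ℕ.+_) eq))
      (∂ᴹ-weight l (suc w) m))
    where
    lemma : ∀ x y w l → x ℕ.+ y ℕ.+ (w ℕ.+ suc l) ≡ x ℕ.+ (y ℕ.+ (suc w ℕ.+ l))
    lemma = solve-∀

  below-∂/∂p : ∀ {B a} l f → Below B a f → Below B (suc l ℕ.+ a) (∂/∂p l f)
  below-∂/∂p {B} {a} l f b = below-scale (1/ l !) (∂/∂Q₁₊ l f) (below-∂/∂Q f b)
    where
    below-∂/∂Q : ∀ f → Below B a f → Below B (suc l ℕ.+ a) (∂/∂Q₁₊ l f)
    below-∂/∂Q []            []       = []
    below-∂/∂Q ((c , m) ∷ f) (le ∷ b) = All.++⁺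
      (below-scale c (∂ᴹ l m) (All.map (λ {t} eq →
        subst (_≤ B)
          (trans (cong (ℕ._+ a) (sym eq)) (ℕ.+-assoc (weightFrom 1 (proj₂ t)) (suc l) a)) le)
        (∂ᴹ-weight l 1 m)))
      (below-∂/∂Q f b)

  below-∂/∂p^ : ∀ {B a} l m f → Below B a f →
    Below B (weightFrom (suc l) m ℕ.+ a) (∂/∂p^From l m f)
  below-∂/∂p^     l []      f b = b
  below-∂/∂p^ {B} {a} l (e ∷ m) f b = iterated e
    where
    g : 𝓡
    g = ∂/∂p^From (suc l) m f

    x : ℕ
    x = weightFrom (suc (suc l)) m

    lemma₀ : ∀ l x a → x ℕ.+ a ≡ suc l ℕ.* 0 ℕ.+ x ℕ.+ a
    lemma₀ = solve-∀

    lemma₁ : ∀ l e x a → suc l ℕ.+ (suc l ℕ.* e ℕ.+ x ℕ.+ a) ≡ suc l ℕ.* suc e ℕ.+ x ℕ.+ a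
    lemma₁ = solve-∀

    iterated : ∀ e → Below B (suc l ℕ.* e ℕ.+ x ℕ.+ a) (fold g (∂/∂p l) e)
    iterated zero    = subst (λ y → Below B y g) (lemma₀ l x a) (below-∂/∂p^ (suc l) m f b)
    iterated (suc e) = subst (λ y → Below B y (fold g (∂/∂p l) (suc e))) (lemma₁ l e x a)
                         (below-∂/∂p l (fold g (∂/∂p l) e) (iterated e))

  below-[] : ∀ {B a} f → B < a → Below B a f → f ≡ []
  below-[] []      _  _        = refl
  below-[] (t ∷ f) lt (le ∷ _) =
    contradiction (ℕ.≤-trans (ℕ.m≤n+m _ _) le) (ℕ.<⇒≱ lt)

  Q·-[] : ∀ k → (Q· k) [] ≡ []
  Q·-[] zero    = refl
  Q·-[] (suc k) = refl

-- For f all of whose terms have weight less than i + 2j + k, the k-th summand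
-- is literally the empty sum; in particular it is for k > weightBound f.
ρ-summand-vanishes : ∀ i j k f → weightBound f < i ℕ.+ 2 ℕ.* j ℕ.+ k →
  ρ-summand i j k f ≡ []
ρ-summand-vanishes i j k f lt =
  trans (cong (Q· k) (all-vanish _ (All.all-filter _ (lists w j)))) (Q·-[] k)
  where
  w : ℕ
  w = i ℕ.+ 2 ℕ.* j ℕ.+ k

  vanish : ∀ m → weightFrom 2 m ≡ w → ∂/∂p^ m f ≡ []
  vanish m eq = below-[] _
    (subst (weightBound f <_) (sym (trans (ℕ.+-identityʳ _) eq)) lt)
    (below-∂/∂p^ 1 m f (below-weightBound f))

  all-vanish : ∀ ms → All (λ m → degree m ≡ j × weightFrom 2 m ≡ w) ms →
    concatMap (λ m → scale (ρ⁽ k ⁾ m) (∂/∂p^ m f)) ms ≡ []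
  all-vanish []       []             = refl
  all-vanish (m ∷ ms) ((_ , eq) ∷ h) =
    cong₂ _++_ (cong (scale (ρ⁽ k ⁾ m)) (vanish m eq)) (all-vanish ms h)

{-# OPTIONS --safe #-}

-- Think of a partition as a Maya diagram, with particles at the half-integers
-- λᵢ - i + ½.  A hook of length m is a particle at x with a hole at x - m, and
-- removing the hook moves that particle to x - m, which changes the power sum
-- p_ℓ by (x - m)^ℓ - x^ℓ.
--
-- Fix m.  For a rational r let f_{r,x}(λ) be the value of f after r x^ℓ - r (x - m)^ℓ
-- has been added to each p_ℓ.  Let B_r(λ) be the sum of f_{r,x}(λ) over the x
-- that are occupied while x - m is not, and A_r(λ) the sum over the x that are
-- empty while x - m is occupied.  Moving a particle from x - m to x gives
-- Σ_{|λ|=s} A_{r+1}(λ) = Σ_{|λ|=s+m} B_r(λ), so that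
-- Σ_{r≥1} q^{mr} Σ_λ (A_r(λ) - B_r(λ)) q^{|λ|} telescopes to Σ_λ B_0(λ) q^{|λ|},
-- and B_0(λ) is f(λ) times the number of hooks of length m.
--
-- On the other hand A_r - B_r is the regularised sum of f_{r,x+m} - f_{r,x}
-- over all particles x.  By Taylor's formula in the p_ℓ, and in x = m t, this
-- sum is Σ_{i,j} m^{i+j+1} r^j ρ_{i,j}(f); the values β_k of Q_k at the empty
-- partition enter through (D/2)/sinh(D/2) (e^{mD} - 1)/D = Σ_{s<m} e^{(s+½)D}.
-- The reflection t ↦ 1 - t shows that odd i contribute nothing.  Summation over
-- m with weight m^{p-1} produces the divisor sums of the Eisenstein series.

module Submission where

-- Why r drops by one: if λ′ arises from λ by moving a particle from x - m to x, then p_ℓ(λ′) =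
-- p_ℓ(λ) + x^ℓ - (x - m)^ℓ, hence f_{r+1,x}(λ) = f_{r,x}(λ′). With n = m r the factor m^{i+j+1} r^j
-- becomes m^{i+1} n^j; together with m^{p-1} and summed over the divisors m of n this is σ_{p+i}(n)
-- n^j, the coefficient of q^n in the j-th derivative of G_{p+i+1} for even i. The constant terms of
-- the Eisenstein series are treated apart. Derivatives have none, and for j = 0 only the monomial 1
-- is left, so ρ_{0,0} is the identity and ρ_{i,0} = 0 for i > 0; what remains is the constant ½
-- ζ(-p) of G_{p+1}, which is why `T̃` contains it. The obstacle is that diagrams and operators are
-- infinite. For the coefficient of q^n a diagram is cut down to a word with n holes and n
-- particles, which has room for every partition of size at most n; the telescoping compares A_r
-- with B_r only at sizes s with s + m ≤ n, for which the m highest places are holes and the m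
-- lowest are particles. Weights cut off the sums over monomials.

module Proof where

  open import Defs
  open import Data.Bool.Base using (Bool; true; false; if_then_else_; not; _∧_)
  open import Data.Bool.Properties using (not-involutive)
  open import Data.Nat.ListAction using (sum)
  open import Data.List.Base
    using (List; []; _∷_; _++_; map; concatMap; filter; upTo; cartesianProductWith; length; lookup;
           allFin; replicate; mapMaybe)
  open import Data.Fin.Base as Fin using (Fin; toℕ)
  open import Data.Nat.Base as ℕ using (ℕ; zero; suc; _∸_; _≤_; _<_; _≥_; z≤n; s≤s; s<s; _!; NonZero)
  import Data.Nat.Properties as ℕ
  import Data.Integer.Base as ℤ
  import Data.Integer.Properties as ℤ
  open import Data.Rational.Base using (ℚ; 0ℚ; 1ℚ; ½; _+_; _*_; _-_; -_; toℚᵘ)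
  import Data.Rational.Properties as ℚ
  import Data.Rational.Unnormalised.Base as ℚᵘ
  import Data.Rational.Unnormalised.Properties as ℚᵘ
  open import Data.Product.Base using (_×_; _,_; proj₁; proj₂; ∃; map₂)
  open import Data.Sum.Base using (_⊎_; inj₁; inj₂)
  open import Data.List.Membership.Propositional using (_∈_)
  open import Data.List.Membership.Propositional.Properties
    using (∈-upTo⁺; ∈-upTo⁻; ∈-filter⁺; ∈-filter⁻;
           ∈-++⁺ˡ; ∈-++⁺ʳ; ∈-++⁻; ∈-map⁺; ∈-map⁻; ∈-concatMap⁺; ∈-lookup;
           ∈-cartesianProductWith⁺; ∈-cartesianProductWith⁻)
  import Data.List.Properties as List
  open import Data.List.Relation.Binary.Permutation.Propositional as ↭ using (_↭_)
  open import Data.List.Relation.Unary.All as All using (All; []; _∷_)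
  import Data.List.Relation.Unary.All.Properties as All
  open import Data.List.Relation.Unary.Linked using (Linked; []; [-]; _∷_; linked?)
  import Data.List.Relation.Unary.Linked.Properties as Linked
  open import Data.List.Membership.Propositional.Properties.WithK using (unique∧set⇒bag)
  open import Data.List.Relation.Binary.BagAndSetEquality using (∼bag⇒↭)
  open import Data.List.Relation.Unary.AllPairs using ([]; _∷_)
  import Data.List.Relation.Unary.AllPairs.Properties as AllPairs
  open import Data.List.Relation.Unary.Unique.Propositional using (Unique)
  import Data.List.Relation.Unary.Unique.Propositional.Properties as Unique
  open import Data.List.Relation.Unary.Any as Any using (here; there)
  open import Data.Nat.Divisibility using (_∣_; _∣?_; ∣m∣n⇒∣m+n; ∣m+n∣m⇒∣n; ∣-refl; ∣⇒≤; _∣0)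
  open import Data.Nat.Induction using (<-wellFounded)
  open import Induction.WellFounded using (Acc; acc)
  open import Data.Nat.GeneralisedArithmetic using (fold)
  open import Function.Bundles using (mk⇔)
  open import Function.Base using (_∘_; id)
  open import Relation.Nullary using (Dec; yes; no; does; ¬_; contradiction)
  open import Relation.Nullary.Decidable using (dec⇒maybe; dec-true; dec-false; _×-dec_)
  open import Relation.Unary using (Decidable; Pred)
  open import Relation.Binary.PropositionalEquality
    using (_≡_; _≢_; _≗_; refl; sym; trans; cong; cong₂; subst; module ≡-Reasoning)
  open import Relation.Binary.Definitions using (tri<; tri≈; tri>)
  open import Data.Nat.Tactic.RingSolver using () renaming (solve-∀ to ℕ-solve-∀)
  open import Tactic.RingSolver using (solve-∀)
  open import Tactic.RingSolver.Core.AlmostCommutativeRing using (AlmostCommutativeRing; fromCommutativeRing)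

  -- Natural numbers and factorials inside ℚ

  ℚ-ring : AlmostCommutativeRing _ _
  ℚ-ring = fromCommutativeRing ℚ.+-*-commutativeRing (λ x → dec⇒maybe (0ℚ ℚ.≟ x))

  fromℕ-+ : ∀ m n → fromℕ (m ℕ.+ n) ≡ fromℕ m + fromℕ n
  fromℕ-+ m n = ℚ.toℚᵘ-injective (begin
    toℚᵘ (fromℕ (m ℕ.+ n))                 ≈⟨ ℚ.toℚᵘ-fromℚᵘ (ℚᵘ.mkℚᵘ (ℤ.+ (m ℕ.+ n)) 0) ⟩
    ℚᵘ.mkℚᵘ (ℤ.+ (m ℕ.+ n)) 0                ≈⟨ ℚᵘ.*≡* (cong₂ (λ a b → (a ℤ.+ b) ℤ.* ℤ.+ 1) (sym (ℤ.*-identityʳ (ℤ.+ m))) (sym (ℤ.*-identityʳ (ℤ.+ n)))) ⟩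
    ℚᵘ.mkℚᵘ (ℤ.+ m) 0 ℚᵘ.+ ℚᵘ.mkℚᵘ (ℤ.+ n) 0   ≈⟨ ℚᵘ.+-cong (ℚᵘ.≃-sym (ℚ.toℚᵘ-fromℚᵘ (ℚᵘ.mkℚᵘ (ℤ.+ m) 0))) (ℚᵘ.≃-sym (ℚ.toℚᵘ-fromℚᵘ (ℚᵘ.mkℚᵘ (ℤ.+ n) 0))) ⟩
    toℚᵘ (fromℕ m) ℚᵘ.+ toℚᵘ (fromℕ n)     ≈⟨ ℚᵘ.≃-sym (ℚ.toℚᵘ-homo-+ (fromℕ m) (fromℕ n)) ⟩
    toℚᵘ (fromℕ m + fromℕ n)               ∎)
    where open ℚᵘ.≃-Reasoning

  fromℕ-* : ∀ m n → fromℕ (m ℕ.* n) ≡ fromℕ m * fromℕ n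
  fromℕ-* zero    n = sym (ℚ.*-zeroˡ (fromℕ n))
  fromℕ-* (suc m) n = begin
    fromℕ (n ℕ.+ m ℕ.* n)             ≡⟨ fromℕ-+ n (m ℕ.* n) ⟩
    fromℕ n + fromℕ (m ℕ.* n)         ≡⟨ cong (fromℕ n +_) (fromℕ-* m n) ⟩
    fromℕ n + fromℕ m * fromℕ n       ≡⟨ ring (fromℕ m) (fromℕ n) ⟩
    (1ℚ + fromℕ m) * fromℕ n          ≡⟨ cong (_* fromℕ n) (sym (fromℕ-+ 1 m)) ⟩
    fromℕ (suc m) * fromℕ n           ∎
    where
    open ≡-Reasoning
    ring : ∀ x y → y + x * y ≡ (1ℚ + x) * y
    ring = solve-∀ ℚ-ring

  fromℕ-suc : ∀ n → fromℕ (suc n) ≡ 1ℚ + fromℕ n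
  fromℕ-suc = fromℕ-+ 1

  fromℕ-injective : ∀ {m n} → fromℕ m ≡ fromℕ n → m ≡ n
  fromℕ-injective {m} {n} eq with ℚ./-injective-≃ (ℚᵘ.mkℚᵘ (ℤ.+ m) 0) (ℚᵘ.mkℚᵘ (ℤ.+ n) 0) eq
  ... | ℚᵘ.*≡* e = ℤ.+-injective (ℤ.*-cancelʳ-≡ (ℤ.+ m) (ℤ.+ n) (ℤ.+ 1) e)

  fromℕ-∸ : ∀ {m n} → n ≤ m → fromℕ (m ∸ n) ≡ fromℕ m - fromℕ n
  fromℕ-∸ {m} {n} n≤m = begin
    fromℕ (m ∸ n)                       ≡⟨ ring (fromℕ (m ∸ n)) (fromℕ n) ⟩
    (fromℕ (m ∸ n) + fromℕ n) - fromℕ n ≡⟨ cong (_- fromℕ n) (fromℕ-+ (m ∸ n) n) ⟨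
    fromℕ (m ∸ n ℕ.+ n) - fromℕ n       ≡⟨ cong (λ k → fromℕ k - fromℕ n) (ℕ.m∸n+n≡m n≤m) ⟩
    fromℕ m - fromℕ n                   ∎
    where
    open ≡-Reasoning
    ring : ∀ x y → x ≡ (x + y) - y
    ring = solve-∀ ℚ-ring

  fromℕ*1/ℕ : ∀ n .{{_ : NonZero n}} → fromℕ n * 1/ℕ n ≡ 1ℚ
  fromℕ*1/ℕ (suc n) = ℚ.toℚᵘ-injective (begin
    toℚᵘ (fromℕ (suc n) * 1/ℕ (suc n))        ≈⟨ ℚ.toℚᵘ-homo-* (fromℕ (suc n)) (1/ℕ (suc n)) ⟩
    toℚᵘ (fromℕ (suc n)) ℚᵘ.* toℚᵘ (1/ℕ (suc n)) ≈⟨ ℚᵘ.*-cong (ℚ.toℚᵘ-fromℚᵘ (ℚᵘ.mkℚᵘ (ℤ.+ suc n) 0)) (ℚ.toℚᵘ-fromℚᵘ (ℚᵘ.mkℚᵘ (ℤ.+ 1) n)) ⟩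
    ℚᵘ.mkℚᵘ (ℤ.+ suc n) 0 ℚᵘ.* ℚᵘ.mkℚᵘ (ℤ.+ 1) n  ≈⟨ ℚᵘ.*≡* lemma ⟩
    toℚᵘ 1ℚ                                   ∎)
    where
    open ℚᵘ.≃-Reasoning
    lemma : (ℤ.+ suc n ℤ.* ℤ.+ 1) ℤ.* ℤ.+ 1 ≡ ℤ.+ 1 ℤ.* ℤ.+ (1 ℕ.* suc n)
    lemma = trans (ℤ.*-identityʳ _) (trans (ℤ.*-identityʳ _)
              (sym (trans (ℤ.*-identityˡ _) (cong ℤ.+_ (ℕ.*-identityˡ (suc n))))))

  1/!-suc : ∀ n → fromℕ (suc n) * 1/ suc n ! ≡ 1/ n !
  1/!-suc n = begin
    a * c                 ≡⟨ ring₁ (a * c) (fromℕ (n !)) ⟩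
    1ℚ * (a * c)          ≡⟨ cong (_* (a * c)) (fromℕ*1/ℕ (n !) {{ℕ._!≢0 n}}) ⟨
    (d * b) * (a * c)     ≡⟨ ring₂ a b c d ⟩
    b * ((a * d) * c)     ≡⟨ cong (λ x → b * (x * c)) (fromℕ-* (suc n) (n !)) ⟨
    b * (fromℕ (suc n !) * c) ≡⟨ cong (b *_) (fromℕ*1/ℕ (suc n !) {{ℕ._!≢0 (suc n)}}) ⟩
    b * 1ℚ                ≡⟨ ℚ.*-identityʳ b ⟩
    b                     ∎
    where
    open ≡-Reasoning
    a b c d : ℚ
    a = fromℕ (suc n)
    b = 1/ n !
    c = 1/ suc n !
    d = fromℕ (n !)
    ring₁ : ∀ x y → x ≡ 1ℚ * x
    ring₁ = solve-∀ ℚ-ring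
    ring₂ : ∀ a b c d → (d * b) * (a * c) ≡ b * ((a * d) * c)
    ring₂ = solve-∀ ℚ-ring

  !*1/! : ∀ n → fromℕ (n !) * 1/ n ! ≡ 1ℚ
  !*1/! n = fromℕ*1/ℕ (n !) {{ℕ._!≢0 n}}

  -- Finite sums

  -- Iverson bracket: sums over filtered lists become weighted sums over a fixed list, which can be
  -- exchanged with other sums.
  ⟦_⟧ : Bool → ℚ
  ⟦ true ⟧  = 1ℚ
  ⟦ false ⟧ = 0ℚ

  module _ {A : Set} where

    ∑-cong∈ : ∀ {f g : A → ℚ} xs → (∀ {x} → x ∈ xs → f x ≡ g x) → ∑ xs f ≡ ∑ xs g
    ∑-cong∈ []       h = refl
    ∑-cong∈ (x ∷ xs) h = cong₂ _+_ (h (here refl)) (∑-cong∈ xs (h ∘ there))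

    ∑-cong : ∀ {f g : A → ℚ} xs → (∀ x → f x ≡ g x) → ∑ xs f ≡ ∑ xs g
    ∑-cong xs h = ∑-cong∈ xs (λ {x} _ → h x)

    ∑-zero : ∀ (xs : List A) → ∑ xs (λ _ → 0ℚ) ≡ 0ℚ
    ∑-zero []       = refl
    ∑-zero (x ∷ xs) = trans (ℚ.+-identityˡ _) (∑-zero xs)

    ∑-0 : ∀ {f : A → ℚ} xs → (∀ {x} → x ∈ xs → f x ≡ 0ℚ) → ∑ xs f ≡ 0ℚ
    ∑-0 xs h = trans (∑-cong∈ xs h) (∑-zero xs)

    ∑-+ : ∀ (f g : A → ℚ) xs → ∑ xs (λ x → f x + g x) ≡ ∑ xs f + ∑ xs g
    ∑-+ f g []       = refl
    ∑-+ f g (x ∷ xs) = trans (cong (f x + g x +_) (∑-+ f g xs)) (ring (f x) (g x) (∑ xs f) (∑ xs g))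
      where
      ring : ∀ a b c d → a + b + (c + d) ≡ a + c + (b + d)
      ring = solve-∀ ℚ-ring

    ∑-*ˡ : ∀ c (f : A → ℚ) xs → ∑ xs (λ x → c * f x) ≡ c * ∑ xs f
    ∑-*ˡ c f []       = sym (ℚ.*-zeroʳ c)
    ∑-*ˡ c f (x ∷ xs) = trans (cong (c * f x +_) (∑-*ˡ c f xs)) (sym (ℚ.*-distribˡ-+ c (f x) (∑ xs f)))

    ∑-*ʳ : ∀ c (f : A → ℚ) xs → ∑ xs (λ x → f x * c) ≡ ∑ xs f * c
    ∑-*ʳ c f xs = trans (∑-cong xs (λ x → ℚ.*-comm (f x) c)) (trans (∑-*ˡ c f xs) (ℚ.*-comm c _))

    ∑-neg : ∀ (f : A → ℚ) xs → ∑ xs (λ x → - f x) ≡ - ∑ xs f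
    ∑-neg f []       = refl
    ∑-neg f (x ∷ xs) = trans (cong (- f x +_) (∑-neg f xs)) (sym (ℚ.neg-distrib-+ (f x) (∑ xs f)))

    ∑-- : ∀ (f g : A → ℚ) xs → ∑ xs (λ x → f x - g x) ≡ ∑ xs f - ∑ xs g
    ∑-- f g xs = trans (∑-+ f (-_ ∘ g) xs) (cong (∑ xs f +_) (∑-neg g xs))

    ∑-++ : ∀ (f : A → ℚ) xs ys → ∑ (xs ++ ys) f ≡ ∑ xs f + ∑ ys f
    ∑-++ f []       ys = sym (ℚ.+-identityˡ _)
    ∑-++ f (x ∷ xs) ys = trans (cong (f x +_) (∑-++ f xs ys)) (sym (ℚ.+-assoc (f x) _ _))

    ∑-filter : ∀ {p} {P : Pred A p} (P? : Decidable P) (f : A → ℚ) xs →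
      ∑ (filter P? xs) f ≡ ∑ xs (λ x → ⟦ does (P? x) ⟧ * f x)
    ∑-filter P? f []       = refl
    ∑-filter P? f (x ∷ xs) with does (P? x)
    ... | true  = cong₂ _+_ (sym (ℚ.*-identityˡ (f x))) (∑-filter P? f xs)
    ... | false = trans (∑-filter P? f xs) (trans (sym (ℚ.+-identityˡ _)) (cong (_+ _) (sym (ℚ.*-zeroˡ (f x)))))

    ∑-↭ : ∀ (f : A → ℚ) {xs ys} → xs ↭ ys → ∑ xs f ≡ ∑ ys f
    ∑-↭ f ↭.refl         = refl
    ∑-↭ f (↭.prep x p)   = cong (f x +_) (∑-↭ f p)
    ∑-↭ f {ys = _ ∷ _ ∷ ys} (↭.swap x y p) = trans (cong (λ s → f x + (f y + s)) (∑-↭ f p)) (ring (f x) (f y) (∑ ys f))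
      where
      ring : ∀ a b c → a + (b + c) ≡ b + (a + c)
      ring = solve-∀ ℚ-ring
    ∑-↭ f (↭.trans p q)  = trans (∑-↭ f p) (∑-↭ f q)

  module _ {A B : Set} where

    ∑-map : ∀ (f : B → ℚ) (g : A → B) xs → ∑ (map g xs) f ≡ ∑ xs (f ∘ g)
    ∑-map f g []       = refl
    ∑-map f g (x ∷ xs) = cong (f (g x) +_) (∑-map f g xs)

    ∑-concatMap : ∀ (f : B → ℚ) (g : A → List B) xs → ∑ (concatMap g xs) f ≡ ∑ xs (λ x → ∑ (g x) f)
    ∑-concatMap f g []       = refl
    ∑-concatMap f g (x ∷ xs) = trans (∑-++ f (g x) (concatMap g xs)) (cong (∑ (g x) f +_) (∑-concatMap f g xs))

    ∑-swap : ∀ (f : A → B → ℚ) xs ys →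
      ∑ xs (λ x → ∑ ys (λ y → f x y)) ≡ ∑ ys (λ y → ∑ xs (λ x → f x y))
    ∑-swap f []       ys = sym (∑-zero ys)
    ∑-swap f (x ∷ xs) ys = trans (cong (∑ ys (f x) +_) (∑-swap f xs ys)) (sym (∑-+ (f x) _ ys))

  ∑-cartesianProductWith : ∀ {A B C : Set} (f : C → ℚ) (g : A → B → C) xs ys →
    ∑ (cartesianProductWith g xs ys) f ≡ ∑ xs (λ x → ∑ ys (λ y → f (g x y)))
  ∑-cartesianProductWith f g []       ys = refl
  ∑-cartesianProductWith f g (x ∷ xs) ys =
    trans (∑-++ f (map (g x) ys) _) (cong₂ _+_ (∑-map f (g x) ys) (∑-cartesianProductWith f g xs ys))

  ∑-upTo-suc : ∀ n (f : ℕ → ℚ) → ∑ (upTo (suc n)) f ≡ f 0 + ∑ (upTo n) (f ∘ suc)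
  ∑-upTo-suc n f = cong (f 0 +_) (trans (cong (λ xs → ∑ xs f) (sym (List.map-upTo suc n))) (∑-map f suc (upTo n)))

  ∑-upTo-cong : ∀ n {f g : ℕ → ℚ} → (∀ {i} → i < n → f i ≡ g i) → ∑ (upTo n) f ≡ ∑ (upTo n) g
  ∑-upTo-cong n h = ∑-cong∈ (upTo n) (h ∘ ∈-upTo⁻)

  ∑-upTo-0 : ∀ n {f : ℕ → ℚ} → (∀ {i} → i < n → f i ≡ 0ℚ) → ∑ (upTo n) f ≡ 0ℚ
  ∑-upTo-0 n h = trans (∑-upTo-cong n h) (∑-zero (upTo n))

  ∑-upTo-+ : ∀ m n (f : ℕ → ℚ) → ∑ (upTo (m ℕ.+ n)) f ≡ ∑ (upTo m) f + ∑ (upTo n) (f ∘ (m ℕ.+_))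
  ∑-upTo-+ zero    n f = sym (ℚ.+-identityˡ _)
  ∑-upTo-+ (suc m) n f = begin
    ∑ (upTo (suc (m ℕ.+ n))) f                    ≡⟨ ∑-upTo-suc (m ℕ.+ n) f ⟩
    f 0 + ∑ (upTo (m ℕ.+ n)) (f ∘ suc)            ≡⟨ cong (f 0 +_) (∑-upTo-+ m n (f ∘ suc)) ⟩
    f 0 + (∑ (upTo m) (f ∘ suc) + b)              ≡⟨ ℚ.+-assoc (f 0) _ b ⟨
    f 0 + ∑ (upTo m) (f ∘ suc) + b                ≡⟨ cong (_+ b) (∑-upTo-suc m f) ⟨
    ∑ (upTo (suc m)) f + b                        ∎
    where
    open ≡-Reasoning
    b : ℚ
    b = ∑ (upTo n) (f ∘ (suc m ℕ.+_))

  ∑-upTo-snoc : ∀ n (f : ℕ → ℚ) → ∑ (upTo (suc n)) f ≡ ∑ (upTo n) f + f n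
  ∑-upTo-snoc n f = begin
    ∑ (upTo (suc n)) f                            ≡⟨ cong (λ k → ∑ (upTo k) f) (ℕ.+-comm 1 n) ⟩
    ∑ (upTo (n ℕ.+ 1)) f                          ≡⟨ ∑-upTo-+ n 1 f ⟩
    ∑ (upTo n) f + (f (n ℕ.+ 0) + 0ℚ)             ≡⟨ cong (∑ (upTo n) f +_) (ℚ.+-identityʳ _) ⟩
    ∑ (upTo n) f + f (n ℕ.+ 0)                    ≡⟨ cong (λ k → ∑ (upTo n) f + f k) (ℕ.+-identityʳ n) ⟩
    ∑ (upTo n) f + f n                            ∎
    where open ≡-Reasoning

  ∑-upTo-extend : ∀ {m n} (f : ℕ → ℚ) → m ≤ n → (∀ {i} → m ≤ i → f i ≡ 0ℚ) → ∑ (upTo n) f ≡ ∑ (upTo m) f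
  ∑-upTo-extend {m} {n} f m≤n h = begin
    ∑ (upTo n) f                                  ≡⟨ cong (λ k → ∑ (upTo k) f) (ℕ.m+[n∸m]≡n m≤n) ⟨
    ∑ (upTo (m ℕ.+ (n ∸ m))) f                    ≡⟨ ∑-upTo-+ m (n ∸ m) f ⟩
    ∑ (upTo m) f + ∑ (upTo (n ∸ m)) (f ∘ (m ℕ.+_)) ≡⟨ cong (∑ (upTo m) f +_) (∑-upTo-0 (n ∸ m) (λ {i} _ → h (ℕ.m≤m+n m i))) ⟩
    ∑ (upTo m) f + 0ℚ                             ≡⟨ ℚ.+-identityʳ _ ⟩
    ∑ (upTo m) f                                  ∎
    where open ≡-Reasoning

  ∑-upTo-reverse : ∀ n (f : ℕ → ℚ) → ∑ (upTo n) f ≡ ∑ (upTo n) (λ i → f (n ∸ suc i))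
  ∑-upTo-reverse zero    f = refl
  ∑-upTo-reverse (suc n) f = begin
    ∑ (upTo (suc n)) f                            ≡⟨ ∑-upTo-snoc n f ⟩
    ∑ (upTo n) f + f n                            ≡⟨ ℚ.+-comm _ (f n) ⟩
    f n + ∑ (upTo n) f                            ≡⟨ cong (f n +_) (∑-upTo-reverse n f) ⟩
    f n + ∑ (upTo n) (λ i → f (n ∸ suc i))        ≡⟨ ∑-upTo-suc n (λ i → f (n ∸ i)) ⟨
    ∑ (upTo (suc n)) (λ i → f (n ∸ i))            ∎
    where open ≡-Reasoning

  ∑-upTo-δ : ∀ n j (f : ℕ → ℚ) → j < n → ∑ (upTo n) (λ i → ⟦ does (j ℕ.≟ i) ⟧ * f i) ≡ f j
  ∑-upTo-δ (suc n) zero f _ = begin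
    ∑ (upTo (suc n)) g                  ≡⟨ ∑-upTo-suc n g ⟩
    1ℚ * f 0 + ∑ (upTo n) (g ∘ suc)     ≡⟨ cong₂ _+_ (ℚ.*-identityˡ (f 0)) (∑-upTo-0 n (λ {i} _ → ℚ.*-zeroˡ (f (suc i)))) ⟩
    f 0 + 0ℚ                            ≡⟨ ℚ.+-identityʳ (f 0) ⟩
    f 0                                 ∎
    where
    open ≡-Reasoning
    g : ℕ → ℚ
    g i = ⟦ does (0 ℕ.≟ i) ⟧ * f i
  ∑-upTo-δ (suc n) (suc j) f (s<s j<n) = begin
    ∑ (upTo (suc n)) g                  ≡⟨ ∑-upTo-suc n g ⟩
    0ℚ * f 0 + ∑ (upTo n) (g ∘ suc)     ≡⟨ cong₂ _+_ (ℚ.*-zeroˡ (f 0)) (∑-upTo-δ n j (f ∘ suc) j<n) ⟩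
    0ℚ + f (suc j)                      ≡⟨ ℚ.+-identityˡ (f (suc j)) ⟩
    f (suc j)                           ∎
    where
    open ≡-Reasoning
    g : ℕ → ℚ
    g i = ⟦ does (suc j ℕ.≟ i) ⟧ * f i

  -- Powers, their derivatives and Taylor's formula for one power

  ^-* : ∀ x y n → (x * y) ^ n ≡ x ^ n * y ^ n
  ^-* x y zero    = refl
  ^-* x y (suc n) = trans (cong (x * y *_) (^-* x y n)) (ring x y (x ^ n) (y ^ n))
    where
    ring : ∀ a b c d → a * b * (c * d) ≡ a * c * (b * d)
    ring = solve-∀ ℚ-ring

  ^-+ : ∀ x m n → x ^ (m ℕ.+ n) ≡ x ^ m * x ^ n
  ^-+ x zero    n = sym (ℚ.*-identityˡ (x ^ n))
  ^-+ x (suc m) n = trans (cong (x *_) (^-+ x m n)) (sym (ℚ.*-assoc x (x ^ m) (x ^ n)))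

  1^ : ∀ n → 1ℚ ^ n ≡ 1ℚ
  1^ zero    = refl
  1^ (suc n) = trans (ℚ.*-identityˡ (1ℚ ^ n)) (1^ n)

  fromℕ-^ : ∀ m n → fromℕ (m ℕ.^ n) ≡ fromℕ m ^ n
  fromℕ-^ m zero    = refl
  fromℕ-^ m (suc n) = trans (fromℕ-* m (m ℕ.^ n)) (cong (fromℕ m *_) (fromℕ-^ m n))

  -- D a d n is the n-th derivative of t ↦ tᵈ at a.
  D : ℚ → ℕ → ℕ → ℚ
  D a d       zero    = a ^ d
  D a zero    (suc n) = 0ℚ
  D a (suc d) (suc n) = fromℕ (suc d) * D a d n

  -- `D` lowers exponent and order together, whereas this is the Leibniz rule for t · t^d. It is the
  -- recursion that suits Taylor's formula and coefficient lists, both of which grow by a factor t.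
  D-leibniz : ∀ a d n → D a (suc d) (suc n) ≡ a * D a d (suc n) + fromℕ (suc n) * D a d n
  D-leibniz a zero    zero    = ring a
    where
    ring : ∀ a → 1ℚ * 1ℚ ≡ a * 0ℚ + 1ℚ * 1ℚ
    ring = solve-∀ ℚ-ring
  D-leibniz a zero    (suc n) = ring a (fromℕ (suc (suc n)))
    where
    ring : ∀ a b → 1ℚ * 0ℚ ≡ a * 0ℚ + b * 0ℚ
    ring = solve-∀ ℚ-ring
  D-leibniz a (suc d) zero    = begin
    fromℕ (suc (suc d)) * (a * a ^ d)               ≡⟨ cong (_* (a * a ^ d)) (fromℕ-suc (suc d)) ⟩
    (1ℚ + fromℕ (suc d)) * (a * a ^ d)              ≡⟨ ring a (fromℕ (suc d)) (a ^ d) ⟩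
    a * (fromℕ (suc d) * a ^ d) + 1ℚ * (a * a ^ d)  ∎
    where
    open ≡-Reasoning
    ring : ∀ a b c → (1ℚ + b) * (a * c) ≡ a * (b * c) + 1ℚ * (a * c)
    ring = solve-∀ ℚ-ring
  D-leibniz a (suc d) (suc n) = begin
    fromℕ (suc (suc d)) * (p * y)       ≡⟨ cong (_* (p * y)) (fromℕ-suc (suc d)) ⟩
    (1ℚ + p) * (p * y)                  ≡⟨ ring₁ p (p * y) ⟩
    p * y + p * (p * y)                 ≡⟨ cong (λ z → p * y + p * z) (D-leibniz a d n) ⟩
    p * y + p * (a * x + r * y)         ≡⟨ ring₂ p y a x r ⟩
    a * (p * x) + (1ℚ + r) * (p * y)    ≡⟨ cong (λ z → a * (p * x) + z * (p * y)) (fromℕ-suc (suc n)) ⟨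
    a * (p * x) + fromℕ (suc (suc n)) * (p * y) ∎
    where
    open ≡-Reasoning
    p r x y : ℚ
    p = fromℕ (suc d)
    r = fromℕ (suc n)
    x = D a d (suc n)
    y = D a d n
    ring₁ : ∀ p z → (1ℚ + p) * z ≡ z + p * z
    ring₁ = solve-∀ ℚ-ring
    ring₂ : ∀ p y a x r → p * y + p * (a * x + r * y) ≡ a * (p * x) + (1ℚ + r) * (p * y)
    ring₂ = solve-∀ ℚ-ring

  D-vanishes : ∀ a {d n} → d < n → D a d n ≡ 0ℚ
  D-vanishes a {zero}  {suc n} _         = refl
  D-vanishes a {suc d} {suc n} (s<s d<n) =
    trans (cong (fromℕ (suc d) *_) (D-vanishes a d<n)) (ℚ.*-zeroʳ (fromℕ (suc d)))

  D-top : ∀ a n → D a n n ≡ fromℕ (n !)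
  D-top a zero    = refl
  D-top a (suc n) = trans (cong (fromℕ (suc n) *_) (D-top a n)) (sym (fromℕ-* (suc n) (n !)))

  -- Coefficients of e^(bz). Paired with the derivatives at a they give the shift operator e^(bD),
  -- hence values at a + b.
  ε : ℚ → Series
  ε b n = b ^ n * 1/ n !

  ε-suc : ∀ b n → fromℕ (suc n) * ε b (suc n) ≡ b * ε b n
  ε-suc b n = trans (ring (fromℕ (suc n)) b (b ^ n) (1/ suc n !)) (cong (λ z → b * (b ^ n * z)) (1/!-suc n))
    where
    ring : ∀ s b c f → s * (b * c * f) ≡ b * (c * (s * f))
    ring = solve-∀ ℚ-ring

  -- Induction on d: the Leibniz rule splits the sum for t · t^d into a times the sum for t^d and,
  -- as (n + 1) b^(n+1)/(n+1)! = b · b^n/n!, b times the same sum. The bound B > d admits all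
  -- nonzero derivatives.
  D-taylor₀ : ∀ a b d {B} → d < B → ∑[ n ∈ upTo B ] ε b n * D a d n ≡ (a + b) ^ d
  D-taylor₀ a b zero    {suc B} _ = begin
    ∑[ n ∈ upTo (suc B) ] ε b n * D a 0 n                       ≡⟨ ∑-upTo-suc B (λ n → ε b n * D a 0 n) ⟩
    1ℚ * 1ℚ * 1ℚ + (∑[ n ∈ upTo B ] ε b (suc n) * 0ℚ)           ≡⟨ cong (1ℚ +_) (∑-0 (upTo B) (λ {n} _ → ℚ.*-zeroʳ (ε b (suc n)))) ⟩
    1ℚ                                                          ∎
    where open ≡-Reasoning
  D-taylor₀ a b (suc d) {suc B} (s<s d<B) = begin
    ∑[ n ∈ upTo (suc B) ] ε b n * D a (suc d) n
      ≡⟨ ∑-upTo-suc B (λ n → ε b n * D a (suc d) n) ⟩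
    1ℚ * 1ℚ * (a * a ^ d) + (∑[ n ∈ upTo B ] ε b (suc n) * D a (suc d) (suc n))
      ≡⟨ cong (1ℚ * 1ℚ * (a * a ^ d) +_) (∑-cong (upTo B) step) ⟩
    1ℚ * 1ℚ * (a * a ^ d) + (∑[ n ∈ upTo B ] (a * (ε b (suc n) * D a d (suc n)) + b * (ε b n * D a d n)))
      ≡⟨ cong (1ℚ * 1ℚ * (a * a ^ d) +_) (trans (∑-+ _ _ (upTo B)) (cong₂ _+_ (∑-*ˡ a _ (upTo B)) (∑-*ˡ b _ (upTo B)))) ⟩
    1ℚ * 1ℚ * (a * a ^ d) + (a * s₁ + b * (∑[ n ∈ upTo B ] ε b n * D a d n))
      ≡⟨ cong (λ z → 1ℚ * 1ℚ * (a * a ^ d) + (a * s₁ + b * z)) (D-taylor₀ a b d d<B) ⟩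
    1ℚ * 1ℚ * (a * a ^ d) + (a * s₁ + b * (a + b) ^ d)
      ≡⟨ ring a b (a ^ d) s₁ ((a + b) ^ d) ⟩
    a * (1ℚ * 1ℚ * a ^ d + s₁) + b * (a + b) ^ d
      ≡⟨ cong (λ z → a * z + b * (a + b) ^ d) (sym (∑-upTo-suc B (λ n → ε b n * D a d n))) ⟩
    a * (∑[ n ∈ upTo (suc B) ] ε b n * D a d n) + b * (a + b) ^ d
      ≡⟨ cong (λ z → a * z + b * (a + b) ^ d) (D-taylor₀ a b d (ℕ.m<n⇒m<1+n d<B)) ⟩
    a * (a + b) ^ d + b * (a + b) ^ d
      ≡⟨ ℚ.*-distribʳ-+ ((a + b) ^ d) a b ⟨
    (a + b) * (a + b) ^ d ∎
    where
    open ≡-Reasoning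
    s₁ : ℚ
    s₁ = ∑[ n ∈ upTo B ] ε b (suc n) * D a d (suc n)
    ring : ∀ a b p s q → 1ℚ * 1ℚ * (a * p) + (a * s + b * q) ≡ a * (1ℚ * 1ℚ * p + s) + b * q
    ring = solve-∀ ℚ-ring
    ring₁ : ∀ e a x s y → e * (a * x + s * y) ≡ a * (e * x) + (s * e) * y
    ring₁ = solve-∀ ℚ-ring
    step : ∀ n → ε b (suc n) * D a (suc d) (suc n) ≡ a * (ε b (suc n) * D a d (suc n)) + b * (ε b n * D a d n)
    step n = begin
      ε b (suc n) * D a (suc d) (suc n)                                  ≡⟨ cong (ε b (suc n) *_) (D-leibniz a d n) ⟩
      ε b (suc n) * (a * D a d (suc n) + fromℕ (suc n) * D a d n)        ≡⟨ ring₁ (ε b (suc n)) a (D a d (suc n)) (fromℕ (suc n)) (D a d n) ⟩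
      a * (ε b (suc n) * D a d (suc n)) + fromℕ (suc n) * ε b (suc n) * D a d n
        ≡⟨ cong (λ z → a * (ε b (suc n) * D a d (suc n)) + z * D a d n) (ε-suc b n) ⟩
      a * (ε b (suc n) * D a d (suc n)) + b * ε b n * D a d n            ≡⟨ cong (a * (ε b (suc n) * D a d (suc n)) +_) (ℚ.*-assoc b _ _) ⟩
      a * (ε b (suc n) * D a d (suc n)) + b * (ε b n * D a d n)          ∎

  D-taylor : ∀ a b d k {B} → d < B → ∑[ n ∈ upTo B ] ε b n * D a d (k ℕ.+ n) ≡ D (a + b) d k
  D-taylor a b d       zero    d<B = D-taylor₀ a b d d<B
  D-taylor a b zero    (suc k) {B} d<B = ∑-0 (upTo B) (λ {n} _ → ℚ.*-zeroʳ (ε b n))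
  D-taylor a b (suc d) (suc k) {B} d<B = begin
    ∑[ n ∈ upTo B ] ε b n * (fromℕ (suc d) * D a d (k ℕ.+ n))
      ≡⟨ ∑-cong (upTo B) (λ n → ring (ε b n) (fromℕ (suc d)) (D a d (k ℕ.+ n))) ⟩
    ∑[ n ∈ upTo B ] fromℕ (suc d) * (ε b n * D a d (k ℕ.+ n))
      ≡⟨ ∑-*ˡ (fromℕ (suc d)) _ (upTo B) ⟩
    fromℕ (suc d) * (∑[ n ∈ upTo B ] ε b n * D a d (k ℕ.+ n))
      ≡⟨ cong (fromℕ (suc d) *_) (D-taylor a b d k (ℕ.<-trans (ℕ.n<1+n d) d<B)) ⟩
    fromℕ (suc d) * D (a + b) d k ∎
    where
    open ≡-Reasoning
    ring : ∀ x y z → x * (y * z) ≡ y * (x * z)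
    ring = solve-∀ ℚ-ring

  -- Polynomials as functionals

  -- The linear functional on polynomials with values z_d on t^d. Evaluation and derivatives at a
  -- point are of this form, so identities between them are checked on powers of t.
  pair : Series → Poly → ℚ
  pair z []      = 0ℚ
  pair z (a ∷ f) = a * z 0 + pair (z ∘ suc) f

  pair-cong : ∀ {y z} f → (∀ {d} → d < length f → y d ≡ z d) → pair y f ≡ pair z f
  pair-cong []      h = refl
  pair-cong (a ∷ f) h = cong₂ _+_ (cong (a *_) (h (s≤s z≤n))) (pair-cong f (h ∘ s≤s))

  pair-0 : ∀ {z} f → (∀ {d} → d < length f → z d ≡ 0ℚ) → pair z f ≡ 0ℚ
  pair-0 []      h = refl
  pair-0 (a ∷ f) h = cong₂ _+_ (trans (cong (a *_) (h (s≤s z≤n))) (ℚ.*-zeroʳ a)) (pair-0 f (h ∘ s≤s))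

  pair-linear : ∀ c y z f → pair (λ d → c * y d + z d) f ≡ c * pair y f + pair z f
  pair-linear c y z []      = sym (trans (ℚ.+-identityʳ _) (ℚ.*-zeroʳ c))
  pair-linear c y z (a ∷ f) =
    trans (cong (a * (c * y 0 + z 0) +_) (pair-linear c (y ∘ suc) (z ∘ suc) f))
          (ring a c (y 0) (z 0) (pair (y ∘ suc) f) (pair (z ∘ suc) f))
    where
    ring : ∀ a c y z p q → a * (c * y + z) + (c * p + q) ≡ c * (a * y + p) + (a * z + q)
    ring = solve-∀ ℚ-ring

  pair-∑ : ∀ {A : Set} (c : A → ℚ) (z : A → Series) xs f →
    pair (λ d → ∑[ x ∈ xs ] c x * z x d) f ≡ ∑[ x ∈ xs ] c x * pair (z x) f
  pair-∑ c z []       f = pair-0 f (λ _ → refl)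
  pair-∑ c z (x ∷ xs) f =
    trans (pair-linear (c x) (z x) _ f) (cong (c x * pair (z x) f +_) (pair-∑ c z xs f))

  δ : ℚ → ℕ → Poly → ℚ
  δ a n = pair (λ d → D a d n)

  value : ℚ → Poly → ℚ
  value a = δ a 0

  δ-taylor : ∀ a b k f {B} → length f ≤ B → ∑[ n ∈ upTo B ] ε b n * δ a (k ℕ.+ n) f ≡ δ (a + b) k f
  δ-taylor a b k f {B} l≤B = trans
    (sym (pair-∑ (ε b) (λ n d → D a d (k ℕ.+ n)) (upTo B) f))
    (pair-cong f (λ d<l → D-taylor a b _ k (ℕ.<-≤-trans d<l l≤B)))

  δ-vanishes : ∀ a n f → length f ≤ n → δ a n f ≡ 0ℚ
  δ-vanishes a n f l≤n = pair-0 f (λ d<l → D-vanishes a (ℕ.<-≤-trans d<l l≤n))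

  value-∷ : ∀ a c f → value a (c ∷ f) ≡ c + a * value a f
  value-∷ a c f = cong₂ _+_ (ℚ.*-identityʳ c) (begin
    pair (λ d → a * a ^ d) f           ≡⟨ pair-cong f (λ {d} _ → sym (ℚ.+-identityʳ (a * a ^ d))) ⟩
    pair (λ d → a * a ^ d + 0ℚ) f      ≡⟨ pair-linear a (a ^_) (λ _ → 0ℚ) f ⟩
    a * value a f + pair (λ _ → 0ℚ) f  ≡⟨ cong (a * value a f +_) (pair-0 f (λ _ → refl)) ⟩
    a * value a f + 0ℚ                 ≡⟨ ℚ.+-identityʳ _ ⟩
    a * value a f                      ∎)
    where open ≡-Reasoning

  δ-∷ : ∀ a n c f → δ a (suc n) (c ∷ f) ≡ a * δ a (suc n) f + fromℕ (suc n) * δ a n f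
  δ-∷ a n c f = begin
    c * 0ℚ + pair (λ d → D a (suc d) (suc n)) f
      ≡⟨ cong₂ _+_ (ℚ.*-zeroʳ c) (pair-cong f (λ {d} _ → trans (D-leibniz a d n) (cong (a * D a d (suc n) +_) (sym (ℚ.+-identityʳ _))))) ⟩
    0ℚ + pair (λ d → a * D a d (suc n) + (fromℕ (suc n) * D a d n + 0ℚ)) f
      ≡⟨ ℚ.+-identityˡ _ ⟩
    pair (λ d → a * D a d (suc n) + (fromℕ (suc n) * D a d n + 0ℚ)) f
      ≡⟨ pair-linear a _ _ f ⟩
    a * δ a (suc n) f + pair (λ d → fromℕ (suc n) * D a d n + 0ℚ) f
      ≡⟨ cong (a * δ a (suc n) f +_) (pair-linear (fromℕ (suc n)) _ _ f) ⟩
    a * δ a (suc n) f + (fromℕ (suc n) * δ a n f + pair (λ _ → 0ℚ) f)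
      ≡⟨ cong (λ z → a * δ a (suc n) f + (fromℕ (suc n) * δ a n f + z)) (pair-0 f (λ _ → refl)) ⟩
    a * δ a (suc n) f + (fromℕ (suc n) * δ a n f + 0ℚ)
      ≡⟨ cong (a * δ a (suc n) f +_) (ℚ.+-identityʳ _) ⟩
    a * δ a (suc n) f + fromℕ (suc n) * δ a n f ∎
    where open ≡-Reasoning

  coeff-+ : ∀ n f g → coeff n (f +ᴾ g) ≡ coeff n f + coeff n g
  coeff-+ n       []      g       = sym (ℚ.+-identityˡ _)
  coeff-+ zero    (a ∷ f) []      = sym (ℚ.+-identityʳ _)
  coeff-+ (suc n) (a ∷ f) []      = sym (ℚ.+-identityʳ _)
  coeff-+ zero    (a ∷ f) (b ∷ g) = refl
  coeff-+ (suc n) (a ∷ f) (b ∷ g) = coeff-+ n f g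

  coeff-· : ∀ n a f → coeff n (a ·ᴾ f) ≡ a * coeff n f
  coeff-· n       a []      = sym (ℚ.*-zeroʳ a)
  coeff-· zero    a (b ∷ f) = refl
  coeff-· (suc n) a (b ∷ f) = coeff-· n a f

  coeff-- : ∀ n f g → coeff n (f -ᴾ g) ≡ coeff n f - coeff n g
  coeff-- n f g = trans (coeff-+ n f ((- 1ℚ) ·ᴾ g)) (cong (coeff n f +_) (trans (coeff-· n (- 1ℚ) g) (ring (coeff n g))))
    where
    ring : ∀ x → (- 1ℚ) * x ≡ - x
    ring = solve-∀ ℚ-ring

  coeff-[] : ∀ n → coeff n (0ℚ ∷ []) ≡ 0ℚ
  coeff-[] zero    = refl
  coeff-[] (suc n) = refl

  coeff-linear*-zero : ∀ b f → coeff 0 ((b ∷ 1ℚ ∷ []) *ᴾ f) ≡ b * coeff 0 f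
  coeff-linear*-zero b f = trans (coeff-+ 0 (b ·ᴾ f) _) (trans (ℚ.+-identityʳ _) (coeff-· 0 b f))

  coeff-linear*-suc : ∀ n b f → coeff (suc n) ((b ∷ 1ℚ ∷ []) *ᴾ f) ≡ b * coeff (suc n) f + coeff n f
  coeff-linear*-suc n b f = begin
    coeff (suc n) ((b ∷ 1ℚ ∷ []) *ᴾ f)                            ≡⟨ coeff-+ (suc n) (b ·ᴾ f) _ ⟩
    coeff (suc n) (b ·ᴾ f) + coeff n (1ℚ ·ᴾ f +ᴾ (0ℚ ∷ []))       ≡⟨ cong₂ _+_ (coeff-· (suc n) b f) (coeff-+ n (1ℚ ·ᴾ f) (0ℚ ∷ [])) ⟩
    b * coeff (suc n) f + (coeff n (1ℚ ·ᴾ f) + coeff n (0ℚ ∷ [])) ≡⟨ cong (b * coeff (suc n) f +_) (cong₂ _+_ (trans (coeff-· n 1ℚ f) (ℚ.*-identityˡ (coeff n f))) (coeff-[] n)) ⟩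
    b * coeff (suc n) f + (coeff n f + 0ℚ)                        ≡⟨ cong (b * coeff (suc n) f +_) (ℚ.+-identityʳ _) ⟩
    b * coeff (suc n) f + coeff n f                               ∎
    where open ≡-Reasoning

  -- Taylor's formula at b. The Horner recursion of `_at_` for t ↦ t + b and the Leibniz rule `δ-∷`
  -- produce the same recursion in n.
  coeff-at : ∀ b f n → fromℕ (n !) * coeff n (f at (b ∷ 1ℚ ∷ [])) ≡ δ b n f
  coeff-at b []      n       = ℚ.*-zeroʳ (fromℕ (n !))
  coeff-at b (a ∷ f) zero    = begin
    1ℚ * coeff 0 ((a ∷ []) +ᴾ g)           ≡⟨ ℚ.*-identityˡ _ ⟩
    coeff 0 ((a ∷ []) +ᴾ g)                ≡⟨ coeff-+ 0 (a ∷ []) g ⟩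
    a + coeff 0 g                          ≡⟨ cong (a +_) (coeff-linear*-zero b (f at (b ∷ 1ℚ ∷ []))) ⟩
    a + b * coeff 0 (f at (b ∷ 1ℚ ∷ []))   ≡⟨ cong (λ z → a + b * z) (trans (sym (ℚ.*-identityˡ _)) (coeff-at b f 0)) ⟩
    a + b * value b f                      ≡⟨ value-∷ b a f ⟨
    value b (a ∷ f)                        ∎
    where
    open ≡-Reasoning
    g : Poly
    g = (b ∷ 1ℚ ∷ []) *ᴾ (f at (b ∷ 1ℚ ∷ []))
  coeff-at b (a ∷ f) (suc n) = begin
    k * coeff (suc n) ((a ∷ []) +ᴾ g)                        ≡⟨ cong (k *_) (trans (coeff-+ (suc n) (a ∷ []) g) (ℚ.+-identityˡ _)) ⟩
    k * coeff (suc n) g                                      ≡⟨ cong (k *_) (coeff-linear*-suc n b h) ⟩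
    k * (b * coeff (suc n) h + coeff n h)                    ≡⟨ cong (_* (b * coeff (suc n) h + coeff n h)) (fromℕ-* (suc n) (n !)) ⟩
    fromℕ (suc n) * fromℕ (n !) * (b * coeff (suc n) h + coeff n h)
      ≡⟨ ring (fromℕ (suc n)) (fromℕ (n !)) b (coeff (suc n) h) (coeff n h) ⟩
    b * (fromℕ (suc n) * fromℕ (n !) * coeff (suc n) h) + fromℕ (suc n) * (fromℕ (n !) * coeff n h)
      ≡⟨ cong (λ z → b * (z * coeff (suc n) h) + fromℕ (suc n) * (fromℕ (n !) * coeff n h)) (fromℕ-* (suc n) (n !)) ⟨
    b * (k * coeff (suc n) h) + fromℕ (suc n) * (fromℕ (n !) * coeff n h)
      ≡⟨ cong₂ (λ y z → b * y + fromℕ (suc n) * z) (coeff-at b f (suc n)) (coeff-at b f n) ⟩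
    b * δ b (suc n) f + fromℕ (suc n) * δ b n f              ≡⟨ δ-∷ b n a f ⟨
    δ b (suc n) (a ∷ f)                                      ∎
    where
    open ≡-Reasoning
    k : ℚ
    k = fromℕ (suc n !)
    h g : Poly
    h = f at (b ∷ 1ℚ ∷ [])
    g = (b ∷ 1ℚ ∷ []) *ᴾ h
    ring : ∀ s t b x y → s * t * (b * x + y) ≡ b * (s * t * x) + s * (t * y)
    ring = solve-∀ ℚ-ring

  coeff-δ₀ : ∀ f n → fromℕ (n !) * coeff n f ≡ δ 0ℚ n f
  coeff-δ₀ []      n       = ℚ.*-zeroʳ (fromℕ (n !))
  coeff-δ₀ (a ∷ f) zero    = sym (trans (value-∷ 0ℚ a f) (ring a (value 0ℚ f)))
    where
    ring : ∀ a x → a + 0ℚ * x ≡ 1ℚ * a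
    ring = solve-∀ ℚ-ring
  coeff-δ₀ (a ∷ f) (suc n) = begin
    fromℕ (suc n !) * coeff n f                        ≡⟨ cong (_* coeff n f) (fromℕ-* (suc n) (n !)) ⟩
    fromℕ (suc n) * fromℕ (n !) * coeff n f            ≡⟨ ℚ.*-assoc (fromℕ (suc n)) (fromℕ (n !)) (coeff n f) ⟩
    fromℕ (suc n) * (fromℕ (n !) * coeff n f)          ≡⟨ cong (fromℕ (suc n) *_) (coeff-δ₀ f n) ⟩
    fromℕ (suc n) * δ 0ℚ n f                           ≡⟨ ring (δ 0ℚ (suc n) f) (fromℕ (suc n) * δ 0ℚ n f) ⟩
    0ℚ * δ 0ℚ (suc n) f + fromℕ (suc n) * δ 0ℚ n f     ≡⟨ δ-∷ 0ℚ n a f ⟨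
    δ 0ℚ (suc n) (a ∷ f)                               ∎
    where
    open ≡-Reasoning
    ring : ∀ x y → y ≡ 0ℚ * x + y
    ring = solve-∀ ℚ-ring

  integrate : ℕ → Poly → Poly
  integrate n []      = []
  integrate n (a ∷ f) = a * 1/ℕ (suc n) ∷ integrate (suc n) f

  integrate-unique : (I : ℕ → Poly → Poly) → (∀ n → I n [] ≡ []) →
    (∀ n a f → I n (a ∷ f) ≡ a * 1/ℕ (suc n) ∷ I (suc n) f) → ∀ n f → I n f ≡ integrate n f
  integrate-unique I I[] I∷ n []      = I[] n
  integrate-unique I I[] I∷ n (a ∷ f) =
    trans (I∷ n a f) (cong (a * 1/ℕ (suc n) ∷_) (integrate-unique I I[] I∷ (suc n) f))

  -- The local functions of antiderivative, eval and Q·_ have no names outside of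
  -- them; they are found by unification once their arguments have been
  -- generalised to variables.
  mutual
    antiderivative-integrate : ∀ f → antiderivative f ≡ 0ℚ ∷ integrate 0 f
    antiderivative-integrate []      = refl
    antiderivative-integrate (a ∷ f) = cong (λ g → 0ℚ ∷ a * 1/ℕ 1 ∷ g) (generalise a f)

    generalise : ∀ (a : ℚ) (f : Poly) → _ ≡ integrate 1 f
    generalise a f with a ∷ f | 1
    ... | g | n = local g n f

    local : ∀ (g : Poly) n f → _ ≡ integrate n f
    local g = integrate-unique _ (λ _ → refl) (λ _ _ _ → refl)

  pair-integrate : ∀ z y n f → (∀ d → z d ≡ fromℕ (suc (n ℕ.+ d)) * y d) → pair z (integrate n f) ≡ pair y f
  pair-integrate z y n []      h = refl
  pair-integrate z y n (a ∷ f) h = cong₂ _+_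
    (begin
      a * 1/ℕ (suc n) * z 0                              ≡⟨ cong (a * 1/ℕ (suc n) *_) (h 0) ⟩
      a * 1/ℕ (suc n) * (fromℕ (suc (n ℕ.+ 0)) * y 0)    ≡⟨ cong (λ m → a * 1/ℕ (suc n) * (fromℕ (suc m) * y 0)) (ℕ.+-identityʳ n) ⟩
      a * 1/ℕ (suc n) * (fromℕ (suc n) * y 0)            ≡⟨ ring a (1/ℕ (suc n)) (fromℕ (suc n)) (y 0) ⟩
      fromℕ (suc n) * 1/ℕ (suc n) * (a * y 0)            ≡⟨ cong (_* (a * y 0)) (fromℕ*1/ℕ (suc n)) ⟩
      1ℚ * (a * y 0)                                     ≡⟨ ℚ.*-identityˡ _ ⟩
      a * y 0                                            ∎)
    (pair-integrate (z ∘ suc) (y ∘ suc) (suc n) f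
      (λ d → trans (h (suc d)) (cong (λ m → fromℕ (suc m) * y (suc d)) (ℕ.+-suc n d))))
    where
    open ≡-Reasoning
    ring : ∀ a b c d → a * b * (c * d) ≡ c * b * (a * d)
    ring = solve-∀ ℚ-ring

  δ-antiderivative : ∀ a n f → δ a (suc n) (antiderivative f) ≡ δ a n f
  δ-antiderivative a n f = begin
    δ a (suc n) (antiderivative f)                                 ≡⟨ cong (δ a (suc n)) (antiderivative-integrate f) ⟩
    0ℚ * 0ℚ + pair (λ d → fromℕ (suc d) * D a d n) (integrate 0 f) ≡⟨ ℚ.+-identityˡ _ ⟩
    pair (λ d → fromℕ (suc d) * D a d n) (integrate 0 f)           ≡⟨ pair-integrate _ (λ d → D a d n) 0 f (λ _ → refl) ⟩
    δ a n f                                                        ∎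
    where open ≡-Reasoning

  coeff-∫₁ : ∀ n f → fromℕ (n !) * coeff n (∫₁ f) ≡ δ 1ℚ n (antiderivative f) - δ 0ℚ n (antiderivative f)
  coeff-∫₁ n f = begin
    fromℕ (n !) * coeff n (∫₁ f)                        ≡⟨ cong (fromℕ (n !) *_) (coeff-- n (F at (1ℚ ∷ 1ℚ ∷ [])) F) ⟩
    fromℕ (n !) * (coeff n (F at (1ℚ ∷ 1ℚ ∷ [])) - coeff n F)
      ≡⟨ ring (fromℕ (n !)) (coeff n (F at (1ℚ ∷ 1ℚ ∷ []))) (coeff n F) ⟩
    fromℕ (n !) * coeff n (F at (1ℚ ∷ 1ℚ ∷ [])) - fromℕ (n !) * coeff n F
      ≡⟨ cong₂ _-_ (coeff-at 1ℚ F n) (coeff-δ₀ F n) ⟩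
    δ 1ℚ n F - δ 0ℚ n F                                 ∎
    where
    open ≡-Reasoning
    F : Poly
    F = antiderivative f
    ring : ∀ a b c → a * (b - c) ≡ a * b - a * c
    ring = solve-∀ ℚ-ring

  -- Convolution of power series and reciprocals

  ∑-triangle : ∀ B (F : ℕ → ℕ → ℚ) →
    ∑[ N ∈ upTo B ] (∑[ k ∈ upTo (suc N) ] F k (N ∸ k)) ≡ ∑[ k ∈ upTo B ] ∑[ n ∈ upTo (B ∸ k) ] F k n
  ∑-triangle zero    F = refl
  ∑-triangle (suc B) F = begin
    ∑[ N ∈ upTo (suc B) ] (∑[ k ∈ upTo (suc N) ] F k (N ∸ k))
      ≡⟨ ∑-cong (upTo (suc B)) (λ N → ∑-upTo-suc N (λ k → F k (N ∸ k))) ⟩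
    ∑[ N ∈ upTo (suc B) ] (F 0 N + (∑[ k ∈ upTo N ] F (suc k) (N ∸ suc k)))
      ≡⟨ ∑-+ (F 0) _ (upTo (suc B)) ⟩
    ∑ (upTo (suc B)) (F 0) + (∑[ N ∈ upTo (suc B) ] ∑[ k ∈ upTo N ] F (suc k) (N ∸ suc k))
      ≡⟨ cong (∑ (upTo (suc B)) (F 0) +_) (∑-upTo-suc B (λ N → ∑[ k ∈ upTo N ] F (suc k) (N ∸ suc k))) ⟩
    ∑ (upTo (suc B)) (F 0) + (0ℚ + (∑[ N ∈ upTo B ] ∑[ k ∈ upTo (suc N) ] F (suc k) (N ∸ k)))
      ≡⟨ cong (∑ (upTo (suc B)) (F 0) +_) (trans (ℚ.+-identityˡ _) (∑-triangle B (F ∘ suc))) ⟩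
    ∑ (upTo (suc B)) (F 0) + (∑[ k ∈ upTo B ] ∑[ n ∈ upTo (B ∸ k) ] F (suc k) n)
      ≡⟨ ∑-upTo-suc B (λ k → ∑[ n ∈ upTo (suc B ∸ k) ] F k n) ⟨
    ∑[ k ∈ upTo (suc B) ] ∑[ n ∈ upTo (suc B ∸ k) ] F k n ∎
    where open ≡-Reasoning

  ⊛-cong : ∀ {a a′ b b′ : Series} → a ≗ a′ → b ≗ b′ → a ⊛ b ≗ a′ ⊛ b′
  ⊛-cong p q n = ∑-cong (upTo (suc n)) (λ i → cong₂ _*_ (p i) (q (n ∸ i)))

  ⊛-comm : ∀ a b → a ⊛ b ≗ b ⊛ a
  ⊛-comm a b n = begin
    ∑[ i ∈ upTo (suc n) ] a i * b (n ∸ i)               ≡⟨ ∑-upTo-reverse (suc n) (λ i → a i * b (n ∸ i)) ⟩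
    ∑[ i ∈ upTo (suc n) ] a (n ∸ i) * b (n ∸ (n ∸ i))   ≡⟨ ∑-upTo-cong (suc n) (λ { {i} (s≤s i≤n) → trans (ℚ.*-comm (a (n ∸ i)) _) (cong (λ k → b k * a (n ∸ i)) (ℕ.m∸[m∸n]≡n i≤n)) }) ⟩
    ∑[ i ∈ upTo (suc n) ] b i * a (n ∸ i)               ∎
    where open ≡-Reasoning

  ⊛-assoc : ∀ a b c → (a ⊛ b) ⊛ c ≗ a ⊛ (b ⊛ c)
  ⊛-assoc a b c n = begin
    ∑[ N ∈ upTo (suc n) ] (∑[ k ∈ upTo (suc N) ] a k * b (N ∸ k)) * c (n ∸ N)
      ≡⟨ ∑-cong (upTo (suc n)) (λ N → trans (sym (∑-*ʳ (c (n ∸ N)) (λ k → a k * b (N ∸ k)) (upTo (suc N))))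
           (∑-upTo-cong (suc N) (λ { {k} (s≤s k≤N) → trans (ℚ.*-assoc (a k) (b (N ∸ k)) _)
              (cong (λ m → a k * (b (N ∸ k) * c (n ∸ m))) (sym (ℕ.m+[n∸m]≡n k≤N))) }))) ⟩
    ∑[ N ∈ upTo (suc n) ] ∑[ k ∈ upTo (suc N) ] F k (N ∸ k)
      ≡⟨ ∑-triangle (suc n) F ⟩
    ∑[ k ∈ upTo (suc n) ] ∑[ j ∈ upTo (suc n ∸ k) ] F k j
      ≡⟨ ∑-upTo-cong (suc n) (λ { {k} (s≤s k≤n) → trans (cong (λ m → ∑ (upTo m) (F k)) (ℕ.+-∸-assoc 1 k≤n))
           (trans (∑-*ˡ (a k) (λ j → b j * c (n ∸ (k ℕ.+ j))) (upTo (suc (n ∸ k))))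
             (cong (a k *_) (∑-cong (upTo (suc (n ∸ k))) (λ j → cong (λ m → b j * c m) (sym (ℕ.∸-+-assoc n k j)))))) }) ⟩
    ∑[ k ∈ upTo (suc n) ] a k * (∑[ j ∈ upTo (suc (n ∸ k)) ] b j * c (n ∸ k ∸ j)) ∎
    where
    open ≡-Reasoning
    F : ℕ → ℕ → ℚ
    F k j = a k * (b j * c (n ∸ (k ℕ.+ j)))

  ⊛-∑ˡ : ∀ {A : Set} (xs : List A) (a : A → Series) b n →
    ((λ k → ∑[ x ∈ xs ] a x k) ⊛ b) n ≡ ∑[ x ∈ xs ] (a x ⊛ b) n
  ⊛-∑ˡ xs a b n = begin
    ∑[ i ∈ upTo (suc n) ] (∑[ x ∈ xs ] a x i) * b (n ∸ i) ≡⟨ ∑-cong (upTo (suc n)) (λ i → sym (∑-*ʳ (b (n ∸ i)) (λ x → a x i) xs)) ⟩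
    ∑[ i ∈ upTo (suc n) ] ∑[ x ∈ xs ] a x i * b (n ∸ i)   ≡⟨ ∑-swap (λ i x → a x i * b (n ∸ i)) (upTo (suc n)) xs ⟩
    ∑[ x ∈ xs ] (a x ⊛ b) n                               ∎
    where open ≡-Reasoning

  ⊛-identityˡ : ∀ a → 1ˢ ⊛ a ≗ a
  ⊛-identityˡ a n = begin
    ∑[ i ∈ upTo (suc n) ] 1ˢ i * a (n ∸ i)           ≡⟨ ∑-upTo-suc n (λ i → 1ˢ i * a (n ∸ i)) ⟩
    1ℚ * a n + (∑[ i ∈ upTo n ] 0ℚ * a (n ∸ suc i))  ≡⟨ cong₂ _+_ (ℚ.*-identityˡ (a n)) (∑-0 (upTo n) (λ {i} _ → ℚ.*-zeroˡ (a (n ∸ suc i)))) ⟩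
    a n + 0ℚ                                         ≡⟨ ℚ.+-identityʳ (a n) ⟩
    a n                                              ∎
    where open ≡-Reasoning

  module _ (x : Series) (x₀ : x 0 ≡ 0ℚ) where

    power : ℕ → Series
    power = fold 1ˢ (x ⊛_)

    -- As x has no constant term, every factor raises the order by one; the cut-off m ≤ n in `recip`
    -- therefore loses nothing.
    power-order : ∀ m {n} → n < m → power m n ≡ 0ℚ
    power-order (suc m) {n} (s≤s n≤m) = ∑-upTo-0 (suc n) term
      where
      term : ∀ {i} → i < suc n → x i * power m (n ∸ i) ≡ 0ℚ
      term {zero}  _         = trans (cong (_* power m n) x₀) (ℚ.*-zeroˡ (power m n))
      term {suc i} (s≤s i<n) = trans (cong (x (suc i) *_)
        (power-order m (ℕ.<-≤-trans (ℕ.∸-monoʳ-< (s≤s z≤n) i<n) n≤m))) (ℚ.*-zeroʳ (x (suc i)))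

    geometric : Series
    geometric n = ∑[ m ∈ upTo (suc n) ] power m n

    geometric-⊛ : ∀ n → (x ⊛ geometric) n ≡ geometric n - 1ˢ n
    geometric-⊛ n = begin
      ∑[ i ∈ upTo (suc n) ] x i * geometric (n ∸ i)
        -- By `power-order` the cut-offs, which vary with i, may all be raised to n, so that the two
        -- sums can be exchanged.
        ≡⟨ ∑-cong (upTo (suc n)) (λ i → cong (x i *_) (∑-upTo-extend (λ m → power m (n ∸ i)) (s≤s (ℕ.m∸n≤m n i)) (λ {m} → power-order m))) ⟨
      ∑[ i ∈ upTo (suc n) ] x i * (∑[ m ∈ upTo (suc n) ] power m (n ∸ i))
        ≡⟨ ∑-cong (upTo (suc n)) (λ i → sym (∑-*ˡ (x i) (λ m → power m (n ∸ i)) (upTo (suc n)))) ⟩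
      ∑[ i ∈ upTo (suc n) ] ∑[ m ∈ upTo (suc n) ] x i * power m (n ∸ i)
        ≡⟨ ∑-swap (λ i m → x i * power m (n ∸ i)) (upTo (suc n)) (upTo (suc n)) ⟩
      ∑[ m ∈ upTo (suc n) ] power (suc m) n
        ≡⟨ ∑-upTo-snoc n (λ m → power (suc m) n) ⟩
      (∑[ m ∈ upTo n ] power (suc m) n) + power (suc n) n
        ≡⟨ cong ((∑[ m ∈ upTo n ] power (suc m) n) +_) (power-order (suc n) ℕ.≤-refl) ⟩
      (∑[ m ∈ upTo n ] power (suc m) n) + 0ℚ
        ≡⟨ ring (∑[ m ∈ upTo n ] power (suc m) n) (1ˢ n) ⟩
      1ˢ n + (∑[ m ∈ upTo n ] power (suc m) n) - 1ˢ n
        ≡⟨ cong (_- 1ˢ n) (∑-upTo-suc n (λ m → power m n)) ⟨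
      geometric n - 1ˢ n ∎
      where
      open ≡-Reasoning
      ring : ∀ a b → a + 0ℚ ≡ b + a - b
      ring = solve-∀ ℚ-ring

  fold-cong : ∀ {s t : Series → Series} → (∀ {a b} → a ≗ b → s a ≗ t b) → ∀ m → fold 1ˢ s m ≗ fold 1ˢ t m
  fold-cong h zero    n = refl
  fold-cong h (suc m) n = h (fold-cong h m) n

  ⊛-recip : ∀ c → c 0 ≡ 1ℚ → c ⊛ recip c ≗ 1ˢ
  ⊛-recip c c₀ n = begin
    (c ⊛ recip c) n                                        ≡⟨ ⊛-cong {a′ = λ i → 1ˢ i - x i} c≗1-x recip≗ n ⟩
    ∑[ i ∈ upTo (suc n) ] (1ˢ i - x i) * g (n ∸ i)         ≡⟨ ∑-cong (upTo (suc n)) (λ i → ring₁ (1ˢ i) (x i) (g (n ∸ i))) ⟩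
    ∑[ i ∈ upTo (suc n) ] (1ˢ i * g (n ∸ i) - x i * g (n ∸ i)) ≡⟨ ∑-- (λ i → 1ˢ i * g (n ∸ i)) (λ i → x i * g (n ∸ i)) (upTo (suc n)) ⟩
    (1ˢ ⊛ g) n - (x ⊛ g) n                                 ≡⟨ cong₂ _-_ (⊛-identityˡ g n) (geometric-⊛ x x₀ n) ⟩
    g n - (g n - 1ˢ n)                                     ≡⟨ ring₂ (g n) (1ˢ n) ⟩
    1ˢ n                                                   ∎
    where
    open ≡-Reasoning
    x : Series
    x i = 1ˢ i - c i
    x₀ : x 0 ≡ 0ℚ
    x₀ = cong (λ z → 1ℚ - z) c₀
    g : Series
    g = geometric x x₀
    step : ∀ {a b} → a ≗ b → x ⊛ a ≗ x ⊛ b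
    step p = ⊛-cong {a = x} (λ _ → refl) p
    recip≗ : recip c ≗ g
    recip≗ n = ∑-cong (upTo (suc n)) (λ m → fold-cong step m n)
    ring₁ : ∀ a b c → (a - b) * c ≡ a * c - b * c
    ring₁ = solve-∀ ℚ-ring
    ring₂ : ∀ a b → a - (a - b) ≡ b
    ring₂ = solve-∀ ℚ-ring
    c≗1-x : ∀ i → c i ≡ 1ˢ i - x i
    c≗1-x i = sym (ring₂ (1ˢ i) (c i))

  β⊛sinhc½ : β ⊛ sinhc½ ≗ 1ˢ
  β⊛sinhc½ n = trans (⊛-comm β sinhc½ n) (⊛-recip sinhc½ refl n)

  -- Composition of differential operators: symbols a and b compose to a ⊛ b. For `w` one takes
  -- scaled derivatives of a polynomial, which vanish from B on, so that square and triangle give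
  -- the same sum.
  ∑-⊛ : ∀ B (a b w : Series) → (∀ {n} → B ≤ n → w n ≡ 0ℚ) →
    ∑[ k ∈ upTo B ] ∑[ n ∈ upTo B ] a k * b n * w (k ℕ.+ n) ≡ ∑[ N ∈ upTo B ] (a ⊛ b) N * w N
  ∑-⊛ B a b w w₀ = begin
    ∑[ k ∈ upTo B ] ∑[ n ∈ upTo B ] F k n
      ≡⟨ ∑-upTo-cong B (λ {k} _ → ∑-upTo-extend (F k) (ℕ.m∸n≤m B k)
           (λ {n} B∸k≤n → trans (cong (a k * b n *_) (w₀ (ℕ.≤-trans (ℕ.m≤n+m∸n B k) (ℕ.+-monoʳ-≤ k B∸k≤n)))) (ℚ.*-zeroʳ (a k * b n)))) ⟩
    ∑[ k ∈ upTo B ] ∑[ n ∈ upTo (B ∸ k) ] F k n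
      ≡⟨ ∑-triangle B F ⟨
    ∑[ N ∈ upTo B ] (∑[ k ∈ upTo (suc N) ] F k (N ∸ k))
      ≡⟨ ∑-cong (upTo B) (λ N → trans
           (∑-upTo-cong (suc N) (λ { {k} (s≤s k≤N) → cong (λ m → a k * b (N ∸ k) * w m) (ℕ.m+[n∸m]≡n k≤N) }))
           (∑-*ʳ (w N) (λ k → a k * b (N ∸ k)) (upTo (suc N)))) ⟩
    ∑[ N ∈ upTo B ] (a ⊛ b) N * w N ∎
    where
    open ≡-Reasoning
    F : ℕ → ℕ → ℚ
    F k n = a k * b n * w (k ℕ.+ n)

  -- The operator (cD/2)/sinh(cD/2) on polynomials

  [-x]^ : ∀ n x → (- x) ^ n ≡ (if even n then x ^ n else - (x ^ n))
  [-x]^ zero          x = refl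
  [-x]^ (suc zero)    x = ring x
    where
    ring : ∀ x → - x * 1ℚ ≡ - (x * 1ℚ)
    ring = solve-∀ ℚ-ring
  [-x]^ (suc (suc n)) x = trans (cong (λ z → - x * (- x * z)) ([-x]^ n x)) (lemma (even n))
    where
    ring₁ : ∀ x y → - x * (- x * y) ≡ x * (x * y)
    ring₁ = solve-∀ ℚ-ring
    ring₂ : ∀ x y → - x * (- x * - y) ≡ - (x * (x * y))
    ring₂ = solve-∀ ℚ-ring
    lemma : ∀ b → - x * (- x * (if b then x ^ n else - (x ^ n))) ≡ (if b then x * (x * x ^ n) else - (x * (x * x ^ n)))
    lemma true  = ring₁ x (x ^ n)
    lemma false = ring₂ x (x ^ n)

  even-suc : ∀ n → even (suc n) ≡ not (even n)
  even-suc zero          = refl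
  even-suc (suc zero)    = refl
  even-suc (suc (suc n)) = even-suc n

  -- Coefficients of e^(cz/2) - e^(-cz/2) = cz · sinh(cz/2)/(cz/2): even powers cancel and odd ones
  -- double.
  ε-odd-part : ∀ c n → ε (½ * c) (suc n) - ε (- (½ * c)) (suc n) ≡ c * (c ^ n * sinhc½ n)
  ε-odd-part c n = trans (cong (λ z → ε (½ * c) (suc n) - z * 1/ suc n !) ([-x]^ (suc n) (½ * c)))
    (trans (cong (λ b → ε (½ * c) (suc n) - (if b then p else - p) * 1/ suc n !) (even-suc n)) (lemma (even n)))
    where
    p : ℚ
    p = (½ * c) ^ suc n
    ring₁ : ∀ c h f → ½ * c * h * f - - (½ * c * h) * f ≡ c * (h * f)
    ring₁ = solve-∀ ℚ-ring
    ring₃ : ∀ h c d f → c * (h * d * f) ≡ c * (d * (h * f))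
    ring₃ = solve-∀ ℚ-ring
    ring₄ : ∀ p f c d → p * f - p * f ≡ c * (d * 0ℚ)
    ring₄ = solve-∀ ℚ-ring
    lemma : ∀ b → ε (½ * c) (suc n) - (if not b then p else - p) * 1/ suc n ! ≡ c * (c ^ n * (if b then ½ ^ n * 1/ suc n ! else 0ℚ))
    lemma true  = trans (ring₁ c ((½ * c) ^ n) (1/ suc n !))
      (trans (cong (λ z → c * (z * 1/ suc n !)) (^-* ½ c n)) (ring₃ (½ ^ n) c (c ^ n) (1/ suc n !)))
    lemma false = ring₄ p (1/ suc n !) c (c ^ n)

  -- Σ_k β_k (cD)ᵏ applied to f, at a.
  Φ : ℚ → ℕ → Poly → ℚ → ℚ
  Φ c B f a = ∑[ k ∈ upTo B ] β k * c ^ k * δ a k f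

  -- (cD/2)/sinh(cD/2) turns the central difference e^{cD/2} - e^{-cD/2} into cD.
  Φ-difference : ∀ c B f a → length f ≤ B →
    Φ c B f (a + ½ * c) - Φ c B f (a + - (½ * c)) ≡ c * δ a 1 f
  Φ-difference c zero    [] a l≤B = sym (ℚ.*-zeroʳ c)
  Φ-difference c (suc B) f a l≤B = begin
    Φ c (suc B) f (a + h) - Φ c (suc B) f (a + - h)
      ≡⟨ ∑-- (λ k → β k * c ^ k * δ (a + h) k f) (λ k → β k * c ^ k * δ (a + - h) k f) (upTo (suc B)) ⟨
    ∑[ k ∈ upTo (suc B) ] (β k * c ^ k * δ (a + h) k f - β k * c ^ k * δ (a + - h) k f)
      ≡⟨ ∑-cong (upTo (suc B)) term ⟩
    ∑[ k ∈ upTo (suc B) ] c * (∑[ n ∈ upTo (suc B) ] β k * sinhc½ n * w (k ℕ.+ n))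
      ≡⟨ ∑-*ˡ c (λ k → ∑[ n ∈ upTo (suc B) ] β k * sinhc½ n * w (k ℕ.+ n)) (upTo (suc B)) ⟩
    c * (∑[ k ∈ upTo (suc B) ] ∑[ n ∈ upTo (suc B) ] β k * sinhc½ n * w (k ℕ.+ n))
      ≡⟨ cong (c *_) (∑-⊛ (suc B) β sinhc½ w w-vanishes) ⟩
    c * (∑[ N ∈ upTo (suc B) ] (β ⊛ sinhc½) N * w N)
      ≡⟨ cong (c *_) (∑-cong (upTo (suc B)) (λ N → cong (_* w N) (β⊛sinhc½ N))) ⟩
    c * (∑[ N ∈ upTo (suc B) ] 1ˢ N * w N)
      ≡⟨ cong (c *_) (∑-upTo-suc B (λ N → 1ˢ N * w N)) ⟩
    c * (1ℚ * w 0 + (∑[ N ∈ upTo B ] 0ℚ * w (suc N)))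
      ≡⟨ cong (λ z → c * (1ℚ * w 0 + z)) (∑-0 (upTo B) (λ {N} _ → ℚ.*-zeroˡ (w (suc N)))) ⟩
    c * (1ℚ * (1ℚ * δ a 1 f) + 0ℚ)
      ≡⟨ ring c (δ a 1 f) ⟩
    c * δ a 1 f ∎
    where
    open ≡-Reasoning
    h : ℚ
    h = ½ * c
    -- The derivative has order N + 1 but the power of c is only N, because the factor c D of the
    -- central difference is split off.
    w : Series
    w N = c ^ N * δ a (suc N) f
    w-vanishes : ∀ {N} → suc B ≤ N → w N ≡ 0ℚ
    w-vanishes {N} B<N = trans (cong (c ^ N *_) (δ-vanishes a (suc N) f (ℕ.≤-trans l≤B (ℕ.m≤n⇒m≤1+n B<N)))) (ℚ.*-zeroʳ (c ^ N))
    ring : ∀ c x → c * (1ℚ * (1ℚ * x) + 0ℚ) ≡ c * x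
    ring = solve-∀ ℚ-ring
    ring₁ : ∀ b p x y → b * p * x - b * p * y ≡ b * p * (x - y)
    ring₁ = solve-∀ ℚ-ring
    ring₂ : ∀ x y z → x * z - y * z ≡ (x - y) * z
    ring₂ = solve-∀ ℚ-ring
    ring₃ : ∀ b p c q s y → b * p * (c * (q * s) * y) ≡ c * (b * s * ((p * q) * y))
    ring₃ = solve-∀ ℚ-ring
    term : ∀ k → β k * c ^ k * δ (a + h) k f - β k * c ^ k * δ (a + - h) k f ≡
      c * (∑[ n ∈ upTo (suc B) ] β k * sinhc½ n * w (k ℕ.+ n))
    term k = begin
      β k * c ^ k * δ (a + h) k f - β k * c ^ k * δ (a + - h) k f
        ≡⟨ ring₁ (β k) (c ^ k) (δ (a + h) k f) (δ (a + - h) k f) ⟩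
      β k * c ^ k * (δ (a + h) k f - δ (a + - h) k f)
        -- Taylor's formula with one summand more than B + 1: the summand n = 0 cancels in the
        -- difference, which leaves n + 1 with n ≤ B.
        ≡⟨ cong (β k * c ^ k *_) (cong₂ _-_ (sym (δ-taylor a h k f {suc (suc B)} (ℕ.m≤n⇒m≤1+n l≤B))) (sym (δ-taylor a (- h) k f (ℕ.m≤n⇒m≤1+n l≤B)))) ⟩
      β k * c ^ k * ((∑[ n ∈ upTo (suc (suc B)) ] ε h n * δ a (k ℕ.+ n) f) - (∑[ n ∈ upTo (suc (suc B)) ] ε (- h) n * δ a (k ℕ.+ n) f))
        ≡⟨ cong (β k * c ^ k *_) (trans (sym (∑-- (λ n → ε h n * δ a (k ℕ.+ n) f) (λ n → ε (- h) n * δ a (k ℕ.+ n) f) (upTo (suc (suc B))))) (∑-cong (upTo (suc (suc B))) (λ n → ring₂ (ε h n) (ε (- h) n) (δ a (k ℕ.+ n) f)))) ⟩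
      β k * c ^ k * (∑[ n ∈ upTo (suc (suc B)) ] (ε h n - ε (- h) n) * δ a (k ℕ.+ n) f)
        ≡⟨ cong (β k * c ^ k *_) (trans (∑-upTo-suc (suc B) (λ n → (ε h n - ε (- h) n) * δ a (k ℕ.+ n) f))
             (trans (cong (_+ (∑[ n ∈ upTo (suc B) ] (ε h (suc n) - ε (- h) (suc n)) * δ a (k ℕ.+ suc n) f)) (ℚ.*-zeroˡ (δ a (k ℕ.+ 0) f))) (ℚ.+-identityˡ _))) ⟩
      β k * c ^ k * (∑[ n ∈ upTo (suc B) ] (ε h (suc n) - ε (- h) (suc n)) * δ a (k ℕ.+ suc n) f)
        ≡⟨ ∑-*ˡ (β k * c ^ k) (λ n → (ε h (suc n) - ε (- h) (suc n)) * δ a (k ℕ.+ suc n) f) (upTo (suc B)) ⟨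
      ∑[ n ∈ upTo (suc B) ] β k * c ^ k * ((ε h (suc n) - ε (- h) (suc n)) * δ a (k ℕ.+ suc n) f)
        ≡⟨ ∑-cong (upTo (suc B)) (λ n → trans (cong₂ (λ y m → β k * c ^ k * (y * δ a m f)) (ε-odd-part c n) (ℕ.+-suc k n))
             (trans (ring₃ (β k) (c ^ k) c (c ^ n) (sinhc½ n) (δ a (suc (k ℕ.+ n)) f))
               (cong (λ z → c * (β k * sinhc½ n * (z * δ a (suc (k ℕ.+ n)) f))) (sym (^-+ c k n))))) ⟩
      ∑[ n ∈ upTo (suc B) ] c * (β k * sinhc½ n * w (k ℕ.+ n))
        ≡⟨ ∑-*ˡ c (λ n → β k * sinhc½ n * w (k ℕ.+ n)) (upTo (suc B)) ⟩
      c * (∑[ n ∈ upTo (suc B) ] β k * sinhc½ n * w (k ℕ.+ n)) ∎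

  -- Sums over the rows of a partition and the functions Q_k

  -- rowdiff θ c λ = Σᵢ θ(λᵢ - i - c) - θ(-i - c), with rows counted from 0.
  rowdiff : (ℚ → ℚ) → ℚ → List ℕ → ℚ
  rowdiff θ c []       = 0ℚ
  rowdiff θ c (l ∷ ls) = (θ (fromℕ l - c) - θ (- c)) + rowdiff θ (c + 1ℚ) ls

  rowdiff-cong : ∀ {θ η} → (∀ x → θ x ≡ η x) → ∀ c ls → rowdiff θ c ls ≡ rowdiff η c ls
  rowdiff-cong h c []       = refl
  rowdiff-cong h c (l ∷ ls) = cong₂ _+_ (cong₂ _-_ (h _) (h _)) (rowdiff-cong h (c + 1ℚ) ls)

  rowdiff-linear : ∀ a θ η c ls → rowdiff (λ x → a * θ x + η x) c ls ≡ a * rowdiff θ c ls + rowdiff η c ls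
  rowdiff-linear a θ η c []       = sym (trans (ℚ.+-identityʳ _) (ℚ.*-zeroʳ a))
  rowdiff-linear a θ η c (l ∷ ls) = trans
    (cong ((a * θ (fromℕ l - c) + η (fromℕ l - c)) - (a * θ (- c) + η (- c)) +_) (rowdiff-linear a θ η (c + 1ℚ) ls))
    (ring a (θ (fromℕ l - c)) (θ (- c)) (η (fromℕ l - c)) (η (- c)) (rowdiff θ (c + 1ℚ) ls) (rowdiff η (c + 1ℚ) ls))
    where
    ring : ∀ a x y u v p q → (a * x + u) - (a * y + v) + (a * p + q) ≡ a * ((x - y) + p) + ((u - v) + q)
    ring = solve-∀ ℚ-ring

  rowdiff-0 : ∀ c ls → rowdiff (λ _ → 0ℚ) c ls ≡ 0ℚ
  rowdiff-0 c []       = refl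
  rowdiff-0 c (l ∷ ls) = trans (ℚ.+-identityˡ _) (rowdiff-0 (c + 1ℚ) ls)

  rowdiff-* : ∀ a θ c ls → rowdiff (λ x → a * θ x) c ls ≡ a * rowdiff θ c ls
  rowdiff-* a θ c ls = begin
    rowdiff (λ x → a * θ x) c ls                     ≡⟨ rowdiff-cong (λ x → sym (ℚ.+-identityʳ (a * θ x))) c ls ⟩
    rowdiff (λ x → a * θ x + 0ℚ) c ls                ≡⟨ rowdiff-linear a θ (λ _ → 0ℚ) c ls ⟩
    a * rowdiff θ c ls + rowdiff (λ _ → 0ℚ) c ls     ≡⟨ cong (a * rowdiff θ c ls +_) (rowdiff-0 c ls) ⟩
    a * rowdiff θ c ls + 0ℚ                          ≡⟨ ℚ.+-identityʳ _ ⟩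
    a * rowdiff θ c ls                               ∎
    where open ≡-Reasoning

  rowdiff-∑ : ∀ {A : Set} (a : A → ℚ) (θ : A → ℚ → ℚ) xs c ls →
    rowdiff (λ x → ∑[ i ∈ xs ] a i * θ i x) c ls ≡ ∑[ i ∈ xs ] a i * rowdiff (θ i) c ls
  rowdiff-∑ a θ []       c ls = rowdiff-0 c ls
  rowdiff-∑ a θ (i ∷ xs) c ls =
    trans (rowdiff-linear (a i) (θ i) _ c ls) (cong (a i * rowdiff (θ i) c ls +_) (rowdiff-∑ a θ xs c ls))

  ∑-allFin-suc : ∀ n (f : Fin (suc n) → ℚ) → ∑ (allFin (suc n)) f ≡ f Fin.zero + ∑ (allFin n) (f ∘ Fin.suc)
  ∑-allFin-suc n f = cong (f Fin.zero +_)
    (trans (cong (λ xs → ∑ xs f) (sym (List.map-tabulate id Fin.suc))) (∑-map f Fin.suc (allFin n)))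

  rowdiff-allFin : ∀ θ c ls →
    ∑[ i ∈ allFin (length ls) ] (θ (fromℕ (lookup ls i) - (c + fromℕ (toℕ i))) - θ (- (c + fromℕ (toℕ i))))
      ≡ rowdiff θ c ls
  rowdiff-allFin θ c []       = refl
  rowdiff-allFin θ c (l ∷ ls) = begin
    ∑ (allFin (suc (length ls))) f                        ≡⟨ ∑-allFin-suc (length ls) f ⟩
    f Fin.zero + ∑ (allFin (length ls)) (f ∘ Fin.suc)     ≡⟨ cong₂ _+_ (cong (λ x → θ (fromℕ l - x) - θ (- x)) (ℚ.+-identityʳ c))
                                                               (∑-cong (allFin (length ls)) (λ i → cong (λ x → θ (fromℕ (lookup ls i) - x) - θ (- x)) (shift (toℕ i)))) ⟩
    (θ (fromℕ l - c) - θ (- c)) + ∑ (allFin (length ls)) (λ i → θ (fromℕ (lookup ls i) - (c + 1ℚ + fromℕ (toℕ i))) - θ (- (c + 1ℚ + fromℕ (toℕ i))))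
      ≡⟨ cong ((θ (fromℕ l - c) - θ (- c)) +_) (rowdiff-allFin θ (c + 1ℚ) ls) ⟩
    rowdiff θ c (l ∷ ls)                                  ∎
    where
    open ≡-Reasoning
    f : Fin (suc (length ls)) → ℚ
    f i = θ (fromℕ (lookup (l ∷ ls) i) - (c + fromℕ (toℕ i))) - θ (- (c + fromℕ (toℕ i)))
    shift : ∀ i → c + fromℕ (suc i) ≡ c + 1ℚ + fromℕ i
    shift i = trans (cong (c +_) (fromℕ-suc i)) (sym (ℚ.+-assoc c 1ℚ (fromℕ i)))

  -- Q_k on bare lists, so that zero parts may be appended and lists read off from words carry no
  -- proofs. The offset ½ is λᵢ - i + ½ with rows counted from 0.
  Qᵖ : List ℕ → ℕ → ℚ
  Qᵖ ls zero    = 1ℚ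
  Qᵖ ls (suc k) = 1/ k ! * rowdiff (_^ k) ½ ls + β (suc k)

  Qᶠ≡Qᵖ : ∀ k μ → Qᶠ k μ ≡ Qᵖ (parts μ) k
  Qᶠ≡Qᵖ zero    μ = refl
  Qᶠ≡Qᵖ (suc k) μ = cong (λ r → 1/ k ! * r + β (suc k)) (trans
    (∑-cong (allFin (length (parts μ))) (λ i → cong₂ (λ x y → (fromℕ (lookup (parts μ) i) + x) ^ k - y ^ k) (start (toℕ i)) (start (toℕ i))))
    (rowdiff-allFin (_^ k) ½ (parts μ)))
    where
    ring : ∀ x → - (1ℚ + x) + ½ ≡ - (½ + x)
    ring = solve-∀ ℚ-ring
    start : ∀ i → - fromℕ (suc i) + ½ ≡ - (½ + fromℕ i)
    start i = trans (cong (λ x → - x + ½) (fromℕ-suc i)) (ring (fromℕ i))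

  -- The moments Σ Q_k c^k τ_k as sums over particles

  -- The k-th Taylor coefficient, times k!, of v ↦ ∫ᵥᵛ⁺¹ f.
  τ : Poly → ℕ → ℚ
  τ f k = fromℕ (k !) * coeff k (∫₁ f)

  τ-suc : ∀ f k → τ f (suc k) ≡ δ 1ℚ k f - δ 0ℚ k f
  τ-suc f k = trans (coeff-∫₁ (suc k) f) (cong₂ _-_ (δ-antiderivative 1ℚ k f) (δ-antiderivative 0ℚ k f))

  length-antiderivative : ∀ f → length (antiderivative f) ≡ suc (length f)
  length-antiderivative f = trans (cong length (antiderivative-integrate f)) (cong suc (length-integrate 0 f))
    where
    length-integrate : ∀ n f → length (integrate n f) ≡ length f
    length-integrate n []      = refl
    length-integrate n (a ∷ f) = cong suc (length-integrate (suc n) f)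

  -- Differentiating ∫ f from v to v + 1 gives f(v + 1) - f(v); this is its Taylor formula at v = 0,
  -- evaluated at v = y c.
  τ-rows : ∀ c f y {B} → length f ≤ B →
    ∑[ k ∈ upTo B ] c * (c ^ k * 1/ k ! * τ f (suc k)) * y ^ k ≡ c * (value (1ℚ + y * c) f - value (y * c) f)
  τ-rows c f y {B} l≤B = begin
    ∑[ k ∈ upTo B ] c * (c ^ k * 1/ k ! * τ f (suc k)) * y ^ k
      ≡⟨ ∑-cong (upTo B) (λ k → trans (cong (λ z → c * (c ^ k * 1/ k ! * z) * y ^ k) (τ-suc f k))
           (trans (ring₁ c (c ^ k) (1/ k !) (δ 1ℚ k f) (δ 0ℚ k f) (y ^ k))
             (cong (λ z → c * (z * 1/ k ! * δ 1ℚ k f - z * 1/ k ! * δ 0ℚ k f)) (sym (^-* y c k))))) ⟩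
    ∑[ k ∈ upTo B ] c * (ε (y * c) k * δ 1ℚ k f - ε (y * c) k * δ 0ℚ k f)
      ≡⟨ trans (∑-*ˡ c _ (upTo B)) (cong (c *_) (∑-- _ _ (upTo B))) ⟩
    c * ((∑[ k ∈ upTo B ] ε (y * c) k * δ 1ℚ k f) - (∑[ k ∈ upTo B ] ε (y * c) k * δ 0ℚ k f))
      ≡⟨ cong (c *_) (cong₂ _-_ (δ-taylor 1ℚ (y * c) 0 f l≤B) (trans (δ-taylor 0ℚ (y * c) 0 f l≤B) (cong (λ z → value z f) (ℚ.+-identityˡ (y * c))))) ⟩
    c * (value (1ℚ + y * c) f - value (y * c) f) ∎
    where
    open ≡-Reasoning
    ring₁ : ∀ c p f x z y → c * (p * f * (x - z)) * y ≡ c * ((y * p) * f * x - (y * p) * f * z)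
    ring₁ = solve-∀ ℚ-ring

  -- `Qᵖ ls k` splits into a row sum and β_k. The row sums resum by `τ-rows`; the β_k assemble to
  -- the operator `Φ` applied to an antiderivative of f, between 0 and 1.
  τ-moments : ∀ c f ls {B} → length f ≤ B →
    ∑[ k ∈ upTo (suc B) ] Qᵖ ls k * c ^ k * τ f k ≡
    c * rowdiff (λ y → value (1ℚ + y * c) f - value (y * c) f) ½ ls
      + (Φ c (suc B) (antiderivative f) 1ℚ - Φ c (suc B) (antiderivative f) 0ℚ)
  τ-moments c f ls {B} l≤B = begin
    ∑[ k ∈ upTo (suc B) ] Qᵖ ls k * c ^ k * τ f k
      ≡⟨ ∑-cong (upTo (suc B)) (λ k → ring₀ (Qᵖ ls k) (β k) (c ^ k) (τ f k)) ⟩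
    ∑[ k ∈ upTo (suc B) ] ((Qᵖ ls k - β k) * c ^ k * τ f k + β k * c ^ k * τ f k)
      ≡⟨ ∑-+ (λ k → (Qᵖ ls k - β k) * c ^ k * τ f k) (λ k → β k * c ^ k * τ f k) (upTo (suc B)) ⟩
    (∑[ k ∈ upTo (suc B) ] (Qᵖ ls k - β k) * c ^ k * τ f k) + (∑[ k ∈ upTo (suc B) ] β k * c ^ k * τ f k)
      ≡⟨ cong₂ _+_ rows sea ⟩
    c * rowdiff (λ y → value (1ℚ + y * c) f - value (y * c) f) ½ ls
      + (Φ c (suc B) (antiderivative f) 1ℚ - Φ c (suc B) (antiderivative f) 0ℚ) ∎
    where
    open ≡-Reasoning
    F : Poly
    F = antiderivative f
    ring₀ : ∀ q b p t → q * p * t ≡ (q - b) * p * t + b * p * t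
    ring₀ = solve-∀ ℚ-ring
    ring₁ : ∀ b p x y → b * p * (x - y) ≡ b * p * x - b * p * y
    ring₁ = solve-∀ ℚ-ring
    ring₂ : ∀ i r b c p t → (i * r + b - b) * (c * p) * t ≡ c * (p * i * t) * r
    ring₂ = solve-∀ ℚ-ring
    sea : ∑[ k ∈ upTo (suc B) ] β k * c ^ k * τ f k ≡ Φ c (suc B) F 1ℚ - Φ c (suc B) F 0ℚ
    sea = trans
      (∑-cong (upTo (suc B)) (λ k → trans (cong (β k * c ^ k *_) (coeff-∫₁ k f)) (ring₁ (β k) (c ^ k) (δ 1ℚ k F) (δ 0ℚ k F))))
      (∑-- (λ k → β k * c ^ k * δ 1ℚ k F) (λ k → β k * c ^ k * δ 0ℚ k F) (upTo (suc B)))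
    rows : ∑[ k ∈ upTo (suc B) ] (Qᵖ ls k - β k) * c ^ k * τ f k ≡ c * rowdiff (λ y → value (1ℚ + y * c) f - value (y * c) f) ½ ls
    rows = begin
      ∑[ k ∈ upTo (suc B) ] (Qᵖ ls k - β k) * c ^ k * τ f k
        ≡⟨ ∑-upTo-suc B (λ k → (Qᵖ ls k - β k) * c ^ k * τ f k) ⟩
      0ℚ * τ f 0 + (∑[ k ∈ upTo B ] (1/ k ! * rowdiff (_^ k) ½ ls + β (suc k) - β (suc k)) * (c * c ^ k) * τ f (suc k))
        ≡⟨ trans (cong (_+ (∑[ k ∈ upTo B ] (1/ k ! * rowdiff (_^ k) ½ ls + β (suc k) - β (suc k)) * (c * c ^ k) * τ f (suc k))) (ℚ.*-zeroˡ (τ f 0))) (ℚ.+-identityˡ _) ⟩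
      ∑[ k ∈ upTo B ] (1/ k ! * rowdiff (_^ k) ½ ls + β (suc k) - β (suc k)) * (c * c ^ k) * τ f (suc k)
        ≡⟨ ∑-cong (upTo B) (λ k → ring₂ (1/ k !) (rowdiff (_^ k) ½ ls) (β (suc k)) c (c ^ k) (τ f (suc k))) ⟩
      ∑[ k ∈ upTo B ] c * (c ^ k * 1/ k ! * τ f (suc k)) * rowdiff (_^ k) ½ ls
        ≡⟨ rowdiff-∑ (λ k → c * (c ^ k * 1/ k ! * τ f (suc k))) (λ k y → y ^ k) (upTo B) ½ ls ⟨
      rowdiff (λ y → ∑[ k ∈ upTo B ] c * (c ^ k * 1/ k ! * τ f (suc k)) * y ^ k) ½ ls
        ≡⟨ rowdiff-cong (λ y → τ-rows c f y l≤B) ½ ls ⟩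
      rowdiff (λ y → c * (value (1ℚ + y * c) f - value (y * c) f)) ½ ls
        ≡⟨ rowdiff-* c _ ½ ls ⟩
      c * rowdiff (λ y → value (1ℚ + y * c) f - value (y * c) f) ½ ls ∎

  -- The interval from a to a + m c is cut into m steps of length c. On each, `Φ-difference` at the
  -- midpoint gives c times the derivative of the antiderivative, that is, c times the value of f
  -- there.
  Φ-telescope : ∀ c f a m {B} → length f ≤ B →
    Φ c (suc B) (antiderivative f) (a + fromℕ m * c) - Φ c (suc B) (antiderivative f) a ≡
    c * (∑[ s ∈ upTo m ] value (a + (fromℕ s + ½) * c) f)
  Φ-telescope c f a zero {B} l≤B = begin
    P (a + 0ℚ * c) - P a    ≡⟨ cong (λ z → P z - P a) (ring₁ a c) ⟩
    P a - P a               ≡⟨ ℚ.+-inverseʳ (P a) ⟩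
    0ℚ                      ≡⟨ ℚ.*-zeroʳ c ⟨
    c * 0ℚ                  ∎
    where
    open ≡-Reasoning
    P : ℚ → ℚ
    P = Φ c (suc B) (antiderivative f)
    ring₁ : ∀ a c → a + 0ℚ * c ≡ a
    ring₁ = solve-∀ ℚ-ring
  Φ-telescope c f a (suc m) {B} l≤B = begin
    P (a + fromℕ (suc m) * c) - P a
      ≡⟨ ring₁ (P (a + fromℕ (suc m) * c)) (P (a + fromℕ m * c)) (P a) ⟩
    (P (a + fromℕ m * c) - P a) + (P (a + fromℕ (suc m) * c) - P (a + fromℕ m * c))
      ≡⟨ cong₂ (λ x y → (P (a + fromℕ m * c) - P a) + (P x - P y)) (trans (cong (λ z → a + z * c) (fromℕ-suc m)) (ring₂ a (fromℕ m) c)) (ring₃ a (fromℕ m) c) ⟩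
    (P (a + fromℕ m * c) - P a) + (P (b + ½ * c) - P (b + - (½ * c)))
      ≡⟨ cong₂ _+_ (Φ-telescope c f a m l≤B)
           (trans (Φ-difference c (suc B) (antiderivative f) b (ℕ.≤-trans (ℕ.≤-reflexive (length-antiderivative f)) (s≤s l≤B))) (cong (c *_) (δ-antiderivative b 0 f))) ⟩
    c * (∑[ s ∈ upTo m ] g s) + c * g m
      ≡⟨ ℚ.*-distribˡ-+ c _ (g m) ⟨
    c * ((∑[ s ∈ upTo m ] g s) + g m)
      ≡⟨ cong (c *_) (∑-upTo-snoc m g) ⟨
    c * (∑[ s ∈ upTo (suc m) ] g s) ∎
    where
    open ≡-Reasoning
    P : ℚ → ℚ
    P = Φ c (suc B) (antiderivative f)
    g : ℕ → ℚ
    g s = value (a + (fromℕ s + ½) * c) f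
    b : ℚ
    b = a + (fromℕ m + ½) * c
    ring₁ : ∀ x y z → x - z ≡ (y - z) + (x - y)
    ring₁ = solve-∀ ℚ-ring
    ring₂ : ∀ a m c → a + (1ℚ + m) * c ≡ a + (m + ½) * c + ½ * c
    ring₂ = solve-∀ ℚ-ring
    ring₃ : ∀ a m c → a + m * c ≡ a + (m + ½) * c + - (½ * c)
    ring₃ = solve-∀ ℚ-ring

  -- The regularised sum of θ(x + 1/c) - θ(x) over the particles x of a Maya
  -- diagram, in the coordinate y = x c.
  particle-sum : ℚ → ℕ → Poly → List ℕ → ℚ
  particle-sum c m f ls =
    c * (rowdiff (λ y → value (1ℚ + y * c) f - value (y * c) f) ½ ls + (∑[ s ∈ upTo m ] value ((fromℕ s + ½) * c) f))

  -- For m c = 1 the unit interval consists of m steps of length c, so the β_k become values of f at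
  -- (s + ½)/m. These are the m positions ½, ..., m - ½ which the vacuum gains when shifted up by m.
  moments⁺ : ∀ c m f ls {B} → fromℕ m * c ≡ 1ℚ → length f ≤ B →
    ∑[ k ∈ upTo (suc B) ] Qᵖ ls k * c ^ k * τ f k ≡ particle-sum c m f ls
  moments⁺ c m f ls {B} mc≡1 l≤B = begin
    ∑[ k ∈ upTo (suc B) ] Qᵖ ls k * c ^ k * τ f k    ≡⟨ τ-moments c f ls l≤B ⟩
    c * R + (P 1ℚ - P 0ℚ)                            ≡⟨ cong (λ z → c * R + (P z - P 0ℚ)) (trans (ℚ.+-identityˡ _) mc≡1) ⟨
    c * R + (P (0ℚ + fromℕ m * c) - P 0ℚ)            ≡⟨ cong (c * R +_) (Φ-telescope c f 0ℚ m l≤B) ⟩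
    c * R + c * (∑[ s ∈ upTo m ] value (0ℚ + (fromℕ s + ½) * c) f)
      ≡⟨ cong (λ z → c * R + c * z) (∑-cong (upTo m) (λ s → cong (λ z → value z f) (ℚ.+-identityˡ _))) ⟩
    c * R + c * (∑[ s ∈ upTo m ] value ((fromℕ s + ½) * c) f) ≡⟨ ℚ.*-distribˡ-+ c R _ ⟨
    particle-sum c m f ls                            ∎
    where
    open ≡-Reasoning
    P : ℚ → ℚ
    P = Φ c (suc B) (antiderivative f)
    R : ℚ
    R = rowdiff (λ y → value (1ℚ + y * c) f - value (y * c) f) ½ ls

  -- Jumps of length -1/c.  Comparison with moments⁺ selects the k of one parity.
  moments⁻ : ∀ c m f ls e {B} → fromℕ m * c ≡ 1ℚ → length f ≤ B → (∀ t → value (1ℚ - t) f ≡ e * value t f) →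
    ∑[ k ∈ upTo (suc B) ] Qᵖ ls k * (- c) ^ k * τ f k ≡ e * particle-sum c m f ls
  moments⁻ c m f ls e {B} mc≡1 l≤B sym-f = begin
    ∑[ k ∈ upTo (suc B) ] Qᵖ ls k * (- c) ^ k * τ f k    ≡⟨ τ-moments (- c) f ls l≤B ⟩
    - c * R⁻ + (P 1ℚ - P 0ℚ)                             ≡⟨ cong₂ (λ x z → - c * x + (P 1ℚ - P z)) rows end ⟩
    - c * (- e * R) + (P 1ℚ - P (1ℚ + fromℕ m * - c))    ≡⟨ ring₁ c e R (P 1ℚ) (P (1ℚ + fromℕ m * - c)) ⟩
    e * (c * R) - (P (1ℚ + fromℕ m * - c) - P 1ℚ)        ≡⟨ cong (λ z → e * (c * R) - z) (Φ-telescope (- c) f 1ℚ m l≤B) ⟩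
    e * (c * R) - (- c * (∑[ s ∈ upTo m ] value (1ℚ + (fromℕ s + ½) * - c) f))
      ≡⟨ cong (λ z → e * (c * R) - (- c * z)) (trans (∑-cong (upTo m) (λ s → trans (cong (λ z → value z f) (ring₂ (fromℕ s) c)) (sym-f _))) (∑-*ˡ e _ (upTo m))) ⟩
    e * (c * R) - (- c * (e * S))                        ≡⟨ ring₃ c e R S ⟩
    e * particle-sum c m f ls                            ∎
    where
    open ≡-Reasoning
    P : ℚ → ℚ
    P = Φ (- c) (suc B) (antiderivative f)
    R R⁻ S : ℚ
    R  = rowdiff (λ y → value (1ℚ + y * c) f - value (y * c) f) ½ ls
    R⁻ = rowdiff (λ y → value (1ℚ + y * - c) f - value (y * - c) f) ½ ls
    S  = ∑[ s ∈ upTo m ] value ((fromℕ s + ½) * c) f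
    ring₁ : ∀ c e r p q → - c * (- e * r) + (p - q) ≡ e * (c * r) - (q - p)
    ring₁ = solve-∀ ℚ-ring
    ring₂ : ∀ s c → 1ℚ + (s + ½) * - c ≡ 1ℚ - (s + ½) * c
    ring₂ = solve-∀ ℚ-ring
    ring₃ : ∀ c e r s → e * (c * r) - (- c * (e * s)) ≡ e * (c * (r + s))
    ring₃ = solve-∀ ℚ-ring
    ring₄ : ∀ y c → 1ℚ + y * - c ≡ 1ℚ - y * c
    ring₄ = solve-∀ ℚ-ring
    ring₅ : ∀ y c → y * - c ≡ 1ℚ - (1ℚ + y * c)
    ring₅ = solve-∀ ℚ-ring
    ring₆ : ∀ e u v → e * u - e * v ≡ - e * (v - u)
    ring₆ = solve-∀ ℚ-ring
    ring₇ : ∀ m c → 1ℚ + m * - c ≡ 1ℚ - m * c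
    ring₇ = solve-∀ ℚ-ring
    -- Steps of length -c lead from 1 down to 0, so the end points of the telescoping sum trade
    -- places.
    end : 0ℚ ≡ 1ℚ + fromℕ m * - c
    end = sym (trans (ring₇ (fromℕ m) c) (cong (λ z → 1ℚ - z) mc≡1))
    rows : R⁻ ≡ - e * R
    rows = trans (rowdiff-cong (λ y → trans
        (cong₂ _-_ (trans (cong (λ z → value z f) (ring₄ y c)) (sym-f (y * c))) (trans (cong (λ z → value z f) (ring₅ y c)) (sym-f (1ℚ + y * c))))
        (ring₆ e (value (y * c) f) (value (1ℚ + y * c) f))) ½ ls)
      (rowdiff-* (- e) _ ½ ls)

  -- Evaluation at a point as a ring homomorphism

  value-+ : ∀ t f g → value t (f +ᴾ g) ≡ value t f + value t g
  value-+ t []      g       = sym (ℚ.+-identityˡ _)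
  value-+ t (a ∷ f) []      = sym (ℚ.+-identityʳ _)
  value-+ t (a ∷ f) (b ∷ g) = begin
    value t (a + b ∷ f +ᴾ g)                    ≡⟨ value-∷ t (a + b) (f +ᴾ g) ⟩
    a + b + t * value t (f +ᴾ g)                ≡⟨ cong (λ z → a + b + t * z) (value-+ t f g) ⟩
    a + b + t * (value t f + value t g)         ≡⟨ ring a b t (value t f) (value t g) ⟩
    (a + t * value t f) + (b + t * value t g)   ≡⟨ cong₂ _+_ (value-∷ t a f) (value-∷ t b g) ⟨
    value t (a ∷ f) + value t (b ∷ g)           ∎
    where
    open ≡-Reasoning
    ring : ∀ a b t x y → a + b + t * (x + y) ≡ (a + t * x) + (b + t * y)
    ring = solve-∀ ℚ-ring

  value-· : ∀ t c f → value t (c ·ᴾ f) ≡ c * value t f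
  value-· t c []      = sym (ℚ.*-zeroʳ c)
  value-· t c (a ∷ f) = begin
    value t (c * a ∷ c ·ᴾ f)         ≡⟨ value-∷ t (c * a) (c ·ᴾ f) ⟩
    c * a + t * value t (c ·ᴾ f)     ≡⟨ cong (λ z → c * a + t * z) (value-· t c f) ⟩
    c * a + t * (c * value t f)      ≡⟨ ring c a t (value t f) ⟩
    c * (a + t * value t f)          ≡⟨ cong (c *_) (value-∷ t a f) ⟨
    c * value t (a ∷ f)              ∎
    where
    open ≡-Reasoning
    ring : ∀ c a t x → c * a + t * (c * x) ≡ c * (a + t * x)
    ring = solve-∀ ℚ-ring

  value-- : ∀ t f g → value t (f -ᴾ g) ≡ value t f - value t g
  value-- t f g = trans (value-+ t f ((- 1ℚ) ·ᴾ g)) (cong (value t f +_) (trans (value-· t (- 1ℚ) g) (ring (value t g))))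
    where
    ring : ∀ x → (- 1ℚ) * x ≡ - x
    ring = solve-∀ ℚ-ring

  value-* : ∀ t f g → value t (f *ᴾ g) ≡ value t f * value t g
  value-* t []      g = sym (ℚ.*-zeroˡ (value t g))
  value-* t (a ∷ f) g = begin
    value t (a ·ᴾ g +ᴾ (0ℚ ∷ f *ᴾ g))                ≡⟨ value-+ t (a ·ᴾ g) (0ℚ ∷ f *ᴾ g) ⟩
    value t (a ·ᴾ g) + value t (0ℚ ∷ f *ᴾ g)         ≡⟨ cong₂ _+_ (value-· t a g) (value-∷ t 0ℚ (f *ᴾ g)) ⟩
    a * value t g + (0ℚ + t * value t (f *ᴾ g))      ≡⟨ cong (λ z → a * value t g + (0ℚ + t * z)) (value-* t f g) ⟩
    a * value t g + (0ℚ + t * (value t f * value t g)) ≡⟨ ring a t (value t f) (value t g) ⟩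
    (a + t * value t f) * value t g                  ≡⟨ cong (_* value t g) (value-∷ t a f) ⟨
    value t (a ∷ f) * value t g                      ∎
    where
    open ≡-Reasoning
    ring : ∀ a t x y → a * y + (0ℚ + t * (x * y)) ≡ (a + t * x) * y
    ring = solve-∀ ℚ-ring

  value-^ : ∀ t f n → value t (f ^ᴾ n) ≡ value t f ^ n
  value-^ t f zero    = refl
  value-^ t f (suc n) = trans (value-* t f (f ^ᴾ n)) (cong (value t f *_) (value-^ t f n))

  value-∑ : ∀ {A : Set} t xs (f : A → Poly) → value t (∑ᴾ xs f) ≡ ∑[ x ∈ xs ] value t (f x)
  value-∑ t []       f = refl
  value-∑ t (x ∷ xs) f = trans (value-+ t (f x) (∑ᴾ xs f)) (cong (value t (f x) +_) (value-∑ t xs f))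

  value-linear : ∀ t b → value t (b ∷ 1ℚ ∷ []) ≡ t + b
  value-linear t b = trans (value-∷ t b (1ℚ ∷ [])) (trans (cong (λ z → b + t * z) (value-∷ t 1ℚ [])) (ring t b))
    where
    ring : ∀ t b → b + t * (1ℚ + t * 0ℚ) ≡ t + b
    ring = solve-∀ ℚ-ring

  -- Power series in u₁, u₂, … over ℚ

  Scalarᵁ : Set
  Scalarᵁ = Monomial → ℚ

  infixl 7 _*ˢ_

  _*ˢ_ : Scalarᵁ → Scalarᵁ → Scalarᵁ
  (F *ˢ H) m = ∑ (splits m) λ { (a , b) → F a * H b }

  1ˢᵁ : Scalarᵁ
  1ˢᵁ m = if degree m ℕ.≡ᵇ 0 then 1ℚ else 0ℚ

  linearˢ : Series → Scalarᵁ
  linearˢ a []                = 0ℚ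
  linearˢ a (0 ∷ m)           = linearˢ (a ∘ suc) m
  linearˢ a (1 ∷ m)           = if degree m ℕ.≡ᵇ 0 then a 0 else 0ℚ
  linearˢ a (suc (suc _) ∷ m) = 0ℚ

  *ˢ-cong : ∀ {F F′ G G′ : Scalarᵁ} → F ≗ F′ → G ≗ G′ → F *ˢ G ≗ F′ *ˢ G′
  *ˢ-cong p q m = ∑-cong (splits m) (λ { (a , b) → cong₂ _*_ (p a) (q b) })

  value-*ᵁ : ∀ t F G m → value t ((F *ᵁ G) m) ≡ ((value t ∘ F) *ˢ (value t ∘ G)) m
  value-*ᵁ t F G m = trans (value-∑ t (splits m) _) (∑-cong (splits m) (λ { (a , b) → value-* t (F a) (G b) }))

  value-1ᵁ : ∀ t m → value t (1ᵁ m) ≡ 1ˢᵁ m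
  value-1ᵁ t m with degree m ℕ.≡ᵇ 0
  ... | true  = refl
  ... | false = refl

  value-powerᵁ : ∀ t F {f} → value t ∘ F ≗ f → ∀ n m → value t (fold 1ᵁ (F *ᵁ_) n m) ≡ fold 1ˢᵁ (f *ˢ_) n m
  value-powerᵁ t F h zero    m = value-1ᵁ t m
  value-powerᵁ t F h (suc n) m = trans (value-*ᵁ t F (fold 1ᵁ (F *ᵁ_) n) m) (*ˢ-cong h (value-powerᵁ t F h n) m)

  value-linearᵁ : ∀ t a b m → value t (linear a m -ᴾ linear b m) ≡ linearˢ (λ n → value t (a n) - value t (b n)) m
  value-linearᵁ t a b []                = refl
  value-linearᵁ t a b (0 ∷ m)           = value-linearᵁ t (a ∘ suc) (b ∘ suc) m
  value-linearᵁ t a b (1 ∷ m) with degree m ℕ.≡ᵇ 0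
  ... | true  = value-- t (a 0) (b 0)
  ... | false = refl
  value-linearᵁ t a b (suc (suc _) ∷ m) = refl

  ∑-splits-∷ : ∀ (f : Monomial × Monomial → ℚ) e m →
    ∑ (splits (e ∷ m)) f ≡ ∑[ d ∈ upTo (suc e) ] ∑ (splits m) (λ { (a , b) → f (d ∷ a , (e ∸ d) ∷ b) })
  ∑-splits-∷ f e m = trans
    (∑-cartesianProductWith f _ (upTo (suc e)) (splits m))
    (∑-cong {g = λ d → ∑ (splits m) (λ { (a , b) → f (d ∷ a , (e ∸ d) ∷ b) })} (upTo (suc e))
      (λ d → ∑-cong (splits m) (λ { (a , b) → refl })))

  degree-zero-*ˢ : ∀ c G m → ∑ (splits m) (λ { (a , b) → (if degree a ℕ.≡ᵇ 0 then c else 0ℚ) * G b }) ≡ c * G m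
  degree-zero-*ˢ c G []      = ℚ.+-identityʳ (c * G [])
  degree-zero-*ˢ c G (e ∷ m) = begin
    ∑ (splits (e ∷ m)) f                 ≡⟨ ∑-splits-∷ f e m ⟩
    ∑ (upTo (suc e)) g                   ≡⟨ ∑-upTo-suc e g ⟩
    g 0 + ∑ (upTo e) (g ∘ suc)           ≡⟨ cong₂ _+_ (trans (∑-cong (splits m) (λ { (a , b) → refl })) (degree-zero-*ˢ c (λ b → G (e ∷ b)) m))
                                              (∑-0 (upTo e) (λ {d} _ → ∑-0 (splits m) (λ { {a , b} _ → ℚ.*-zeroˡ (G ((e ∸ suc d) ∷ b)) }))) ⟩
    c * G (e ∷ m) + 0ℚ                   ≡⟨ ℚ.+-identityʳ _ ⟩
    c * G (e ∷ m)                        ∎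
    where
    open ≡-Reasoning
    f : Monomial × Monomial → ℚ
    f (a , b) = (if degree a ℕ.≡ᵇ 0 then c else 0ℚ) * G b
    g : ℕ → ℚ
    g d = ∑ (splits m) (λ { (a , b) → f (d ∷ a , (e ∸ d) ∷ b) })

  linearˢ-*ˢ-zero : ∀ a G m → (linearˢ a *ˢ G) (0 ∷ m) ≡ (linearˢ (a ∘ suc) *ˢ (λ b → G (0 ∷ b))) m
  linearˢ-*ˢ-zero a G m = begin
    ∑ (splits (0 ∷ m)) f                 ≡⟨ ∑-splits-∷ f 0 m ⟩
    ∑ (splits m) (λ { (x , y) → f (0 ∷ x , 0 ∷ y) }) + 0ℚ ≡⟨ ℚ.+-identityʳ _ ⟩
    ∑ (splits m) (λ { (x , y) → f (0 ∷ x , 0 ∷ y) })      ≡⟨ ∑-cong (splits m) (λ { (x , y) → refl }) ⟩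
    (linearˢ (a ∘ suc) *ˢ (λ b → G (0 ∷ b))) m ∎
    where
    open ≡-Reasoning
    f : Monomial × Monomial → ℚ
    f (x , y) = linearˢ a x * G y

  linearˢ-*ˢ-suc : ∀ a G e m →
    (linearˢ a *ˢ G) (suc e ∷ m) ≡ (linearˢ (a ∘ suc) *ˢ (λ b → G (suc e ∷ b))) m + a 0 * G (e ∷ m)
  linearˢ-*ˢ-suc a G e m = begin
    ∑ (splits (suc e ∷ m)) f                     ≡⟨ ∑-splits-∷ f (suc e) m ⟩
    ∑ (upTo (suc (suc e))) g                     ≡⟨ ∑-upTo-suc (suc e) g ⟩
    g 0 + ∑ (upTo (suc e)) (g ∘ suc)             ≡⟨ cong₂ _+_ (∑-cong (splits m) (λ { (x , y) → refl })) (∑-upTo-suc e (g ∘ suc)) ⟩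
    (linearˢ (a ∘ suc) *ˢ (λ b → G (suc e ∷ b))) m + (g 1 + ∑ (upTo e) (λ d → g (suc (suc d))))
      ≡⟨ cong ((linearˢ (a ∘ suc) *ˢ (λ b → G (suc e ∷ b))) m +_) (trans (cong₂ _+_
           (trans (∑-cong (splits m) (λ { (x , y) → refl })) (degree-zero-*ˢ (a 0) (λ b → G (e ∷ b)) m))
           (∑-0 (upTo e) (λ {d} _ → ∑-0 (splits m) (λ { {x , y} _ → ℚ.*-zeroˡ (G ((suc e ∸ suc (suc d)) ∷ y)) }))))
           (ℚ.+-identityʳ (a 0 * G (e ∷ m)))) ⟩
    (linearˢ (a ∘ suc) *ˢ (λ b → G (suc e ∷ b))) m + a 0 * G (e ∷ m) ∎
    where
    open ≡-Reasoning
    f : Monomial × Monomial → ℚ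
    f (x , y) = linearˢ a x * G y
    g : ℕ → ℚ
    g d = ∑ (splits m) (λ { (x , y) → f (d ∷ x , (suc e ∸ d) ∷ y) })

  -- The coefficients of exp(a₀u₁ + a₁u₂ + ⋯).
  ℰ : Series → Scalarᵁ
  ℰ a []      = 1ℚ
  ℰ a (e ∷ m) = ε (a 0) e * ℰ (a ∘ suc) m

  -- The degree d part of e^L is L^d/d!, so multiplication by L turns it into d + 1 times the part
  -- of degree d + 1. The weight `g` on degrees is arbitrary because, past the first variable, the
  -- induction sees degrees shifted by its exponent. In degree 0 the factor `fromℕ (degree m)` is
  -- zero, whatever `pred` returns.
  linearˢ-*ˢ-ℰ : ∀ a (g : ℕ → ℚ) m →
    (linearˢ a *ˢ (λ b → g (degree b) * ℰ a b)) m ≡ fromℕ (degree m) * g (ℕ.pred (degree m)) * ℰ a m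
  linearˢ-*ˢ-ℰ a g [] = ring (g 0)
    where
    ring : ∀ x → 0ℚ * (x * 1ℚ) + 0ℚ ≡ 0ℚ * x * 1ℚ
    ring = solve-∀ ℚ-ring
  linearˢ-*ˢ-ℰ a g (zero ∷ m) = begin
    (linearˢ a *ˢ (λ b → g (degree b) * ℰ a b)) (0 ∷ m)
      ≡⟨ linearˢ-*ˢ-zero a (λ b → g (degree b) * ℰ a b) m ⟩
    (linearˢ (a ∘ suc) *ˢ (λ b → g (degree b) * (1ℚ * 1ℚ * ℰ (a ∘ suc) b))) m
      ≡⟨ *ˢ-cong {F = linearˢ (a ∘ suc)} (λ _ → refl) (λ b → cong (g (degree b) *_) (ℚ.*-identityˡ (ℰ (a ∘ suc) b))) m ⟩
    (linearˢ (a ∘ suc) *ˢ (λ b → g (degree b) * ℰ (a ∘ suc) b)) m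
      ≡⟨ linearˢ-*ˢ-ℰ (a ∘ suc) g m ⟩
    fromℕ (degree m) * g (ℕ.pred (degree m)) * ℰ (a ∘ suc) m
      ≡⟨ cong (fromℕ (degree m) * g (ℕ.pred (degree m)) *_) (ℚ.*-identityˡ (ℰ (a ∘ suc) m)) ⟨
    fromℕ (degree m) * g (ℕ.pred (degree m)) * ℰ a (0 ∷ m) ∎
    where open ≡-Reasoning
  linearˢ-*ˢ-ℰ a g (suc e ∷ m) = begin
    (linearˢ a *ˢ (λ b → g (degree b) * ℰ a b)) (suc e ∷ m)
      ≡⟨ linearˢ-*ˢ-suc a (λ b → g (degree b) * ℰ a b) e m ⟩
    (linearˢ (a ∘ suc) *ˢ (λ b → g (suc e ℕ.+ degree b) * (x * ℰ (a ∘ suc) b))) m + a 0 * (g (e ℕ.+ k) * (ε (a 0) e * y))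
      ≡⟨ cong (_+ a 0 * (g (e ℕ.+ k) * (ε (a 0) e * y))) (trans
           (∑-cong {g = λ p → x * (linearˢ (a ∘ suc) (proj₁ p) * (g (suc e ℕ.+ degree (proj₂ p)) * ℰ (a ∘ suc) (proj₂ p)))} (splits m)
             (λ { (b , c) → ring₁ (linearˢ (a ∘ suc) b) (g (suc e ℕ.+ degree c)) x (ℰ (a ∘ suc) c) }))
           (trans (∑-*ˡ x _ (splits m)) (cong (x *_) (trans (∑-cong (splits m) (λ { (b , c) → refl })) (linearˢ-*ˢ-ℰ (a ∘ suc) (λ j → g (suc e ℕ.+ j)) m))))) ⟩
    x * (fromℕ k * g (suc e ℕ.+ ℕ.pred k) * y) + a 0 * (g (e ℕ.+ k) * (ε (a 0) e * y))
      ≡⟨ cong₂ _+_ (cong (λ z → x * (z * y)) (shift k)) (ring₂ (a 0) (g (e ℕ.+ k)) (ε (a 0) e) y) ⟩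
    x * (fromℕ k * g (e ℕ.+ k) * y) + g (e ℕ.+ k) * (a 0 * ε (a 0) e) * y
      ≡⟨ cong (λ z → x * (fromℕ k * g (e ℕ.+ k) * y) + g (e ℕ.+ k) * z * y) (ε-suc (a 0) e) ⟨
    x * (fromℕ k * g (e ℕ.+ k) * y) + g (e ℕ.+ k) * (fromℕ (suc e) * x) * y
      ≡⟨ ring₃ x (fromℕ k) (g (e ℕ.+ k)) y (fromℕ (suc e)) ⟩
    (fromℕ (suc e) + fromℕ k) * g (e ℕ.+ k) * (x * y)
      ≡⟨ cong (λ z → z * g (e ℕ.+ k) * (x * y)) (fromℕ-+ (suc e) k) ⟨
    fromℕ (suc e ℕ.+ k) * g (e ℕ.+ k) * (x * y) ∎
    where
    open ≡-Reasoning
    k : ℕ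
    k = degree m
    x y : ℚ
    x = ε (a 0) (suc e)
    y = ℰ (a ∘ suc) m
    ring₁ : ∀ l g x y → l * (g * (x * y)) ≡ x * (l * (g * y))
    ring₁ = solve-∀ ℚ-ring
    ring₂ : ∀ a g e y → a * (g * (e * y)) ≡ g * (a * e) * y
    ring₂ = solve-∀ ℚ-ring
    ring₃ : ∀ x k g y s → x * (k * g * y) + g * (s * x) * y ≡ (s + k) * g * (x * y)
    ring₃ = solve-∀ ℚ-ring
    shift : ∀ k → fromℕ k * g (suc e ℕ.+ ℕ.pred k) ≡ fromℕ k * g (e ℕ.+ k)
    shift zero    = trans (ℚ.*-zeroˡ (g (suc e ℕ.+ 0))) (sym (ℚ.*-zeroˡ (g (e ℕ.+ 0))))
    shift (suc k) = cong (λ j → fromℕ (suc k) * g j) (sym (ℕ.+-suc e k))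

  ℰ-degree-zero : ∀ a m → degree m ≡ 0 → ℰ a m ≡ 1ℚ
  ℰ-degree-zero a []         eq = refl
  ℰ-degree-zero a (zero ∷ m) eq = trans (ℚ.*-identityˡ (ℰ (a ∘ suc) m)) (ℰ-degree-zero (a ∘ suc) m eq)

  -- L^n is n! times the degree n part of e^L; the induction feeds the weight n! on degree n, and
  -- zero elsewhere, into `linearˢ-*ˢ-ℰ`.
  powerˢ : ∀ a n m → fold 1ˢᵁ (linearˢ a *ˢ_) n m ≡ ⟦ does (degree m ℕ.≟ n) ⟧ * fromℕ (n !) * ℰ a m
  powerˢ a zero    m = lemma (degree m) refl
    where
    lemma : ∀ k → degree m ≡ k → (if k ℕ.≡ᵇ 0 then 1ℚ else 0ℚ) ≡ ⟦ does (k ℕ.≟ 0) ⟧ * 1ℚ * ℰ a m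
    lemma zero    eq = sym (trans (ℚ.*-identityˡ (ℰ a m)) (ℰ-degree-zero a m eq))
    lemma (suc k) eq = sym (ℚ.*-zeroˡ (ℰ a m))
  powerˢ a (suc n) m = begin
    (linearˢ a *ˢ fold 1ˢᵁ (linearˢ a *ˢ_) n) m                              ≡⟨ *ˢ-cong {F = linearˢ a} (λ _ → refl) (powerˢ a n) m ⟩
    (linearˢ a *ˢ (λ b → g (degree b) * ℰ a b)) m                            ≡⟨ linearˢ-*ˢ-ℰ a g m ⟩
    fromℕ (degree m) * g (ℕ.pred (degree m)) * ℰ a m                         ≡⟨ cong (_* ℰ a m) (lemma (degree m)) ⟩
    ⟦ does (degree m ℕ.≟ suc n) ⟧ * fromℕ (suc n !) * ℰ a m                  ∎
    where
    open ≡-Reasoning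
    g : ℕ → ℚ
    g k = ⟦ does (k ℕ.≟ n) ⟧ * fromℕ (n !)
    ring₁ : ∀ x y → x * (1ℚ * y) ≡ 1ℚ * (x * y)
    ring₁ = solve-∀ ℚ-ring
    ring₂ : ∀ x y z → x * (0ℚ * y) ≡ 0ℚ * z
    ring₂ = solve-∀ ℚ-ring
    lemma : ∀ k → fromℕ k * g (ℕ.pred k) ≡ ⟦ does (k ℕ.≟ suc n) ⟧ * fromℕ (suc n !)
    lemma zero    = trans (ℚ.*-zeroˡ (g 0)) (sym (ℚ.*-zeroˡ (fromℕ (suc n !))))
    lemma (suc k) with k ℕ.≟ n
    ... | yes refl = trans (cong (λ b → fromℕ (suc k) * (⟦ b ⟧ * fromℕ (k !))) (dec-true (k ℕ.≟ k) refl))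
                       (trans (ring₁ (fromℕ (suc k)) (fromℕ (k !))) (trans (cong (1ℚ *_) (sym (fromℕ-* (suc k) (k !))))
                         (cong (λ b → ⟦ b ⟧ * fromℕ (suc k !)) (sym (dec-true (suc k ℕ.≟ suc k) refl)))))
    ... | no k≢n   = trans (cong (λ b → fromℕ (suc k) * (⟦ b ⟧ * fromℕ (n !))) (dec-false (k ℕ.≟ n) k≢n))
                       (trans (ring₂ (fromℕ (suc k)) (fromℕ (n !)) (fromℕ (suc n !)))
                         (cong (λ b → ⟦ b ⟧ * fromℕ (suc n !)) (sym (dec-false (suc k ℕ.≟ suc n) (k≢n ∘ ℕ.suc-injective)))))

  ΔU : SeriesU
  ΔU m = U X m -ᴾ U (X -ᴾ (1ℚ ∷ [])) m

  Δ : ℚ → Series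
  Δ t n = t ^ suc n - (t - 1ℚ) ^ suc n

  -- U(t) - U(t - 1) is linear in the u_ℓ, so of the powers in `exp` only the one with n =
  -- `degree m` reaches u^m. This leaves the product of the (t^ℓ - (t - 1)^ℓ)^e/e! over the
  -- variables u_ℓ^e of m.
  value-exp-ΔU : ∀ t m → value t (exp ΔU m) ≡ ℰ (Δ t) m
  value-exp-ΔU t m = begin
    value t (exp ΔU m)
      ≡⟨ value-∑ t (upTo (suc (degree m))) (λ n → 1/ n ! ·ᴾ fold 1ᵁ (ΔU *ᵁ_) n m) ⟩
    ∑[ n ∈ upTo (suc (degree m)) ] value t (1/ n ! ·ᴾ fold 1ᵁ (ΔU *ᵁ_) n m)
      ≡⟨ ∑-cong (upTo (suc (degree m))) term ⟩
    ∑[ n ∈ upTo (suc (degree m)) ] ⟦ does (degree m ℕ.≟ n) ⟧ * ℰ (Δ t) m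
      ≡⟨ ∑-upTo-δ (suc (degree m)) (degree m) (λ _ → ℰ (Δ t) m) ℕ.≤-refl ⟩
    ℰ (Δ t) m ∎
    where
    open ≡-Reasoning
    ΔU-values : ∀ m → value t (ΔU m) ≡ linearˢ (Δ t) m
    ΔU-values m = trans (value-linearᵁ t _ _ m) (linearˢ-cong m (λ n → cong₂ _-_
      (trans (value-^ t X (suc n)) (cong (_^ suc n) (trans (value-linear t 0ℚ) (ℚ.+-identityʳ t))))
      (trans (value-^ t (X -ᴾ (1ℚ ∷ [])) (suc n)) (cong (_^ suc n) (value-linear t (- 1ℚ))))))
      where
      linearˢ-cong : ∀ {a b} m → (∀ n → a n ≡ b n) → linearˢ a m ≡ linearˢ b m
      linearˢ-cong []                h = refl
      linearˢ-cong (0 ∷ m)           h = linearˢ-cong m (h ∘ suc)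
      linearˢ-cong (1 ∷ m)           h = cong (if degree m ℕ.≡ᵇ 0 then_else 0ℚ) (h 0)
      linearˢ-cong (suc (suc _) ∷ m) h = refl
    ring : ∀ f d n e → f * (d * n * e) ≡ n * f * (d * e)
    ring = solve-∀ ℚ-ring
    term : ∀ n → value t (1/ n ! ·ᴾ fold 1ᵁ (ΔU *ᵁ_) n m) ≡ ⟦ does (degree m ℕ.≟ n) ⟧ * ℰ (Δ t) m
    term n = begin
      value t (1/ n ! ·ᴾ fold 1ᵁ (ΔU *ᵁ_) n m)            ≡⟨ value-· t (1/ n !) (fold 1ᵁ (ΔU *ᵁ_) n m) ⟩
      1/ n ! * value t (fold 1ᵁ (ΔU *ᵁ_) n m)             ≡⟨ cong (1/ n ! *_) (trans (value-powerᵁ t ΔU ΔU-values n m) (powerˢ (Δ t) n m)) ⟩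
      1/ n ! * (d * fromℕ (n !) * ℰ (Δ t) m)              ≡⟨ ring (1/ n !) d (fromℕ (n !)) (ℰ (Δ t) m) ⟩
      fromℕ (n !) * 1/ n ! * (d * ℰ (Δ t) m)              ≡⟨ cong (_* (d * ℰ (Δ t) m)) (!*1/! n) ⟩
      1ℚ * (d * ℰ (Δ t) m)                                ≡⟨ ℚ.*-identityˡ _ ⟩
      d * ℰ (Δ t) m                                       ∎
      where
      d : ℚ
      d = ⟦ does (degree m ℕ.≟ n) ⟧

  -- Homogeneity and the reflection t ↦ 1 - t

  ℰ-cong : ∀ {a b} → a ≗ b → ∀ m → ℰ a m ≡ ℰ b m
  ℰ-cong h []      = refl
  ℰ-cong h (e ∷ m) = cong₂ _*_ (cong (λ x → ε x e) (h 0)) (ℰ-cong (h ∘ suc) m)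

  ε-* : ∀ x y n → ε (x * y) n ≡ x ^ n * ε y n
  ε-* x y n = trans (cong (_* 1/ n !) (^-* x y n)) (ℚ.*-assoc (x ^ n) (y ^ n) (1/ n !))

  ℰ-scale-degree : ∀ r a m → ℰ (λ n → r * a n) m ≡ r ^ degree m * ℰ a m
  ℰ-scale-degree r a []      = refl
  ℰ-scale-degree r a (e ∷ m) = begin
    ε (r * a 0) e * ℰ (λ n → r * a (suc n)) m                     ≡⟨ cong₂ _*_ (ε-* r (a 0) e) (ℰ-scale-degree r (a ∘ suc) m) ⟩
    (r ^ e * ε (a 0) e) * (r ^ degree m * ℰ (a ∘ suc) m)          ≡⟨ ring (r ^ e) (ε (a 0) e) (r ^ degree m) (ℰ (a ∘ suc) m) ⟩
    r ^ e * r ^ degree m * ℰ a (e ∷ m)                            ≡⟨ cong (_* ℰ a (e ∷ m)) (^-+ r e (degree m)) ⟨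
    r ^ (e ℕ.+ degree m) * ℰ a (e ∷ m)                            ∎
    where
    open ≡-Reasoning
    ring : ∀ x y z w → (x * y) * (z * w) ≡ x * z * (y * w)
    ring = solve-∀ ℚ-ring

  ^-^ : ∀ x m n → x ^ (m ℕ.* n) ≡ (x ^ m) ^ n
  ^-^ x m zero    = cong (x ^_) (ℕ.*-zeroʳ m)
  ^-^ x m (suc n) = trans (cong (x ^_) (ℕ.*-suc m n)) (trans (^-+ x m (m ℕ.* n)) (cong (x ^ m *_) (^-^ x m n)))

  ℰ-scale-weight : ∀ x w a m → ℰ (λ n → x ^ (w ℕ.+ n) * a n) m ≡ x ^ weightFrom w m * ℰ a m
  ℰ-scale-weight x w a []      = refl
  ℰ-scale-weight x w a (e ∷ m) = begin
    ε (x ^ (w ℕ.+ 0) * a 0) e * ℰ (λ n → x ^ (w ℕ.+ suc n) * a (suc n)) m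
      ≡⟨ cong₂ _*_ (trans (cong (λ i → ε (x ^ i * a 0) e) (ℕ.+-identityʳ w)) (ε-* (x ^ w) (a 0) e))
                   (trans (ℰ-cong (λ n → cong (λ i → x ^ i * a (suc n)) (ℕ.+-suc w n)) m) (ℰ-scale-weight x (suc w) (a ∘ suc) m)) ⟩
    ((x ^ w) ^ e * ε (a 0) e) * (x ^ weightFrom (suc w) m * ℰ (a ∘ suc) m)
      ≡⟨ ring ((x ^ w) ^ e) (ε (a 0) e) (x ^ weightFrom (suc w) m) (ℰ (a ∘ suc) m) ⟩
    (x ^ w) ^ e * x ^ weightFrom (suc w) m * ℰ a (e ∷ m)
      ≡⟨ cong (_* ℰ a (e ∷ m)) (trans (cong (_* x ^ weightFrom (suc w) m) (sym (^-^ x w e))) (sym (^-+ x (w ℕ.* e) (weightFrom (suc w) m)))) ⟩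
    x ^ weightFrom w (e ∷ m) * ℰ a (e ∷ m) ∎
    where
    open ≡-Reasoning
    ring : ∀ x y z w → (x * y) * (z * w) ≡ x * z * (y * w)
    ring = solve-∀ ℚ-ring

  -- The coefficient t^(n+1) - (t - 1)^(n+1) of u_{n+1} acquires the sign (-1)^n, so u_ℓ counts with
  -- ℓ - 1, which is what `weightFrom 0` measures.
  value-reflect : ∀ t m → value (1ℚ - t) (exp ΔU m) ≡ (- 1ℚ) ^ weightFrom 0 m * value t (exp ΔU m)
  value-reflect t m = begin
    value (1ℚ - t) (exp ΔU m)                          ≡⟨ value-exp-ΔU (1ℚ - t) m ⟩
    ℰ (Δ (1ℚ - t)) m                                   ≡⟨ ℰ-cong reflect m ⟩
    ℰ (λ n → (- 1ℚ) ^ n * Δ t n) m                     ≡⟨ ℰ-scale-weight (- 1ℚ) 0 (Δ t) m ⟩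
    (- 1ℚ) ^ weightFrom 0 m * ℰ (Δ t) m                ≡⟨ cong ((- 1ℚ) ^ weightFrom 0 m *_) (value-exp-ΔU t m) ⟨
    (- 1ℚ) ^ weightFrom 0 m * value t (exp ΔU m)       ∎
    where
    open ≡-Reasoning
    ring₁ : ∀ t → 1ℚ - t ≡ - 1ℚ * (t - 1ℚ)
    ring₁ = solve-∀ ℚ-ring
    ring₂ : ∀ t → 1ℚ - t - 1ℚ ≡ - 1ℚ * t
    ring₂ = solve-∀ ℚ-ring
    ring₃ : ∀ s x y → (- 1ℚ * s) * y - (- 1ℚ * s) * x ≡ s * (x - y)
    ring₃ = solve-∀ ℚ-ring
    reflect : ∀ n → Δ (1ℚ - t) n ≡ (- 1ℚ) ^ n * Δ t n
    reflect n = begin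
      (1ℚ - t) ^ suc n - (1ℚ - t - 1ℚ) ^ suc n
        ≡⟨ cong₂ (λ x y → x ^ suc n - y ^ suc n) (ring₁ t) (ring₂ t) ⟩
      (- 1ℚ * (t - 1ℚ)) ^ suc n - (- 1ℚ * t) ^ suc n
        ≡⟨ cong₂ _-_ (^-* (- 1ℚ) (t - 1ℚ) (suc n)) (^-* (- 1ℚ) t (suc n)) ⟩
      (- 1ℚ) ^ suc n * (t - 1ℚ) ^ suc n - (- 1ℚ) ^ suc n * t ^ suc n
        ≡⟨ ring₃ ((- 1ℚ) ^ n) (t ^ suc n) ((t - 1ℚ) ^ suc n) ⟩
      (- 1ℚ) ^ n * Δ t n ∎

  -- Degree bounds

  infix 4 _hasDegree≤_

  -- In terms of coefficients, not of the length of the list: cancellation of leading terms leaves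
  -- zeros at its end.
  _hasDegree≤_ : Poly → ℕ → Set
  f hasDegree≤ n = ∀ {i} → n < i → coeff i f ≡ 0ℚ

  degree≤-mono : ∀ f {m n} → m ≤ n → f hasDegree≤ m → f hasDegree≤ n
  degree≤-mono f m≤n h n<i = h (ℕ.≤-<-trans m≤n n<i)

  degree≤-+ : ∀ {n} f g → f hasDegree≤ n → g hasDegree≤ n → f +ᴾ g hasDegree≤ n
  degree≤-+ f g p q {i} n<i = trans (coeff-+ i f g) (cong₂ _+_ (p n<i) (q n<i))

  degree≤-· : ∀ {n} c f → f hasDegree≤ n → c ·ᴾ f hasDegree≤ n
  degree≤-· c f p {i} n<i = trans (coeff-· i c f) (trans (cong (c *_) (p n<i)) (ℚ.*-zeroʳ c))

  coeff-zero-* : ∀ f g → (∀ i → coeff i f ≡ 0ℚ) → ∀ i → coeff i (f *ᴾ g) ≡ 0ℚ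
  coeff-zero-* []      g h i = refl
  coeff-zero-* (c ∷ f) g h i = trans (coeff-+ i (c ·ᴾ g) (0ℚ ∷ f *ᴾ g)) (cong₂ _+_
    (trans (coeff-· i c g) (trans (cong (_* coeff i g) (h 0)) (ℚ.*-zeroˡ (coeff i g))))
    (tail i))
    where
    tail : ∀ i → coeff i (0ℚ ∷ f *ᴾ g) ≡ 0ℚ
    tail zero    = refl
    tail (suc i) = coeff-zero-* f g (h ∘ suc) i

  degree≤-* : ∀ {m n} f g → f hasDegree≤ m → g hasDegree≤ n → f *ᴾ g hasDegree≤ (m ℕ.+ n)
  degree≤-* []      g p q _ = refl
  degree≤-* {m} {n} (c ∷ f) g p q {i} m+n<i = trans (coeff-+ i (c ·ᴾ g) (0ℚ ∷ f *ᴾ g)) (cong₂ _+_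
    (degree≤-· c g q (ℕ.≤-<-trans (ℕ.m≤n+m n m) m+n<i))
    (tail m i p m+n<i))
    where
    tail : ∀ m i → (c ∷ f) hasDegree≤ m → m ℕ.+ n < i → coeff i (0ℚ ∷ f *ᴾ g) ≡ 0ℚ
    tail zero    (suc i) p _           = coeff-zero-* f g (λ j → p {suc j} (s≤s z≤n)) i
    tail (suc m) (suc i) p (s≤s m+n<i) = degree≤-* {m} f g (λ m<j → p (s≤s m<j)) q m+n<i

  degree≤-∑ : ∀ {A : Set} {n} xs (f : A → Poly) → (∀ {x} → x ∈ xs → f x hasDegree≤ n) → ∑ᴾ xs f hasDegree≤ n
  degree≤-∑ []       f h _ = refl
  degree≤-∑ (x ∷ xs) f h   = degree≤-+ (f x) (∑ᴾ xs f) (h (here refl)) (degree≤-∑ xs f (h ∘ there))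

  one-degree≤ : ∀ n → (1ℚ ∷ []) hasDegree≤ n
  one-degree≤ n (s≤s _) = refl

  coeff-linear^-beyond : ∀ b n → ((b ∷ 1ℚ ∷ []) ^ᴾ n) hasDegree≤ n
  coeff-linear^-beyond b zero    = one-degree≤ 0
  coeff-linear^-beyond b (suc n) {suc i} (s≤s n<i) = begin
    coeff (suc i) ((b ∷ 1ℚ ∷ []) *ᴾ p)     ≡⟨ coeff-linear*-suc i b p ⟩
    b * coeff (suc i) p + coeff i p        ≡⟨ cong₂ (λ x y → b * x + y) (coeff-linear^-beyond b n (ℕ.m≤n⇒m≤1+n n<i)) (coeff-linear^-beyond b n n<i) ⟩
    b * 0ℚ + 0ℚ                            ≡⟨ trans (ℚ.+-identityʳ _) (ℚ.*-zeroʳ b) ⟩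
    0ℚ                                     ∎
    where
    open ≡-Reasoning
    p : Poly
    p = (b ∷ 1ℚ ∷ []) ^ᴾ n

  coeff-linear^-top : ∀ b n → coeff n ((b ∷ 1ℚ ∷ []) ^ᴾ n) ≡ 1ℚ
  coeff-linear^-top b zero    = refl
  coeff-linear^-top b (suc n) = begin
    coeff (suc n) ((b ∷ 1ℚ ∷ []) *ᴾ p)     ≡⟨ coeff-linear*-suc n b p ⟩
    b * coeff (suc n) p + coeff n p        ≡⟨ cong₂ (λ x y → b * x + y) (coeff-linear^-beyond b n ℕ.≤-refl) (coeff-linear^-top b n) ⟩
    b * 0ℚ + 1ℚ                            ≡⟨ cong (_+ 1ℚ) (ℚ.*-zeroʳ b) ⟩
    1ℚ                                     ∎
    where
    open ≡-Reasoning
    p : Poly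
    p = (b ∷ 1ℚ ∷ []) ^ᴾ n

  -- Two monic polynomials of degree n + 1 differ by one of degree at most n.
  Δᴾ-degree≤ : ∀ n → X ^ᴾ suc n -ᴾ (X -ᴾ (1ℚ ∷ [])) ^ᴾ suc n hasDegree≤ n
  Δᴾ-degree≤ n {i} n<i = trans (coeff-- i (X ^ᴾ suc n) ((X -ᴾ (1ℚ ∷ [])) ^ᴾ suc n)) (split (ℕ.m≤n⇒m<n∨m≡n n<i))
    where
    split : suc n < i ⊎ suc n ≡ i → coeff i (X ^ᴾ suc n) - coeff i ((X -ᴾ (1ℚ ∷ [])) ^ᴾ suc n) ≡ 0ℚ
    split (inj₁ 1+n<i) = cong₂ _-_ (coeff-linear^-beyond 0ℚ (suc n) 1+n<i) (coeff-linear^-beyond (- 1ℚ) (suc n) 1+n<i)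
    split (inj₂ refl)  = cong₂ _-_ (coeff-linear^-top 0ℚ (suc n)) (coeff-linear^-top (- 1ℚ) (suc n))

  linear-degree≤ : ∀ a b w → (∀ n → a n -ᴾ b n hasDegree≤ (w ℕ.+ n)) → ∀ m → linear a m -ᴾ linear b m hasDegree≤ weightFrom w m
  linear-degree≤ a b w h []      _ = refl
  linear-degree≤ a b w h (0 ∷ m) = degree≤-mono (linear (a ∘ suc) m -ᴾ linear (b ∘ suc) m) (ℕ.m≤n+m (weightFrom (suc w) m) (w ℕ.* 0))
    (linear-degree≤ (a ∘ suc) (b ∘ suc) (suc w) (λ n → subst (a (suc n) -ᴾ b (suc n) hasDegree≤_) (ℕ.+-suc w n) (h (suc n))) m)
  linear-degree≤ a b w h (1 ∷ m) with degree m ℕ.≡ᵇ 0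
  ... | true  = degree≤-mono (a 0 -ᴾ b 0) (ℕ.≤-trans (ℕ.≤-reflexive (trans (ℕ.+-identityʳ w) (sym (ℕ.*-identityʳ w)))) (ℕ.m≤m+n (w ℕ.* 1) _)) (h 0)
  ... | false = λ _ → refl
  linear-degree≤ a b w h (suc (suc e) ∷ m) _ = refl

  weightFrom-splits : ∀ m w {a b} → (a , b) ∈ splits m → weightFrom w a ℕ.+ weightFrom w b ≡ weightFrom w m
  weightFrom-splits []      w (here refl) = refl
  weightFrom-splits (e ∷ m) w ab∈ with ∈-cartesianProductWith⁻ _ (upTo (suc e)) (splits m) ab∈
  ... | d , (a , b) , d∈ , ab∈m , refl = begin
    w ℕ.* d ℕ.+ weightFrom (suc w) a ℕ.+ (w ℕ.* (e ∸ d) ℕ.+ weightFrom (suc w) b)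
      ≡⟨ +-exchange (w ℕ.* d) (weightFrom (suc w) a) (w ℕ.* (e ∸ d)) (weightFrom (suc w) b) ⟩
    w ℕ.* d ℕ.+ w ℕ.* (e ∸ d) ℕ.+ (weightFrom (suc w) a ℕ.+ weightFrom (suc w) b)
      ≡⟨ cong₂ ℕ._+_ (trans (sym (ℕ.*-distribˡ-+ w d (e ∸ d))) (cong (w ℕ.*_) (ℕ.m+[n∸m]≡n (ℕ.≤-pred (∈-upTo⁻ d∈))))) (weightFrom-splits m (suc w) ab∈m) ⟩
    w ℕ.* e ℕ.+ weightFrom (suc w) m ∎
    where
    open ≡-Reasoning
    +-exchange : ∀ a b c d → a ℕ.+ b ℕ.+ (c ℕ.+ d) ≡ a ℕ.+ c ℕ.+ (b ℕ.+ d)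
    +-exchange = ℕ-solve-∀

  power-degree≤ : ∀ F w → (∀ m → F m hasDegree≤ weightFrom w m) → ∀ n m → fold 1ᵁ (F *ᵁ_) n m hasDegree≤ weightFrom w m
  power-degree≤ F w h zero m with degree m ℕ.≡ᵇ 0
  ... | true  = one-degree≤ (weightFrom w m)
  ... | false = λ _ → refl
  power-degree≤ F w h (suc n) m = degree≤-∑ (splits m) _ (λ { {a , b} ab∈ →
    degree≤-mono (F a *ᴾ fold 1ᵁ (F *ᵁ_) n b) (ℕ.≤-reflexive (weightFrom-splits m w ab∈)) (degree≤-* (F a) (fold 1ᵁ (F *ᵁ_) n b) (h a) (power-degree≤ F w h n b)) })

  -- The coefficient of u_{n+1} in U(t) - U(t - 1) has degree at most n, and degrees add in products
  -- as `weightFrom 0` does.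
  exp-ΔU-degree≤ : ∀ m → exp ΔU m hasDegree≤ weightFrom 0 m
  exp-ΔU-degree≤ m = degree≤-∑ (upTo (suc (degree m))) (λ n → 1/ n ! ·ᴾ fold 1ᵁ (ΔU *ᵁ_) n m) (λ {n} _ →
    degree≤-· (1/ n !) (fold 1ᵁ (ΔU *ᵁ_) n m) (power-degree≤ ΔU 0 (linear-degree≤ _ _ 0 Δᴾ-degree≤) n m))

  pair-cong-coeff : ∀ {y z} f → (∀ d → coeff d f * y d ≡ coeff d f * z d) → pair y f ≡ pair z f
  pair-cong-coeff []      h = refl
  pair-cong-coeff (a ∷ f) h = cong₂ _+_ (h 0) (pair-cong-coeff f (h ∘ suc))

  -- Up to a shift of k by one, `τ` compares a derivative of f at 1 and at 0; from order n on that
  -- derivative is constant.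
  τ-vanishes : ∀ f {n k} → f hasDegree≤ n → n < k → τ f k ≡ 0ℚ
  τ-vanishes f {n} {suc k} deg (s≤s n≤k) = begin
    τ f (suc k)          ≡⟨ τ-suc f k ⟩
    δ 1ℚ k f - δ 0ℚ k f  ≡⟨ cong (_- δ 0ℚ k f) (pair-cong-coeff f same) ⟩
    δ 0ℚ k f - δ 0ℚ k f  ≡⟨ ℚ.+-inverseʳ (δ 0ℚ k f) ⟩
    0ℚ                   ∎
    where
    open ≡-Reasoning
    same : ∀ d → coeff d f * D 1ℚ d k ≡ coeff d f * D 0ℚ d k
    same d with ℕ.<-cmp d k
    ... | tri< d<k _ _  = cong (coeff d f *_) (trans (D-vanishes 1ℚ d<k) (sym (D-vanishes 0ℚ d<k)))
    ... | tri≈ _ refl _ = cong (coeff d f *_) (trans (D-top 1ℚ d) (sym (D-top 0ℚ d)))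
    ... | tri> _ _ k<d  = trans (cong (_* D 1ℚ d k) 0≡) (trans (ℚ.*-zeroˡ (D 1ℚ d k)) (sym (trans (cong (_* D 0ℚ d k) 0≡) (ℚ.*-zeroˡ (D 0ℚ d k)))))
      where
      0≡ : coeff d f ≡ 0ℚ
      0≡ = deg (ℕ.≤-<-trans n≤k k<d)

  -- Says that ρ^(k) has no terms of weight below 2 j + k in degree j; the weights i + 2 j + k with
  -- i ≥ 0 thus exhaust it.
  ρ-vanishes : ∀ k m → weightFrom 0 m < k → ρ⁽ k ⁾ m ≡ 0ℚ
  ρ-vanishes k m = τ-vanishes (exp ΔU m) (exp-ΔU-degree≤ m)

  -- Evaluation of elements of 𝓡, where q i is the value of Q_{i+1}

  monomialAt : Series → Monomial → ℚ
  monomialAt q []      = 1ℚ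
  monomialAt q (e ∷ m) = q 0 ^ e * monomialAt (q ∘ suc) m

  polyAt : Series → 𝓡 → ℚ
  polyAt q f = ∑[ t ∈ f ] proj₁ t * monomialAt q (proj₂ t)

  monomialAt-cong : ∀ {q r} m → (∀ {i} → i < length m → q i ≡ r i) → monomialAt q m ≡ monomialAt r m
  monomialAt-cong []      h = refl
  monomialAt-cong (e ∷ m) h = cong₂ _*_ (cong (_^ e) (h (s≤s z≤n))) (monomialAt-cong m (h ∘ s≤s))

  monomialAt-unique : ∀ Q (E : ℕ → Monomial → ℚ) → (∀ k → E k [] ≡ 1ℚ) →
    (∀ k e m → E k (e ∷ m) ≡ Q k ^ e * E (suc k) m) → ∀ k m → E k m ≡ monomialAt (λ i → Q (i ℕ.+ k)) m
  monomialAt-unique Q E E[] E∷ k []      = E[] k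
  monomialAt-unique Q E E[] E∷ k (e ∷ m) = trans (E∷ k e m) (cong (Q k ^ e *_)
    (trans (monomialAt-unique Q E E[] E∷ (suc k) m) (monomialAt-cong m (λ {i} _ → cong Q (ℕ.+-suc i k)))))

  mutual
    eval-polyAt : ∀ f μ → eval f μ ≡ polyAt (λ i → Qᶠ (i ℕ.+ 1) μ) f
    eval-polyAt f μ = ∑-cong f (term f μ)

    term : ∀ f μ (t : ℚ × Monomial) → _ ≡ _
    term f μ (c , m) with 1
    ... | k = cong (c *_) (evalᴹ-monomialAt f μ k m)

    evalᴹ-monomialAt : ∀ f μ k m → _ ≡ monomialAt (λ i → Qᶠ (i ℕ.+ k) μ) m
    evalᴹ-monomialAt f μ = monomialAt-unique (λ k → Qᶠ k μ) _ (λ _ → refl) (λ _ _ _ → refl)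

  polyAt-cong : ∀ {q r} f → (∀ i → q i ≡ r i) → polyAt q f ≡ polyAt r f
  polyAt-cong f h = ∑-cong f (λ t → cong (proj₁ t *_) (monomialAt-cong (proj₂ t) (λ {i} _ → h i)))

  eval-Qᵖ : ∀ f μ → eval f μ ≡ polyAt (Qᵖ (parts μ) ∘ suc) f
  eval-Qᵖ f μ = trans (eval-polyAt f μ) (polyAt-cong f (λ i → trans (cong (λ k → Qᶠ k μ) (ℕ.+-comm i 1)) (Qᶠ≡Qᵖ (suc i) μ)))

  polyAt-scale : ∀ q c f → polyAt q (scale c f) ≡ c * polyAt q f
  polyAt-scale q c f = trans (∑-map (λ t → proj₁ t * monomialAt q (proj₂ t)) _ f)
    (trans (∑-cong f (λ { (a , m) → ℚ.*-assoc c a (monomialAt q m) })) (∑-*ˡ c _ f))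

  polyAt-concatMap : ∀ {A : Set} q (g : A → 𝓡) xs → polyAt q (concatMap g xs) ≡ ∑[ x ∈ xs ] polyAt q (g x)
  polyAt-concatMap q = ∑-concatMap _

  increment : ℕ → Monomial → Monomial
  increment zero    []      = 1 ∷ []
  increment zero    (e ∷ m) = suc e ∷ m
  increment (suc k) []      = 0 ∷ increment k []
  increment (suc k) (e ∷ m) = e ∷ increment k m

  increment-unique : (I : ℕ → Monomial → Monomial) → I 0 [] ≡ 1 ∷ [] → (∀ e m → I 0 (e ∷ m) ≡ suc e ∷ m) →
    (∀ k → I (suc k) [] ≡ 0 ∷ I k []) → (∀ k e m → I (suc k) (e ∷ m) ≡ e ∷ I k m) → ∀ k m → I k m ≡ increment k m
  increment-unique I a b c d zero    []      = a
  increment-unique I a b c d zero    (e ∷ m) = b e m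
  increment-unique I a b c d (suc k) []      = trans (c k) (cong (0 ∷_) (increment-unique I a b c d k []))
  increment-unique I a b c d (suc k) (e ∷ m) = trans (d k e m) (cong (e ∷_) (increment-unique I a b c d k m))

  mutual
    Q·-increment : ∀ k f → (Q· (suc k)) f ≡ map (map₂ (increment k)) f
    Q·-increment k f = List.map-cong (λ { (c , m) → cong (c ,_) (raise-increment k m) }) f

    raise-increment : ∀ k m → _ ≡ increment k m
    raise-increment zero    []      = refl
    raise-increment zero    (e ∷ m) = refl
    raise-increment (suc k) []      = cong (0 ∷_) (raise-generalised k [])
    raise-increment (suc k) (e ∷ m) = cong (e ∷_) (raise-generalised k m)

    raise-generalised : ∀ k m → _ ≡ increment k m
    raise-generalised k m with suc k
    ... | n = raise-local n k m

    raise-local : ∀ (n : ℕ) k m → _ ≡ increment k m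
    raise-local n = increment-unique _ refl (λ _ _ → refl) (λ _ → refl) (λ _ _ _ → refl)

  monomialAt-increment : ∀ q k m → monomialAt q (increment k m) ≡ q k * monomialAt q m
  monomialAt-increment q zero    []      = cong (_* 1ℚ) (ℚ.*-identityʳ (q 0))
  monomialAt-increment q zero    (e ∷ m) = ℚ.*-assoc (q 0) (q 0 ^ e) (monomialAt (q ∘ suc) m)
  monomialAt-increment q (suc k) []      = trans (ℚ.*-identityˡ (monomialAt (q ∘ suc) (increment k []))) (monomialAt-increment (q ∘ suc) k [])
  monomialAt-increment q (suc k) (e ∷ m) = trans (cong (q 0 ^ e *_) (monomialAt-increment (q ∘ suc) k m)) (ring (q 0 ^ e) (q (suc k)) (monomialAt (q ∘ suc) m))
    where
    ring : ∀ x y z → x * (y * z) ≡ y * (x * z)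
    ring = solve-∀ ℚ-ring

  polyAt-Q· : ∀ (Q : Series) k f → Q 0 ≡ 1ℚ → polyAt (Q ∘ suc) ((Q· k) f) ≡ Q k * polyAt (Q ∘ suc) f
  polyAt-Q· Q zero    f Q₀ = sym (trans (cong (_* polyAt (Q ∘ suc) f) Q₀) (ℚ.*-identityˡ _))
  polyAt-Q· Q (suc k) f Q₀ = begin
    polyAt (Q ∘ suc) ((Q· (suc k)) f)                     ≡⟨ cong (polyAt (Q ∘ suc)) (Q·-increment k f) ⟩
    polyAt (Q ∘ suc) (map (map₂ (increment k)) f)         ≡⟨ ∑-map _ (map₂ (increment k)) f ⟩
    ∑[ t ∈ f ] proj₁ t * monomialAt (Q ∘ suc) (increment k (proj₂ t))
      ≡⟨ ∑-cong f (λ t → trans (cong (proj₁ t *_) (monomialAt-increment (Q ∘ suc) k (proj₂ t))) (ring (proj₁ t) (Q (suc k)) (monomialAt (Q ∘ suc) (proj₂ t)))) ⟩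
    ∑[ t ∈ f ] Q (suc k) * (proj₁ t * monomialAt (Q ∘ suc) (proj₂ t)) ≡⟨ ∑-*ˡ (Q (suc k)) _ f ⟩
    Q (suc k) * polyAt (Q ∘ suc) f                        ∎
    where
    open ≡-Reasoning
    ring : ∀ x y z → x * (y * z) ≡ y * (x * z)
    ring = solve-∀ ℚ-ring

  -- Taylor's formula in the variables p_ℓ

  monomialD : ℕ → ℕ → Series → Monomial → ℚ
  monomialD l       N q []      = D 1ℚ 0 N
  monomialD zero    N q (e ∷ m) = D (q 0) e N * monomialAt (q ∘ suc) m
  monomialD (suc l) N q (e ∷ m) = q 0 ^ e * monomialD l N (q ∘ suc) m

  polyD : ℕ → ℕ → Series → 𝓡 → ℚ
  polyD l N q f = ∑[ t ∈ f ] proj₁ t * monomialD l N q (proj₂ t)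

  monomialD-0 : ∀ l q m → monomialD l 0 q m ≡ monomialAt q m
  monomialD-0 l       q []      = refl
  monomialD-0 zero    q (e ∷ m) = refl
  monomialD-0 (suc l) q (e ∷ m) = cong (q 0 ^ e *_) (monomialD-0 l (q ∘ suc) m)

  polyD-∂ᴹ : ∀ l N q m → polyD l N q (∂ᴹ l m) ≡ monomialD l (suc N) q m
  polyD-∂ᴹ l       N q []          = refl
  polyD-∂ᴹ zero    N q (zero ∷ m)  = sym (ℚ.*-zeroˡ (monomialAt (q ∘ suc) m))
  polyD-∂ᴹ zero    N q (suc e ∷ m) = trans (ℚ.+-identityʳ _) (sym (ℚ.*-assoc (fromℕ (suc e)) (D (q 0) e N) (monomialAt (q ∘ suc) m)))
  polyD-∂ᴹ (suc l) N q (e ∷ m)     = begin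
    polyD (suc l) N q (map (map₂ (e ∷_)) (∂ᴹ l m))                                   ≡⟨ ∑-map _ (map₂ (e ∷_)) (∂ᴹ l m) ⟩
    ∑[ t ∈ ∂ᴹ l m ] proj₁ t * (q 0 ^ e * monomialD l N (q ∘ suc) (proj₂ t))          ≡⟨ ∑-cong (∂ᴹ l m) (λ t → ring (proj₁ t) (q 0 ^ e) (monomialD l N (q ∘ suc) (proj₂ t))) ⟩
    ∑[ t ∈ ∂ᴹ l m ] q 0 ^ e * (proj₁ t * monomialD l N (q ∘ suc) (proj₂ t))          ≡⟨ ∑-*ˡ (q 0 ^ e) _ (∂ᴹ l m) ⟩
    q 0 ^ e * polyD l N (q ∘ suc) (∂ᴹ l m)                                           ≡⟨ cong (q 0 ^ e *_) (polyD-∂ᴹ l N (q ∘ suc) m) ⟩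
    q 0 ^ e * monomialD l (suc N) (q ∘ suc) m                                        ∎
    where
    open ≡-Reasoning
    ring : ∀ x y z → x * (y * z) ≡ y * (x * z)
    ring = solve-∀ ℚ-ring

  polyD-scale : ∀ l N q c f → polyD l N q (scale c f) ≡ c * polyD l N q f
  polyD-scale l N q c f = trans (∑-map (λ t → proj₁ t * monomialD l N q (proj₂ t)) _ f)
    (trans (∑-cong f (λ { (a , m) → ℚ.*-assoc c a (monomialD l N q m) })) (∑-*ˡ c _ f))

  polyD-∂/∂p : ∀ l N q f → polyD l N q (∂/∂p l f) ≡ 1/ l ! * polyD l (suc N) q f
  polyD-∂/∂p l N q f = trans (polyD-scale l N q (1/ l !) (∂/∂Q₁₊ l f)) (cong (1/ l ! *_) (trans
    (∑-concatMap _ _ f)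
    (∑-cong f (λ { (c , m) → trans (polyD-scale l N q c (∂ᴹ l m)) (cong (c *_) (polyD-∂ᴹ l N q m)) }))))

  polyD-∂/∂p^ : ∀ l N q f e → polyD l N q (fold f (∂/∂p l) e) ≡ (1/ l !) ^ e * polyD l (e ℕ.+ N) q f
  polyD-∂/∂p^ l N q f zero    = sym (ℚ.*-identityˡ (polyD l N q f))
  polyD-∂/∂p^ l N q f (suc e) = begin
    polyD l N q (∂/∂p l (fold f (∂/∂p l) e))              ≡⟨ polyD-∂/∂p l N q (fold f (∂/∂p l) e) ⟩
    1/ l ! * polyD l (suc N) q (fold f (∂/∂p l) e)        ≡⟨ cong (1/ l ! *_) (polyD-∂/∂p^ l (suc N) q f e) ⟩
    1/ l ! * ((1/ l !) ^ e * polyD l (e ℕ.+ suc N) q f)   ≡⟨ ℚ.*-assoc (1/ l !) ((1/ l !) ^ e) _ ⟨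
    (1/ l !) ^ suc e * polyD l (e ℕ.+ suc N) q f          ≡⟨ cong (λ n → (1/ l !) ^ suc e * polyD l n q f) (ℕ.+-suc e N) ⟩
    (1/ l !) ^ suc e * polyD l (suc e ℕ.+ N) q f          ∎
    where open ≡-Reasoning

  bump : ℕ → ℚ → Series → Series
  bump zero    b q zero    = q 0 + b
  bump zero    b q (suc i) = q (suc i)
  bump (suc l) b q zero    = q 0
  bump (suc l) b q (suc i) = bump l b (q ∘ suc) i

  bump-at : ∀ l b q → bump l b q l ≡ q l + b
  bump-at zero    b q = refl
  bump-at (suc l) b q = bump-at l b (q ∘ suc)

  bump-other : ∀ l b q i → i ≢ l → bump l b q i ≡ q i
  bump-other zero    b q zero    i≢l = contradiction refl i≢l
  bump-other zero    b q (suc i) i≢l = refl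
  bump-other (suc l) b q zero    i≢l = refl
  bump-other (suc l) b q (suc i) i≢l = bump-other l b (q ∘ suc) i (i≢l ∘ cong suc)

  monomialD-taylor : ∀ {B} l b q m → 0 < B → All (_< B) m →
    ∑[ e ∈ upTo B ] ε b e * monomialD l e q m ≡ monomialAt (bump l b q) m
  monomialD-taylor l b q [] 0<B [] = D-taylor₀ 1ℚ b 0 0<B
  monomialD-taylor {B} zero b q (e ∷ m) 0<B (e<B ∷ _) = begin
    ∑[ n ∈ upTo B ] ε b n * (D (q 0) e n * monomialAt (q ∘ suc) m)   ≡⟨ ∑-cong (upTo B) (λ n → sym (ℚ.*-assoc (ε b n) (D (q 0) e n) (monomialAt (q ∘ suc) m))) ⟩
    ∑[ n ∈ upTo B ] ε b n * D (q 0) e n * monomialAt (q ∘ suc) m     ≡⟨ ∑-*ʳ (monomialAt (q ∘ suc) m) _ (upTo B) ⟩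
    (∑[ n ∈ upTo B ] ε b n * D (q 0) e n) * monomialAt (q ∘ suc) m   ≡⟨ cong (_* monomialAt (q ∘ suc) m) (D-taylor₀ (q 0) b e e<B) ⟩
    (q 0 + b) ^ e * monomialAt (q ∘ suc) m                           ∎
    where open ≡-Reasoning
  monomialD-taylor {B} (suc l) b q (e ∷ m) 0<B (_ ∷ m<B) = begin
    ∑[ n ∈ upTo B ] ε b n * (q 0 ^ e * monomialD l n (q ∘ suc) m)    ≡⟨ ∑-cong (upTo B) (λ n → ring (ε b n) (q 0 ^ e) (monomialD l n (q ∘ suc) m)) ⟩
    ∑[ n ∈ upTo B ] q 0 ^ e * (ε b n * monomialD l n (q ∘ suc) m)    ≡⟨ ∑-*ˡ (q 0 ^ e) _ (upTo B) ⟩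
    q 0 ^ e * (∑[ n ∈ upTo B ] ε b n * monomialD l n (q ∘ suc) m)    ≡⟨ cong (q 0 ^ e *_) (monomialD-taylor l b (q ∘ suc) m 0<B m<B) ⟩
    q 0 ^ e * monomialAt (bump l b (q ∘ suc)) m                      ∎
    where
    open ≡-Reasoning
    ring : ∀ x y z → x * (y * z) ≡ y * (x * z)
    ring = solve-∀ ℚ-ring

  -- Since ∂/∂p_l = (1/l!) ∂/∂Q_{l+1}, the operator exp(a ∂/∂p_l) translates Q_{l+1} by a/l!.
  -- Exponents below B make the exponential series stop in time.
  polyAt-taylor : ∀ {B} l a q f → 0 < B → All (λ t → All (_< B) (proj₂ t)) f →
    ∑[ e ∈ upTo B ] ε a e * polyAt q (fold f (∂/∂p l) e) ≡ polyAt (bump l (1/ l ! * a) q) f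
  polyAt-taylor {B} l a q f 0<B f<B = begin
    ∑[ e ∈ upTo B ] ε a e * polyAt q (fold f (∂/∂p l) e)
      ≡⟨ ∑-cong (upTo B) term₁ ⟩
    ∑[ e ∈ upTo B ] ∑[ t ∈ f ] proj₁ t * (ε b e * monomialD l e q (proj₂ t))
      ≡⟨ ∑-swap (λ e t → proj₁ t * (ε b e * monomialD l e q (proj₂ t))) (upTo B) f ⟩
    ∑[ t ∈ f ] ∑[ e ∈ upTo B ] proj₁ t * (ε b e * monomialD l e q (proj₂ t))
      ≡⟨ ∑-cong∈ f (λ {t} t∈f → trans (∑-*ˡ (proj₁ t) _ (upTo B)) (cong (proj₁ t *_) (monomialD-taylor l b q (proj₂ t) 0<B (All.lookup f<B t∈f)))) ⟩
    polyAt (bump l b q) f ∎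
    where
    open ≡-Reasoning
    b : ℚ
    b = 1/ l ! * a
    ring₁ : ∀ x y z → x * (y * z) ≡ y * x * z
    ring₁ = solve-∀ ℚ-ring
    ring₂ : ∀ x y z → x * (y * z) ≡ y * (x * z)
    ring₂ = solve-∀ ℚ-ring
    term₁ : ∀ e → ε a e * polyAt q (fold f (∂/∂p l) e) ≡ ∑[ t ∈ f ] proj₁ t * (ε b e * monomialD l e q (proj₂ t))
    term₁ e = begin
      ε a e * polyAt q (fold f (∂/∂p l) e)
        ≡⟨ cong (ε a e *_) (∑-cong (fold f (∂/∂p l) e) (λ t → cong (proj₁ t *_) (sym (monomialD-0 l q (proj₂ t))))) ⟩
      ε a e * polyD l 0 q (fold f (∂/∂p l) e)
        ≡⟨ cong (ε a e *_) (trans (polyD-∂/∂p^ l 0 q f e) (cong (λ n → (1/ l !) ^ e * polyD l n q f) (ℕ.+-identityʳ e))) ⟩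
      ε a e * ((1/ l !) ^ e * polyD l e q f)
        ≡⟨ trans (ring₁ (ε a e) ((1/ l !) ^ e) (polyD l e q f)) (cong (_* polyD l e q f) (sym (ε-* (1/ l !) a e))) ⟩
      ε b e * polyD l e q f
        ≡⟨ ∑-*ˡ (ε b e) _ f ⟨
      ∑[ t ∈ f ] ε b e * (proj₁ t * monomialD l e q (proj₂ t))
        ≡⟨ ∑-cong f (λ t → ring₂ (ε b e) (proj₁ t) (monomialD l e q (proj₂ t))) ⟩
      ∑[ t ∈ f ] proj₁ t * (ε b e * monomialD l e q (proj₂ t)) ∎

  module _ {P P′ : Monomial → Set} (l : ℕ) (∂ᴹ⁺ : ∀ m → P m → All (P′ ∘ proj₂) (∂ᴹ l m)) where

    All-∂/∂p : ∀ f → All (P ∘ proj₂) f → All (P′ ∘ proj₂) (∂/∂p l f)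
    All-∂/∂p f p = All.map⁺ (All.map id (All-∂/∂Q f p))
      where
      All-∂/∂Q : ∀ f → All (P ∘ proj₂) f → All (P′ ∘ proj₂) (∂/∂Q₁₊ l f)
      All-∂/∂Q []            []      = []
      All-∂/∂Q ((c , m) ∷ f) (p ∷ h) = All.++⁺ (All.map⁺ (All.map id (∂ᴹ⁺ m p))) (All-∂/∂Q f h)

  ∂ᴹ-exponents : ∀ {B} l m → All (_< B) m → All (λ t → All (_< B) (proj₂ t)) (∂ᴹ l m)
  ∂ᴹ-exponents l       []          _          = []
  ∂ᴹ-exponents zero    (zero ∷ m)  _          = []
  ∂ᴹ-exponents zero    (suc e ∷ m) (e<B ∷ h)  = (ℕ.<-trans (ℕ.n<1+n e) e<B ∷ h) ∷ []
  ∂ᴹ-exponents (suc l) (e ∷ m)     (e<B ∷ h)  = All.map⁺ (All.map (e<B ∷_) (∂ᴹ-exponents l m h))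

  ∂/∂p^-exponents : ∀ {B} l m f → All (λ t → All (_< B) (proj₂ t)) f → All (λ t → All (_< B) (proj₂ t)) (∂/∂p^From l m f)
  ∂/∂p^-exponents {B} l []      f h = h
  ∂/∂p^-exponents {B} l (e ∷ m) f h = iterate e
    where
    iterate : ∀ e → All (λ t → All (_< B) (proj₂ t)) (fold (∂/∂p^From (suc l) m f) (∂/∂p l) e)
    iterate zero    = ∂/∂p^-exponents (suc l) m f h
    iterate (suc e) = All-∂/∂p l (∂ᴹ-exponents l) (fold (∂/∂p^From (suc l) m f) (∂/∂p l) e) (iterate e)

  shift : ℕ → ℕ → Series → Series → Series
  shift l zero    a q = q
  shift l (suc L) a q = shift (suc l) L (a ∘ suc) (bump l (1/ l ! * a 0) q)

  -- One variable at a time. The remaining derivations sit inside the one treated, so the bound on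
  -- exponents must survive differentiation, which is `∂/∂p^-exponents`.
  polyAt-taylorᴸ : ∀ L b l a q f → All (λ t → All (_< suc b) (proj₂ t)) f →
    ∑[ m ∈ lists L b ] ℰ a m * polyAt q (∂/∂p^From l m f) ≡ polyAt (shift l L a q) f
  polyAt-taylorᴸ zero    b l a q f f<b = trans (ℚ.+-identityʳ _) (ℚ.*-identityˡ (polyAt q f))
  polyAt-taylorᴸ (suc L) b l a q f f<b = begin
    ∑[ m ∈ lists (suc L) b ] ℰ a m * polyAt q (∂/∂p^From l m f)
      ≡⟨ ∑-cartesianProductWith _ _∷_ (upTo (suc b)) (lists L b) ⟩
    ∑[ e ∈ upTo (suc b) ] ∑[ m ∈ lists L b ] F e m
      ≡⟨ ∑-swap F (upTo (suc b)) (lists L b) ⟩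
    ∑[ m ∈ lists L b ] ∑[ e ∈ upTo (suc b) ] F e m
      ≡⟨ ∑-cong (lists L b) (λ m → trans (∑-cong (upTo (suc b)) (λ e → ring (ε (a 0) e) (ℰ (a ∘ suc) m) (polyAt q (fold (∂/∂p^From (suc l) m f) (∂/∂p l) e))))
           (trans (∑-*ˡ (ℰ (a ∘ suc) m) (λ e → ε (a 0) e * polyAt q (fold (∂/∂p^From (suc l) m f) (∂/∂p l) e)) (upTo (suc b)))
             (cong (ℰ (a ∘ suc) m *_) (polyAt-taylor l (a 0) q (∂/∂p^From (suc l) m f) (s≤s z≤n) (∂/∂p^-exponents (suc l) m f f<b))))) ⟩
    ∑[ m ∈ lists L b ] ℰ (a ∘ suc) m * polyAt (bump l (1/ l ! * a 0) q) (∂/∂p^From (suc l) m f)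
      ≡⟨ polyAt-taylorᴸ L b (suc l) (a ∘ suc) (bump l (1/ l ! * a 0) q) f f<b ⟩
    polyAt (shift l (suc L) a q) f ∎
    where
    open ≡-Reasoning
    F : ℕ → Monomial → ℚ
    F e m = ε (a 0) e * ℰ (a ∘ suc) m * polyAt q (fold (∂/∂p^From (suc l) m f) (∂/∂p l) e)
    ring : ∀ x y z → x * y * z ≡ y * (x * z)
    ring = solve-∀ ℚ-ring

  shift-spec : ∀ L l (a q t : Series) → (∀ {i} → i < l → q i ≡ t i) → (∀ n → q (l ℕ.+ n) + 1/ (l ℕ.+ n) ! * a n ≡ t (l ℕ.+ n)) →
    ∀ {i} → i < l ℕ.+ L → shift l L a q i ≡ t i
  shift-spec zero    l a q t low high {i} i<l+0 = low (subst (i <_) (ℕ.+-identityʳ l) i<l+0)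
  shift-spec (suc L) l a q t low high {i} i<l+L = shift-spec L (suc l) (a ∘ suc) (bump l (1/ l ! * a 0) q) t low′ high′ (subst (i <_) (ℕ.+-suc l L) i<l+L)
    where
    low′ : ∀ {i} → i < suc l → bump l (1/ l ! * a 0) q i ≡ t i
    low′ {i} (s≤s i≤l) with ℕ.m≤n⇒m<n∨m≡n i≤l
    ... | inj₁ i<l  = trans (bump-other l (1/ l ! * a 0) q i (ℕ.<⇒≢ i<l)) (low i<l)
    ... | inj₂ refl = trans (bump-at l (1/ l ! * a 0) q) (subst (λ n → q n + 1/ n ! * a 0 ≡ t n) (ℕ.+-identityʳ l) (high 0))
    high′ : ∀ n → bump l (1/ l ! * a 0) q (suc l ℕ.+ n) + 1/ (suc l ℕ.+ n) ! * a (suc n) ≡ t (suc l ℕ.+ n)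
    high′ n = trans (cong (_+ 1/ (suc l ℕ.+ n) ! * a (suc n)) (bump-other l (1/ l ! * a 0) q (suc l ℕ.+ n) (ℕ.>⇒≢ (s≤s (ℕ.m≤m+n l n)))))
      (subst (λ k → q k + 1/ k ! * a (suc n) ≡ t k) (ℕ.+-suc l n) (high (suc n)))

  -- Derivations lower the weight

  ∂ᴹ-weight : ∀ l w m → All (λ t → weightFrom w (proj₂ t) ℕ.+ (w ℕ.+ l) ≡ weightFrom w m) (∂ᴹ l m)
  ∂ᴹ-weight l       w []          = []
  ∂ᴹ-weight zero    w (zero  ∷ m) = []
  ∂ᴹ-weight zero    w (suc e ∷ m) = ring w e (weightFrom (suc w) m) ∷ []
    where
    ring : ∀ w e x → w ℕ.* e ℕ.+ x ℕ.+ (w ℕ.+ 0) ≡ w ℕ.* suc e ℕ.+ x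
    ring = ℕ-solve-∀
  ∂ᴹ-weight (suc l) w (e ∷ m)     = All.map⁺ (All.map (λ {t} eq →
    trans (ring (w ℕ.* e) (weightFrom (suc w) (proj₂ t)) w l) (cong (w ℕ.* e ℕ.+_) eq)) (∂ᴹ-weight l (suc w) m))
    where
    ring : ∀ x y w l → x ℕ.+ y ℕ.+ (w ℕ.+ suc l) ≡ x ℕ.+ (y ℕ.+ (suc w ℕ.+ l))
    ring = ℕ-solve-∀

  HasWeight≤ : ℕ → ℕ → Monomial → Set
  HasWeight≤ W a m = weightFrom 1 m ℕ.+ a ≤ W

  ∂ᴹ-weight≤ : ∀ {W a} l m → HasWeight≤ W a m → All (HasWeight≤ W (suc l ℕ.+ a) ∘ proj₂) (∂ᴹ l m)
  ∂ᴹ-weight≤ {W} {a} l m h = All.map (λ {t} eq → subst (_≤ W)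
    (trans (cong (ℕ._+ a) (sym eq)) (ℕ.+-assoc (weightFrom 1 (proj₂ t)) (suc l) a)) h) (∂ᴹ-weight l 1 m)

  ∂/∂p^-weight≤ : ∀ {W a} l m f → All (HasWeight≤ W a ∘ proj₂) f →
    All (HasWeight≤ W (weightFrom (suc l) m ℕ.+ a) ∘ proj₂) (∂/∂p^From l m f)
  ∂/∂p^-weight≤         l []      f h = h
  ∂/∂p^-weight≤ {W} {a} l (e ∷ m) f h = iterate e
    where
    g : 𝓡
    g = ∂/∂p^From (suc l) m f
    x : ℕ
    x = weightFrom (suc (suc l)) m
    ring₀ : ∀ l x a → x ℕ.+ a ≡ suc l ℕ.* 0 ℕ.+ x ℕ.+ a
    ring₀ = ℕ-solve-∀
    ring₁ : ∀ l e x a → suc l ℕ.+ (suc l ℕ.* e ℕ.+ x ℕ.+ a) ≡ suc l ℕ.* suc e ℕ.+ x ℕ.+ a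
    ring₁ = ℕ-solve-∀
    iterate : ∀ e → All (HasWeight≤ W (suc l ℕ.* e ℕ.+ x ℕ.+ a) ∘ proj₂) (fold g (∂/∂p l) e)
    iterate zero    = subst (λ y → All (HasWeight≤ W y ∘ proj₂) g) (ring₀ l x a) (∂/∂p^-weight≤ (suc l) m f h)
    iterate (suc e) = subst (λ y → All (HasWeight≤ W y ∘ proj₂) (fold g (∂/∂p l) (suc e))) (ring₁ l e x a)
      (All-∂/∂p l (∂ᴹ-weight≤ l) (fold g (∂/∂p l) e) (iterate e))

  HasWeight≤-weightBound : ∀ f → All (HasWeight≤ (weightBound f) 0 ∘ proj₂) f
  HasWeight≤-weightBound []            = []
  HasWeight≤-weightBound ((c , m) ∷ f) =
    ℕ.≤-trans (ℕ.≤-reflexive (ℕ.+-identityʳ (weightFrom 1 m))) (ℕ.m≤m⊔n (weightFrom 1 m) (weightBound f)) ∷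
    All.map (λ h → ℕ.≤-trans h (ℕ.m≤n⊔m (weightFrom 1 m) (weightBound f))) (HasWeight≤-weightBound f)

  -- A derivation ∂/∂p_l lowers the weight by l + 1, so the product lowers it by `weightFrom 2 m`,
  -- more than any term of f has to lose.
  ∂/∂p^-vanishes : ∀ f m → weightBound f < weightFrom 2 m → ∂/∂p^ m f ≡ []
  ∂/∂p^-vanishes f m W<w = empty (∂/∂p^ m f) (∂/∂p^-weight≤ 1 m f (HasWeight≤-weightBound f))
    where
    empty : ∀ g → All (HasWeight≤ (weightBound f) (weightFrom 2 m ℕ.+ 0) ∘ proj₂) g → g ≡ []
    empty []            _       = refl
    empty ((c , n) ∷ g) (h ∷ _) = contradiction
      (ℕ.≤-trans (ℕ.≤-trans (ℕ.m≤m+n (weightFrom 2 m) 0) (ℕ.m≤n+m _ (weightFrom 1 n))) h) (ℕ.<⇒≱ W<w)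

  -- Sums over exponent lists of varying length and size

  ∑-lists-suc : ∀ L b (T : Monomial → ℚ) → ∑ (lists (suc L) b) T ≡ ∑[ e ∈ upTo (suc b) ] ∑[ m ∈ lists L b ] T (e ∷ m)
  ∑-lists-suc L b T = ∑-cartesianProductWith T _∷_ (upTo (suc b)) (lists L b)

  ∑-lists-bound : ∀ L {b b′} (T : Monomial → ℚ) → b ≤ b′ → (∀ m → b < degree m → T m ≡ 0ℚ) → ∑ (lists L b′) T ≡ ∑ (lists L b) T
  ∑-lists-bound zero    T b≤b′ h = refl
  ∑-lists-bound (suc L) {b} {b′} T b≤b′ h = begin
    ∑ (lists (suc L) b′) T                                        ≡⟨ ∑-lists-suc L b′ T ⟩
    ∑[ e ∈ upTo (suc b′) ] ∑[ m ∈ lists L b′ ] T (e ∷ m)          ≡⟨ ∑-cong (upTo (suc b′)) (λ e → ∑-lists-bound L (λ m → T (e ∷ m)) b≤b′ (λ m b<m → h (e ∷ m) (ℕ.<-≤-trans b<m (ℕ.m≤n+m (degree m) e)))) ⟩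
    ∑[ e ∈ upTo (suc b′) ] ∑[ m ∈ lists L b ] T (e ∷ m)           ≡⟨ ∑-upTo-extend (λ e → ∑[ m ∈ lists L b ] T (e ∷ m)) (s≤s b≤b′) (λ {e} b<e → ∑-0 (lists L b) (λ {m} _ → h (e ∷ m) (ℕ.<-≤-trans b<e (ℕ.m≤m+n e (degree m))))) ⟩
    ∑[ e ∈ upTo (suc b) ] ∑[ m ∈ lists L b ] T (e ∷ m)            ≡⟨ ∑-lists-suc L b T ⟨
    ∑ (lists (suc L) b) T                                         ∎
    where open ≡-Reasoning

  -- Lists from `lists` have a prescribed length, while a monomial is a list up to trailing zeros; a
  -- stable function depends on the monomial alone.
  Stable : (Monomial → ℚ) → Set
  Stable T = ∀ d m → T (m ++ replicate d 0) ≡ T m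

  ∑-lists-zero : ∀ d b w {W} (T : Monomial → ℚ) → Stable T → W < w → (∀ m → W < weightFrom w m → T m ≡ 0ℚ) →
    ∑ (lists d b) T ≡ T []
  ∑-lists-zero zero    b w T stable W<w h = ℚ.+-identityʳ (T [])
  ∑-lists-zero (suc d) b w {W} T stable W<w h = begin
    ∑ (lists (suc d) b) T                                  ≡⟨ ∑-lists-suc d b T ⟩
    ∑ (upTo (suc b)) S                                     ≡⟨ ∑-upTo-suc b S ⟩
    S 0 + ∑ (upTo b) (S ∘ suc)                             ≡⟨ cong₂ _+_
      (∑-lists-zero d b (suc w) (λ m → T (0 ∷ m)) (λ d m → stable d (0 ∷ m)) (ℕ.m<n⇒m<1+n W<w) (λ m lt → h (0 ∷ m) (ℕ.<-≤-trans lt (ℕ.m≤n+m _ (w ℕ.* 0)))))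
      (∑-0 (upTo b) (λ {e} _ → ∑-0 (lists d b) (λ {m} _ → h (suc e ∷ m) (ℕ.<-≤-trans W<w (ℕ.≤-trans (ℕ.m≤m*n w (suc e)) (ℕ.m≤m+n (w ℕ.* suc e) _)))))) ⟩
    T (0 ∷ []) + 0ℚ                                        ≡⟨ ℚ.+-identityʳ _ ⟩
    T (0 ∷ [])                                             ≡⟨ stable 1 [] ⟩
    T []                                                   ∎
    where
    open ≡-Reasoning
    S : ℕ → ℚ
    S e = ∑[ m ∈ lists d b ] T (e ∷ m)

  -- The variable behind the first L has weight w + L > W, so any positive exponent from there on
  -- puts the monomial where T vanishes; only padding by zeros is left.
  ∑-lists-length : ∀ L d b w {W} (T : Monomial → ℚ) → Stable T → W < w ℕ.+ L → (∀ m → W < weightFrom w m → T m ≡ 0ℚ) →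
    ∑ (lists (L ℕ.+ d) b) T ≡ ∑ (lists L b) T
  ∑-lists-length zero    d b w T stable W< h = trans (∑-lists-zero d b w T stable (subst (_ <_) (ℕ.+-identityʳ w) W<) h) (sym (ℚ.+-identityʳ (T [])))
  ∑-lists-length (suc L) d b w {W} T stable W< h = begin
    ∑ (lists (suc L ℕ.+ d) b) T                                   ≡⟨ ∑-lists-suc (L ℕ.+ d) b T ⟩
    ∑[ e ∈ upTo (suc b) ] ∑[ m ∈ lists (L ℕ.+ d) b ] T (e ∷ m)    ≡⟨ ∑-cong (upTo (suc b)) (λ e → ∑-lists-length L d b (suc w) (λ m → T (e ∷ m)) (λ d m → stable d (e ∷ m))
                                                                       (subst (W <_) (ℕ.+-suc w L) W<) (λ m lt → h (e ∷ m) (ℕ.<-≤-trans lt (ℕ.m≤n+m _ (w ℕ.* e))))) ⟩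
    ∑[ e ∈ upTo (suc b) ] ∑[ m ∈ lists L b ] T (e ∷ m)            ≡⟨ ∑-lists-suc L b T ⟨
    ∑ (lists (suc L) b) T                                         ∎
    where open ≡-Reasoning

  degree-stable : ∀ d m → degree (m ++ replicate d 0) ≡ degree m
  degree-stable zero    []      = refl
  degree-stable (suc d) []      = degree-stable d []
  degree-stable d       (e ∷ m) = cong (e ℕ.+_) (degree-stable d m)

  weightFrom-stable : ∀ w d m → weightFrom w (m ++ replicate d 0) ≡ weightFrom w m
  weightFrom-stable w zero    []      = refl
  weightFrom-stable w (suc d) []      = cong₂ ℕ._+_ (ℕ.*-zeroʳ w) (weightFrom-stable (suc w) d [])
  weightFrom-stable w d       (e ∷ m) = cong (w ℕ.* e ℕ.+_) (weightFrom-stable (suc w) d m)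

  ℰ-stable : ∀ a → Stable (ℰ a)
  ℰ-stable a zero    []      = refl
  ℰ-stable a (suc d) []      = trans (ℚ.*-identityˡ (ℰ (a ∘ suc) (replicate d 0))) (ℰ-stable (a ∘ suc) d [])
  ℰ-stable a d       (e ∷ m) = cong (ε (a 0) e *_) (ℰ-stable (a ∘ suc) d m)

  ∂/∂p^-stable : ∀ l f d m → ∂/∂p^From l (m ++ replicate d 0) f ≡ ∂/∂p^From l m f
  ∂/∂p^-stable l f zero    []      = refl
  ∂/∂p^-stable l f (suc d) []      = ∂/∂p^-stable (suc l) f d []
  ∂/∂p^-stable l f d       (e ∷ m) = cong (λ g → fold g (∂/∂p l) e) (∂/∂p^-stable (suc l) f d m)

  -- Degree, weight and excess of monomials

  ⟦⟧-∧ : ∀ a b → ⟦ a ∧ b ⟧ ≡ ⟦ a ⟧ * ⟦ b ⟧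
  ⟦⟧-∧ true  b = sym (ℚ.*-identityˡ ⟦ b ⟧)
  ⟦⟧-∧ false b = sym (ℚ.*-zeroˡ ⟦ b ⟧)

  does-⇔ : ∀ {a b} {A : Set a} {B : Set b} (a? : Dec A) (b? : Dec B) → (A → B) → (B → A) → does a? ≡ does b?
  does-⇔ (yes a) b? f g = sym (dec-true b? (f a))
  does-⇔ (no ¬a) b? f g = sym (dec-false b? (¬a ∘ g))

  weightFrom-suc : ∀ w m → weightFrom (suc w) m ≡ weightFrom w m ℕ.+ degree m
  weightFrom-suc w []      = refl
  weightFrom-suc w (e ∷ m) = trans (cong (suc w ℕ.* e ℕ.+_) (weightFrom-suc (suc w) m)) (ring w e (weightFrom (suc w) m) (degree m))
    where
    ring : ∀ w e x d → suc w ℕ.* e ℕ.+ (x ℕ.+ d) ≡ w ℕ.* e ℕ.+ x ℕ.+ (e ℕ.+ d)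
    ring = ℕ-solve-∀

  -- For a monomial of ρ^(k)_{i,j}, of weight i + 2 j + k and degree j, the excess `weightFrom 0` is
  -- i + k.
  weight-excess : ∀ m → weightFrom 2 m ≡ weightFrom 0 m ℕ.+ 2 ℕ.* degree m
  weight-excess m = trans (weightFrom-suc 1 m) (trans (cong (ℕ._+ degree m) (weightFrom-suc 0 m)) (ring (weightFrom 0 m) (degree m)))
    where
    ring : ∀ x d → x ℕ.+ d ℕ.+ d ≡ x ℕ.+ 2 ℕ.* d
    ring = ℕ-solve-∀

  degree≤weight : ∀ m → degree m ≤ weightFrom 2 m
  degree≤weight m = ℕ.≤-trans (ℕ.m≤n+m (degree m) (weightFrom 1 m)) (ℕ.≤-reflexive (sym (weightFrom-suc 1 m)))

  monomial? : ∀ j w (m : Monomial) → Dec (degree m ≡ j × weightFrom 2 m ≡ w)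
  monomial? j w m = (degree m ℕ.≟ j) ×-dec (weightFrom 2 m ℕ.≟ w)

  -- `monomials` draws from lists whose length and entries depend on w and j. A common L and b is
  -- required before summation over j and w can be carried inside.
  ∑-monomials : ∀ L b j w (T : Monomial → ℚ) → Stable T → j ≤ b → w ≤ L →
    ∑ (monomials j w) T ≡ ∑[ m ∈ lists L b ] ⟦ does (monomial? j w m) ⟧ * T m
  ∑-monomials L b j w T stable j≤b w≤L = begin
    ∑ (monomials j w) T                  ≡⟨ ∑-filter (monomial? j w) T (lists w j) ⟩
    ∑ (lists w j) S                      ≡⟨ ∑-lists-bound w S j≤b (λ m j<d → S-0 m (λ (d≡j , _) → ℕ.<⇒≢ j<d (sym d≡j))) ⟨
    ∑ (lists w b) S                      ≡⟨ ∑-lists-length w (L ∸ w) b 2 S S-stable (ℕ.m<n⇒m<1+n (ℕ.n<1+n w)) (λ m w<v → S-0 m (λ (_ , v≡w) → ℕ.<⇒≢ w<v (sym v≡w))) ⟨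
    ∑ (lists (w ℕ.+ (L ∸ w)) b) S        ≡⟨ cong (λ n → ∑ (lists n b) S) (ℕ.m+[n∸m]≡n w≤L) ⟩
    ∑ (lists L b) S                      ∎
    where
    open ≡-Reasoning
    S : Monomial → ℚ
    S m = ⟦ does (monomial? j w m) ⟧ * T m
    S-0 : ∀ m → ¬ (degree m ≡ j × weightFrom 2 m ≡ w) → S m ≡ 0ℚ
    S-0 m ¬p = trans (cong (λ b → ⟦ b ⟧ * T m) (dec-false (monomial? j w m) ¬p)) (ℚ.*-zeroˡ (T m))
    S-stable : Stable S
    S-stable d m = cong₂ (λ b x → ⟦ b ⟧ * x) (cong₂ (λ x y → does (x ℕ.≟ j) ∧ does (y ℕ.≟ w)) (degree-stable d m) (weightFrom-stable 2 d m)) (stable d m)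

  -- Every monomial of weight less than N has a unique degree j and excess e.
  ∑-all-monomials : ∀ N L b (T : Monomial → ℚ) → Stable T → (∀ m → N ≤ weightFrom 2 m → T m ≡ 0ℚ) → N ≤ b → 3 ℕ.* N ≤ L →
    ∑[ j ∈ upTo N ] ∑[ e ∈ upTo N ] ∑ (monomials j (e ℕ.+ 2 ℕ.* j)) T ≡ ∑ (lists L b) T
  ∑-all-monomials N L b T stable vanish N≤b 3N≤L = begin
    ∑[ j ∈ upTo N ] ∑[ e ∈ upTo N ] ∑ (monomials j (e ℕ.+ 2 ℕ.* j)) T
      -- The hypothesis 3 N ≤ L covers all weights e + 2 j with e, j < N.
      ≡⟨ ∑-upTo-cong N (λ {j} j<N → ∑-upTo-cong N (λ {e} e<N → ∑-monomials L b j (e ℕ.+ 2 ℕ.* j) T stable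
           (ℕ.≤-trans (ℕ.<⇒≤ j<N) N≤b) (ℕ.≤-trans (ℕ.+-mono-≤ (ℕ.<⇒≤ e<N) (ℕ.*-monoʳ-≤ 2 (ℕ.<⇒≤ j<N))) 3N≤L))) ⟩
    ∑[ j ∈ upTo N ] ∑[ e ∈ upTo N ] ∑[ m ∈ lists L b ] S j e m
      ≡⟨ ∑-cong (upTo N) (λ j → ∑-swap (S j) (upTo N) (lists L b)) ⟩
    ∑[ j ∈ upTo N ] ∑[ m ∈ lists L b ] ∑[ e ∈ upTo N ] S j e m
      ≡⟨ ∑-swap (λ j m → ∑[ e ∈ upTo N ] S j e m) (upTo N) (lists L b) ⟩
    ∑[ m ∈ lists L b ] ∑[ j ∈ upTo N ] ∑[ e ∈ upTo N ] S j e m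
      ≡⟨ ∑-cong (lists L b) single ⟩
    ∑ (lists L b) T ∎
    where
    open ≡-Reasoning
    S : ℕ → ℕ → Monomial → ℚ
    S j e m = ⟦ does (monomial? j (e ℕ.+ 2 ℕ.* j) m) ⟧ * T m
    S-split : ∀ j e m → S j e m ≡ ⟦ does (degree m ℕ.≟ j) ⟧ * (⟦ does (weightFrom 2 m ℕ.≟ e ℕ.+ 2 ℕ.* j) ⟧ * T m)
    S-split j e m = trans (cong (_* T m) (⟦⟧-∧ (does (degree m ℕ.≟ j)) (does (weightFrom 2 m ℕ.≟ e ℕ.+ 2 ℕ.* j)))) (ℚ.*-assoc ⟦ does (degree m ℕ.≟ j) ⟧ _ (T m))
    single : ∀ m → ∑[ j ∈ upTo N ] ∑[ e ∈ upTo N ] S j e m ≡ T m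
    single m with N ℕ.≤? weightFrom 2 m
    ... | yes N≤w = trans (∑-0 (upTo N) (λ {j} _ → ∑-0 (upTo N) (λ {e} _ → trans (cong (⟦ does (monomial? j (e ℕ.+ 2 ℕ.* j) m) ⟧ *_) (vanish m N≤w)) (ℚ.*-zeroʳ ⟦ does (monomial? j (e ℕ.+ 2 ℕ.* j) m) ⟧)))) (sym (vanish m N≤w))
    ... | no  N≰w = begin
      ∑[ j ∈ upTo N ] ∑[ e ∈ upTo N ] S j e m
        ≡⟨ ∑-cong (upTo N) (λ j → trans (∑-cong (upTo N) (λ e → S-split j e m)) (∑-*ˡ ⟦ does (degree m ℕ.≟ j) ⟧ _ (upTo N))) ⟩
      ∑[ j ∈ upTo N ] ⟦ does (degree m ℕ.≟ j) ⟧ * (∑[ e ∈ upTo N ] ⟦ does (weightFrom 2 m ℕ.≟ e ℕ.+ 2 ℕ.* j) ⟧ * T m)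
        ≡⟨ ∑-upTo-δ N (degree m) (λ j → ∑[ e ∈ upTo N ] ⟦ does (weightFrom 2 m ℕ.≟ e ℕ.+ 2 ℕ.* j) ⟧ * T m) (ℕ.≤-<-trans (degree≤weight m) w<N) ⟩
      ∑[ e ∈ upTo N ] ⟦ does (weightFrom 2 m ℕ.≟ e ℕ.+ 2 ℕ.* degree m) ⟧ * T m
        ≡⟨ ∑-cong (upTo N) (λ e → cong (λ b → ⟦ b ⟧ * T m) (does-⇔ (weightFrom 2 m ℕ.≟ e ℕ.+ 2 ℕ.* degree m) (weightFrom 0 m ℕ.≟ e)
             (λ eq → ℕ.+-cancelʳ-≡ (2 ℕ.* degree m) (weightFrom 0 m) e (trans (sym (weight-excess m)) eq))
             (λ eq → trans (weight-excess m) (cong (ℕ._+ 2 ℕ.* degree m) eq)))) ⟩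
      ∑[ e ∈ upTo N ] ⟦ does (weightFrom 0 m ℕ.≟ e) ⟧ * T m
        ≡⟨ ∑-upTo-δ N (weightFrom 0 m) (λ _ → T m) (ℕ.≤-<-trans (ℕ.≤-trans (ℕ.m≤m+n (weightFrom 0 m) _) (ℕ.≤-reflexive (sym (weight-excess m)))) w<N) ⟩
      T m ∎
      where
      w<N : weightFrom 2 m < N
      w<N = ℕ.≰⇒> N≰w

  ∑-square : ∀ N (F : ℕ → ℕ → ℚ) → (∀ i k → N ≤ i ℕ.+ k → F i k ≡ 0ℚ) →
    ∑[ i ∈ upTo N ] ∑[ k ∈ upTo N ] F i k ≡ ∑[ e ∈ upTo N ] ∑[ i ∈ upTo (suc e) ] F i (e ∸ i)
  ∑-square N F h = trans
    (∑-upTo-cong N (λ {k} _ → ∑-upTo-extend (F k) (ℕ.m∸n≤m N k) (λ {n} N∸k≤n → h k n (ℕ.≤-trans (ℕ.m≤n+m∸n N k) (ℕ.+-monoʳ-≤ k N∸k≤n)))))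
    (sym (∑-triangle N F))

  -- Signs and parity

  sign-square : ∀ k → (- 1ℚ) ^ k * (- 1ℚ) ^ k ≡ 1ℚ
  sign-square zero    = refl
  sign-square (suc k) = trans (ring ((- 1ℚ) ^ k)) (sign-square k)
    where
    ring : ∀ x → - 1ℚ * x * (- 1ℚ * x) ≡ x * x
    ring = solve-∀ ℚ-ring

  even-indicator : ∀ n → ⟦ even n ⟧ ≡ ½ * (1ℚ + (- 1ℚ) ^ n)
  even-indicator n = sym (trans (cong (λ x → ½ * (1ℚ + x)) (trans ([-x]^ n 1ℚ) (cong (λ x → if even n then x else - x) (1^ n)))) (lemma (even n)))
    where
    lemma : ∀ b → ½ * (1ℚ + (if b then 1ℚ else - 1ℚ)) ≡ ⟦ b ⟧
    lemma true  = refl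
    lemma false = refl

  -- Restricting to even i = e - k amounts to averaging over a sign (-1)^e (-1)^k; the factor (-1)^k
  -- turns c^k into (-c)^k, so `moments⁺` and `moments⁻` both apply.
  even-∸-indicator : ∀ {e k} → k ≤ e → ⟦ even (e ∸ k) ⟧ ≡ ½ * (1ℚ + (- 1ℚ) ^ e * (- 1ℚ) ^ k)
  even-∸-indicator {e} {k} k≤e = trans (even-indicator (e ∸ k)) (cong (λ x → ½ * (1ℚ + x)) (begin
    s (e ∸ k)                         ≡⟨ ring₁ (s (e ∸ k)) ⟩
    1ℚ * s (e ∸ k)                    ≡⟨ cong (_* s (e ∸ k)) (sign-square k) ⟨
    s k * s k * s (e ∸ k)             ≡⟨ ring₂ (s k) (s (e ∸ k)) ⟩
    s k * s (e ∸ k) * s k             ≡⟨ cong (_* s k) (trans (cong s (sym (ℕ.m+[n∸m]≡n k≤e))) (^-+ (- 1ℚ) k (e ∸ k))) ⟨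
    s e * s k                         ∎))
    where
    open ≡-Reasoning
    s : ℕ → ℚ
    s = (- 1ℚ) ^_
    ring₁ : ∀ x → x ≡ 1ℚ * x
    ring₁ = solve-∀ ℚ-ring
    ring₂ : ∀ x y → x * x * y ≡ x * y * x
    ring₂ = solve-∀ ℚ-ring

  -- The sum of all ρ_{i,j} for one hook length m

  size : 𝓡 → ℕ
  size []            = 0
  size ((c , m) ∷ f) = (degree m ℕ.+ length m) ℕ.⊔ size f

  size-exponents : ∀ f {b} → size f ≤ b → All (λ t → All (_< suc b) (proj₂ t)) f
  size-exponents []            _    = []
  size-exponents ((c , m) ∷ f) s≤b =
    exponents m (ℕ.≤-trans (ℕ.m≤m+n (degree m) (length m)) (ℕ.≤-trans (ℕ.m≤m⊔n _ (size f)) s≤b)) ∷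
    size-exponents f (ℕ.≤-trans (ℕ.m≤n⊔m (degree m ℕ.+ length m) _) s≤b)
    where
    exponents : ∀ {b} m → degree m ≤ b → All (_< suc b) m
    exponents []      _   = []
    exponents (e ∷ m) d≤b = s≤s (ℕ.≤-trans (ℕ.m≤m+n e (degree m)) d≤b) ∷ exponents m (ℕ.≤-trans (ℕ.m≤n+m (degree m) e) d≤b)

  size-length : ∀ f {t} → t ∈ f → length (proj₂ t) ≤ size f
  size-length ((c , m) ∷ f) (here refl) = ℕ.≤-trans (ℕ.m≤n+m (length m) (degree m)) (ℕ.m≤m⊔n _ (size f))
  size-length ((c , m) ∷ f) (there t∈f) = ℕ.≤-trans (size-length f t∈f) (ℕ.m≤n⊔m (degree m ℕ.+ length m) _)

  module _ (m : ℕ) (c : ℚ) (mc≡1 : fromℕ m * c ≡ 1ℚ) (ls : List ℕ) where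

    private
      M : ℚ
      M = fromℕ m

    M^c^ : ∀ k → M ^ k * c ^ k ≡ 1ℚ
    M^c^ k = trans (sym (^-* M c k)) (trans (cong (_^ k) mc≡1) (1^ k))

    -- By the reflection t ↦ 1 - t only k of the same parity as the excess contribute.
    parity-sum : ∀ μ → let e = weightFrom 0 μ in
      ∑[ k ∈ upTo (suc e) ] ⟦ even (e ∸ k) ⟧ * M ^ suc (e ∸ k) * (Qᵖ ls k * ρ⁽ k ⁾ μ) ≡ M ^ suc e * particle-sum c m (exp ΔU μ) ls
    parity-sum μ = begin
      ∑[ k ∈ upTo (suc e) ] ⟦ even (e ∸ k) ⟧ * M ^ suc (e ∸ k) * (Qᵖ ls k * ρ⁽ k ⁾ μ)
        ≡⟨ ∑-upTo-cong (suc e) (λ { {k} (s≤s k≤e) → summand k k≤e }) ⟩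
      ∑[ k ∈ upTo (suc e) ] ½ * M ^ suc e * (F c k + s * F (- c) k)
        ≡⟨ ∑-*ˡ (½ * M ^ suc e) (λ k → F c k + s * F (- c) k) (upTo (suc e)) ⟩
      ½ * M ^ suc e * (∑[ k ∈ upTo (suc e) ] (F c k + s * F (- c) k))
        ≡⟨ cong (½ * M ^ suc e *_) (trans (∑-+ (F c) (λ k → s * F (- c) k) (upTo (suc e))) (cong (∑ (upTo (suc e)) (F c) +_) (∑-*ˡ s (F (- c)) (upTo (suc e))))) ⟩
      ½ * M ^ suc e * (∑ (upTo (suc e)) (F c) + s * ∑ (upTo (suc e)) (F (- c)))
        ≡⟨ cong₂ (λ x y → ½ * M ^ suc e * (x + s * y)) (extend c) (extend (- c)) ⟩
      ½ * M ^ suc e * (∑ (upTo (suc B)) (F c) + s * ∑ (upTo (suc B)) (F (- c)))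
        -- The moments for c give the particle sum, those for -c give s times it, and s² = 1 makes
        -- the two halves equal.
        ≡⟨ cong₂ (λ x y → ½ * M ^ suc e * (x + s * y)) (moments⁺ c m f ls mc≡1 (ℕ.m≤m+n (length f) e))
             (moments⁻ c m f ls s mc≡1 (ℕ.m≤m+n (length f) e) (λ t → value-reflect t μ)) ⟩
      ½ * M ^ suc e * (particle-sum c m f ls + s * (s * particle-sum c m f ls))
        ≡⟨ ring₁ (M ^ suc e) s (particle-sum c m f ls) ⟩
      M ^ suc e * (½ * particle-sum c m f ls + s * s * (½ * particle-sum c m f ls))
        ≡⟨ cong (λ z → M ^ suc e * (½ * particle-sum c m f ls + z * (½ * particle-sum c m f ls))) (sign-square e) ⟩
      M ^ suc e * (½ * particle-sum c m f ls + 1ℚ * (½ * particle-sum c m f ls))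
        ≡⟨ ring₂ (M ^ suc e) (particle-sum c m f ls) ⟩
      M ^ suc e * particle-sum c m f ls ∎
      where
      open ≡-Reasoning
      e B : ℕ
      e = weightFrom 0 μ
      f : Poly
      f = exp ΔU μ
      B = length f ℕ.+ e
      s : ℚ
      s = (- 1ℚ) ^ e
      F : ℚ → ℕ → ℚ
      F c k = Qᵖ ls k * c ^ k * τ f k
      extend : ∀ c → ∑ (upTo (suc e)) (F c) ≡ ∑ (upTo (suc B)) (F c)
      extend c = sym (∑-upTo-extend (F c) (s≤s (ℕ.m≤n+m e (length f))) (λ {k} e<k →
        trans (cong (Qᵖ ls k * c ^ k *_) (ρ-vanishes k μ e<k)) (ℚ.*-zeroʳ (Qᵖ ls k * c ^ k))))
      ring₁ : ∀ p s x → ½ * p * (x + s * (s * x)) ≡ p * (½ * x + s * s * (½ * x))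
      ring₁ = solve-∀ ℚ-ring
      ring₂ : ∀ p x → p * (½ * x + 1ℚ * (½ * x)) ≡ p * x
      ring₂ = solve-∀ ℚ-ring
      ring₃ : ∀ s t M p q r → ½ * (1ℚ + s * t) * (M * p) * (q * r) ≡ ½ * M * (q * p * r + s * (q * (t * p) * r))
      ring₃ = solve-∀ ℚ-ring
      summand : ∀ k → k ≤ e → ⟦ even (e ∸ k) ⟧ * M ^ suc (e ∸ k) * (Qᵖ ls k * τ f k) ≡ ½ * M ^ suc e * (F c k + s * F (- c) k)
      summand k k≤e = begin
        ⟦ even (e ∸ k) ⟧ * M ^ suc (e ∸ k) * (Qᵖ ls k * τ f k)
          ≡⟨ cong₂ (λ x y → x * y * (Qᵖ ls k * τ f k)) (even-∸-indicator k≤e) M-power ⟩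
        ½ * (1ℚ + s * (- 1ℚ) ^ k) * (M ^ suc e * c ^ k) * (Qᵖ ls k * τ f k)
          ≡⟨ ring₃ s ((- 1ℚ) ^ k) (M ^ suc e) (c ^ k) (Qᵖ ls k) (τ f k) ⟩
        ½ * M ^ suc e * (F c k + s * (Qᵖ ls k * ((- 1ℚ) ^ k * c ^ k) * τ f k))
          ≡⟨ cong (λ x → ½ * M ^ suc e * (F c k + s * (Qᵖ ls k * x * τ f k))) (trans (sym (^-* (- 1ℚ) c k)) (cong (_^ k) (ring₄ c))) ⟩
        ½ * M ^ suc e * (F c k + s * F (- c) k) ∎
        where
        ring₄ : ∀ c → - 1ℚ * c ≡ - c
        ring₄ = solve-∀ ℚ-ring
        ring₆ : ∀ x y z → x * (y * z) ≡ y * x * z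
        ring₆ = solve-∀ ℚ-ring
        M-power : M ^ suc (e ∸ k) ≡ M ^ suc e * c ^ k
        M-power = begin
          M ^ suc (e ∸ k)                      ≡⟨ ℚ.*-identityʳ _ ⟨
          M ^ suc (e ∸ k) * 1ℚ                 ≡⟨ cong (M ^ suc (e ∸ k) *_) (M^c^ k) ⟨
          M ^ suc (e ∸ k) * (M ^ k * c ^ k)    ≡⟨ ring₆ (M ^ suc (e ∸ k)) (M ^ k) (c ^ k) ⟩
          M ^ k * M ^ suc (e ∸ k) * c ^ k      ≡⟨ cong (_* c ^ k) (^-+ M k (suc (e ∸ k))) ⟨
          M ^ (k ℕ.+ suc (e ∸ k)) * c ^ k      ≡⟨ cong (λ n → M ^ n * c ^ k) (trans (ℕ.+-suc k (e ∸ k)) (cong suc (ℕ.m+[n∸m]≡n k≤e))) ⟩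
          M ^ suc e * c ^ k                    ∎

    module _ (f : 𝓡) (t : ℕ) where

      private
        T₀ r : ℚ
        T₀ = fromℕ t
        r = T₀ * c

        q : Series
        q = Qᵖ ls ∘ suc

        T : Monomial → ℚ
        T μ = polyAt q (∂/∂p^ μ f)

      -- The increment of the power sums p₁, p₂, … when r particles move from x - m to x.
      jump : ℚ → Series
      jump x n = r * (x ^ suc n - (x - M) ^ suc n)

      -- At t = x/m the differences t^(n+1) - (t - 1)^(n+1) are x^(n+1) - (x - m)^(n+1) over
      -- m^(n+1). A factor m per unit of excess and T₀ per degree leaves the coefficient T₀/m = r.
      jump-ℰ : ∀ x μ → T₀ ^ degree μ * (M ^ weightFrom 0 μ * value (x * c) (exp ΔU μ)) ≡ ℰ (jump x) μ
      jump-ℰ x μ = begin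
        T₀ ^ degree μ * (M ^ weightFrom 0 μ * value (x * c) (exp ΔU μ))    ≡⟨ cong (λ z → T₀ ^ degree μ * (M ^ weightFrom 0 μ * z)) (value-exp-ΔU (x * c) μ) ⟩
        T₀ ^ degree μ * (M ^ weightFrom 0 μ * ℰ (Δ (x * c)) μ)             ≡⟨ cong (T₀ ^ degree μ *_) (ℰ-scale-weight M 0 (Δ (x * c)) μ) ⟨
        T₀ ^ degree μ * ℰ (λ n → M ^ n * Δ (x * c) n) μ                    ≡⟨ ℰ-scale-degree T₀ (λ n → M ^ n * Δ (x * c) n) μ ⟨
        ℰ (λ n → T₀ * (M ^ n * Δ (x * c) n)) μ                             ≡⟨ ℰ-cong rescale μ ⟩
        ℰ (jump x) μ                                                       ∎
        where
        open ≡-Reasoning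
        ring₂ : ∀ x M c → x * c - M * c ≡ (x - M) * c
        ring₂ = solve-∀ ℚ-ring
        ring₃ : ∀ T M p q c d → T * (M * (p * (c * d) - q * (c * d))) ≡ T * c * (p - q) * (M * d)
        ring₃ = solve-∀ ℚ-ring
        rescale : ∀ n → T₀ * (M ^ n * Δ (x * c) n) ≡ jump x n
        rescale n = begin
          T₀ * (M ^ n * ((x * c) ^ suc n - (x * c - 1ℚ) ^ suc n))
            ≡⟨ cong (λ z → T₀ * (M ^ n * ((x * c) ^ suc n - z ^ suc n))) (trans (cong (λ z → x * c - z) (sym mc≡1)) (ring₂ x M c)) ⟩
          T₀ * (M ^ n * ((x * c) ^ suc n - ((x - M) * c) ^ suc n))
            ≡⟨ cong₂ (λ y z → T₀ * (M ^ n * (y - z))) (^-* x c (suc n)) (^-* (x - M) c (suc n)) ⟩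
          T₀ * (M ^ n * (x ^ suc n * (c * c ^ n) - (x - M) ^ suc n * (c * c ^ n)))
            ≡⟨ ring₃ T₀ (M ^ n) (x ^ suc n) ((x - M) ^ suc n) c (c ^ n) ⟩
          jump x n * (M ^ n * c ^ n)
            ≡⟨ trans (cong (jump x n *_) (M^c^ n)) (ℚ.*-identityʳ (jump x n)) ⟩
          jump x n ∎

      particle-ℰ : Monomial → ℚ
      particle-ℰ μ = rowdiff (λ y → ℰ (jump (y + M)) μ - ℰ (jump y) μ) ½ ls + (∑[ s ∈ upTo m ] ℰ (jump (fromℕ s + ½)) μ)

      V : Monomial → ℚ
      V μ = T μ * particle-ℰ μ

      particle-sum-V : ∀ μ → T₀ ^ degree μ * (M ^ suc (weightFrom 0 μ) * particle-sum c m (exp ΔU μ) ls) * T μ ≡ V μ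
      particle-sum-V μ = begin
        T₀ ^ degree μ * (M * P * (c * (rowdiff R₀ ½ ls + ∑ (upTo m) S₀))) * T μ
          ≡⟨ ring₁ (T₀ ^ degree μ) M P c (rowdiff R₀ ½ ls) (∑ (upTo m) S₀) (T μ) ⟩
        T μ * (M * c) * (T₀ ^ degree μ * P * rowdiff R₀ ½ ls + T₀ ^ degree μ * P * ∑ (upTo m) S₀)
          ≡⟨ cong₂ (λ x y → T μ * x * y) mc≡1 (cong₂ _+_ (sym (rowdiff-* (T₀ ^ degree μ * P) R₀ ½ ls)) (sym (∑-*ˡ (T₀ ^ degree μ * P) S₀ (upTo m)))) ⟩
        T μ * 1ℚ * (rowdiff (λ y → T₀ ^ degree μ * P * R₀ y) ½ ls + (∑[ s ∈ upTo m ] T₀ ^ degree μ * P * S₀ s))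
          ≡⟨ cong₂ (λ x y → x * y) (ℚ.*-identityʳ (T μ)) (cong₂ _+_
               (rowdiff-cong rowterm ½ ls)
               (∑-cong (upTo m) (λ s → trans (ℚ.*-assoc (T₀ ^ degree μ) P _) (jump-ℰ (fromℕ s + ½) μ)))) ⟩
        V μ ∎
        where
        open ≡-Reasoning
        P : ℚ
        P = M ^ weightFrom 0 μ
        R₀ : ℚ → ℚ
        R₀ y = value (1ℚ + y * c) (exp ΔU μ) - value (y * c) (exp ΔU μ)
        S₀ : ℕ → ℚ
        S₀ s = value ((fromℕ s + ½) * c) (exp ΔU μ)
        ring₁ : ∀ d M P c x y T → d * (M * P * (c * (x + y))) * T ≡ T * (M * c) * (d * P * x + d * P * y)
        ring₁ = solve-∀ ℚ-ring
        ring₂ : ∀ d P x y → d * P * (x - y) ≡ d * (P * x) - d * (P * y)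
        ring₂ = solve-∀ ℚ-ring
        ring₃ : ∀ M y c → M * c + y * c ≡ (y + M) * c
        ring₃ = solve-∀ ℚ-ring
        rowterm : ∀ y → T₀ ^ degree μ * P * R₀ y ≡ ℰ (jump (y + M)) μ - ℰ (jump y) μ
        rowterm y = trans (ring₂ (T₀ ^ degree μ) P (value (1ℚ + y * c) (exp ΔU μ)) (value (y * c) (exp ΔU μ)))
          (cong₂ _-_
            (trans (cong (λ z → T₀ ^ degree μ * (P * value z (exp ΔU μ))) (trans (cong (_+ y * c) (sym mc≡1)) (ring₃ M y c))) (jump-ℰ (y + M) μ))
            (jump-ℰ y μ))

      V-stable : Stable V
      V-stable d μ = cong₂ _*_ (cong (polyAt q) (∂/∂p^-stable 1 f d μ)) (cong₂ _+_
        (rowdiff-cong (λ y → cong₂ _-_ (ℰ-stable (jump (y + M)) d μ) (ℰ-stable (jump y) d μ)) ½ ls)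
        (∑-cong (upTo m) (λ s → ℰ-stable (jump (fromℕ s + ½)) d μ)))

      T-vanishes : ∀ μ → weightBound f < weightFrom 2 μ → T μ ≡ 0ℚ
      T-vanishes μ W<w = cong (polyAt q) (∂/∂p^-vanishes f μ W<w)

      polyAt-ρ : ∀ i j → polyAt q (ρ i j f) ≡
        ∑[ k ∈ upTo (suc (weightBound f)) ] Qᵖ ls k * (∑[ μ ∈ monomials j (i ℕ.+ 2 ℕ.* j ℕ.+ k) ] ρ⁽ k ⁾ μ * T μ)
      polyAt-ρ i j = trans
        (polyAt-concatMap q (λ k → ρ-summand i j k f) (upTo (suc (weightBound f))))
        (∑-cong {g = λ k → Qᵖ ls k * (∑[ μ ∈ monomials j (i ℕ.+ 2 ℕ.* j ℕ.+ k) ] ρ⁽ k ⁾ μ * T μ)} (upTo (suc (weightBound f))) (λ k →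
          trans (polyAt-Q· (Qᵖ ls) k (concatMap (λ μ → scale (ρ⁽ k ⁾ μ) (∂/∂p^ μ f)) (monomials j (i ℕ.+ 2 ℕ.* j ℕ.+ k))) refl)
          (cong (Qᵖ ls k *_) (trans (polyAt-concatMap q (λ μ → scale (ρ⁽ k ⁾ μ) (∂/∂p^ μ f)) (monomials j (i ℕ.+ 2 ℕ.* j ℕ.+ k)))
            (∑-cong (monomials j (i ℕ.+ 2 ℕ.* j ℕ.+ k)) (λ μ → polyAt-scale q (ρ⁽ k ⁾ μ) (∂/∂p^ μ f)))))))

      -- As p_i = i! Q_{i+1}, the value of Q_{i+1} moves by the increment of p_i over i!. For i = 0
      -- the increment vanishes, so Q_1 stays fixed.
      shifted : ℚ → ℚ
      shifted x = polyAt (λ i → q i + 1/ i ! * (r * (x ^ i - (x - M) ^ i))) f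

      shifted-lists : ∀ x L b → size f ≤ L → size f ≤ b → ∑[ μ ∈ lists L b ] ℰ (jump x) μ * T μ ≡ shifted x
      shifted-lists x L b s≤L s≤b = trans
        (polyAt-taylorᴸ L b 1 (jump x) q f (size-exponents f s≤b))
        (∑-cong∈ f (λ {t} t∈f → cong (proj₁ t *_) (monomialAt-cong (proj₂ t) (λ i<l →
          shift-spec L 1 (jump x) q _ low (λ n → refl) (s≤s (ℕ.<⇒≤ (ℕ.<-≤-trans i<l (ℕ.≤-trans (size-length f t∈f) s≤L))))))))
        where
        ring : ∀ y r → y ≡ y + 1/ 0 ! * (r * (1ℚ - 1ℚ))
        ring y r = sym (trans (cong (y +_) (trans (ℚ.*-identityˡ (r * (1ℚ - 1ℚ))) (ℚ.*-zeroʳ r))) (ℚ.+-identityʳ y))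
        low : ∀ {i} → i < 1 → q i ≡ q i + 1/ i ! * (r * (x ^ i - (x - M) ^ i))
        low {zero} (s≤s z≤n) = ring (q 0) r

      V-lists : ∀ L b → size f ≤ L → size f ≤ b →
        ∑ (lists L b) V ≡ rowdiff (λ y → shifted (y + M) - shifted y) ½ ls + (∑[ s ∈ upTo m ] shifted (fromℕ s + ½))
      V-lists L b s≤L s≤b = begin
        ∑ (lists L b) V
          ≡⟨ ∑-cong (lists L b) (λ μ → ℚ.*-distribˡ-+ (T μ) (rowdiff (θ μ) ½ ls) (∑ (upTo m) (η μ))) ⟩
        ∑[ μ ∈ lists L b ] (T μ * rowdiff (θ μ) ½ ls + T μ * ∑ (upTo m) (η μ))
          ≡⟨ ∑-+ (λ μ → T μ * rowdiff (θ μ) ½ ls) (λ μ → T μ * ∑ (upTo m) (η μ)) (lists L b) ⟩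
        (∑[ μ ∈ lists L b ] T μ * rowdiff (θ μ) ½ ls) + (∑[ μ ∈ lists L b ] T μ * ∑ (upTo m) (η μ))
          ≡⟨ cong₂ _+_ rows sea ⟩
        rowdiff (λ y → shifted (y + M) - shifted y) ½ ls + (∑[ s ∈ upTo m ] shifted (fromℕ s + ½)) ∎
        where
        open ≡-Reasoning
        θ : Monomial → ℚ → ℚ
        θ μ y = ℰ (jump (y + M)) μ - ℰ (jump y) μ
        η : Monomial → ℕ → ℚ
        η μ s = ℰ (jump (fromℕ s + ½)) μ
        ring : ∀ t x y → t * (x - y) ≡ x * t - y * t
        ring = solve-∀ ℚ-ring
        rows : ∑[ μ ∈ lists L b ] T μ * rowdiff (θ μ) ½ ls ≡ rowdiff (λ y → shifted (y + M) - shifted y) ½ ls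
        rows = trans (sym (rowdiff-∑ T θ (lists L b) ½ ls)) (rowdiff-cong (λ y → trans
          (trans (∑-cong (lists L b) (λ μ → ring (T μ) (ℰ (jump (y + M)) μ) (ℰ (jump y) μ)))
                 (∑-- (λ μ → ℰ (jump (y + M)) μ * T μ) (λ μ → ℰ (jump y) μ * T μ) (lists L b)))
          (cong₂ _-_ (shifted-lists (y + M) L b s≤L s≤b) (shifted-lists y L b s≤L s≤b))) ½ ls)
        sea : ∑[ μ ∈ lists L b ] T μ * ∑ (upTo m) (η μ) ≡ ∑[ s ∈ upTo m ] shifted (fromℕ s + ½)
        sea = trans (∑-cong (lists L b) (λ μ → sym (∑-*ˡ (T μ) (η μ) (upTo m))))
          (trans (∑-swap (λ μ s → T μ * η μ s) (lists L b) (upTo m))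
            (∑-cong (upTo m) (λ s → trans (∑-cong (lists L b) (λ μ → ℚ.*-comm (T μ) (η μ s))) (shifted-lists (fromℕ s + ½) L b s≤L s≤b))))

      module _ (N : ℕ) (W<N : weightBound f < N) where

        private
          S : ℕ → ℕ → ℕ → ℚ
          S j w k = ∑[ μ ∈ monomials j w ] ρ⁽ k ⁾ μ * T μ

          F : ℕ → ℕ → ℕ → ℚ
          F j i k = ⟦ even i ⟧ * (M ^ suc i * T₀ ^ j) * (Qᵖ ls k * S j (i ℕ.+ 2 ℕ.* j ℕ.+ k) k)

          F-vanishes : ∀ j i k → weightBound f < i ℕ.+ k → F j i k ≡ 0ℚ
          F-vanishes j i k W<i+k = trans
            (cong (λ z → ⟦ even i ⟧ * (M ^ suc i * T₀ ^ j) * (Qᵖ ls k * z)) (∑-0 (monomials j w) (λ {μ} μ∈ → trans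
              (cong (ρ⁽ k ⁾ μ *_) (T-vanishes μ (ℕ.<-≤-trans W<i+k (ℕ.≤-trans i+k≤w (ℕ.≤-reflexive (sym (proj₂ (proj₂ (∈-filter⁻ (monomial? j w) {xs = lists w j} μ∈)))))))))
              (ℚ.*-zeroʳ (ρ⁽ k ⁾ μ)))))
            (trans (cong (⟦ even i ⟧ * (M ^ suc i * T₀ ^ j) *_) (ℚ.*-zeroʳ (Qᵖ ls k))) (ℚ.*-zeroʳ (⟦ even i ⟧ * (M ^ suc i * T₀ ^ j))))
            where
            w : ℕ
            w = i ℕ.+ 2 ℕ.* j ℕ.+ k
            i+k≤w : i ℕ.+ k ≤ w
            i+k≤w = ℕ.+-monoˡ-≤ k (ℕ.m≤m+n i (2 ℕ.* j))

          -- For i + k = e all monomials have the same weight e + 2 j, so the sum over k can be done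
          -- one monomial at a time, where `parity-sum` applies.
          diagonal : ∀ j e → ∑[ i ∈ upTo (suc e) ] F j i (e ∸ i) ≡ ∑ (monomials j (e ℕ.+ 2 ℕ.* j)) V
          diagonal j e = begin
            ∑[ i ∈ upTo (suc e) ] F j i (e ∸ i)
              ≡⟨ ∑-upTo-reverse (suc e) (λ i → F j i (e ∸ i)) ⟩
            ∑[ k ∈ upTo (suc e) ] F j (e ∸ k) (e ∸ (e ∸ k))
              ≡⟨ ∑-upTo-cong (suc e) (λ { {k} (s≤s k≤e) → trans (cong (F j (e ∸ k)) (ℕ.m∸[m∸n]≡n k≤e))
                   (trans (cong (λ w → a k * (Qᵖ ls k * S j w k)) (weight k k≤e))
                     (trans (cong (a k *_) (sym (∑-*ˡ (Qᵖ ls k) (λ μ → ρ⁽ k ⁾ μ * T μ) (monomials j v))))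
                       (sym (∑-*ˡ (a k) (λ μ → Qᵖ ls k * (ρ⁽ k ⁾ μ * T μ)) (monomials j v))))) }) ⟩
            ∑[ k ∈ upTo (suc e) ] ∑[ μ ∈ monomials j v ] a k * (Qᵖ ls k * (ρ⁽ k ⁾ μ * T μ))
              ≡⟨ ∑-swap (λ k μ → a k * (Qᵖ ls k * (ρ⁽ k ⁾ μ * T μ))) (upTo (suc e)) (monomials j v) ⟩
            ∑[ μ ∈ monomials j v ] ∑[ k ∈ upTo (suc e) ] a k * (Qᵖ ls k * (ρ⁽ k ⁾ μ * T μ))
              ≡⟨ ∑-cong∈ (monomials j v) (λ {μ} μ∈ → column-sum μ (proj₂ (∈-filter⁻ (monomial? j v) {xs = lists v j} μ∈))) ⟩
            ∑ (monomials j v) V ∎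
            where
            open ≡-Reasoning
            v : ℕ
            v = e ℕ.+ 2 ℕ.* j
            a : ℕ → ℚ
            a k = ⟦ even (e ∸ k) ⟧ * (M ^ suc (e ∸ k) * T₀ ^ j)
            weight : ∀ k → k ≤ e → e ∸ k ℕ.+ 2 ℕ.* j ℕ.+ k ≡ v
            weight k k≤e = trans (ring (e ∸ k) j k) (cong (ℕ._+ 2 ℕ.* j) (ℕ.m∸n+n≡m k≤e))
              where
              ring : ∀ d j k → d ℕ.+ 2 ℕ.* j ℕ.+ k ≡ d ℕ.+ k ℕ.+ 2 ℕ.* j
              ring = ℕ-solve-∀
            ring : ∀ b p d q r t → b * (p * d) * (q * (r * t)) ≡ d * (b * p * (q * r)) * t
            ring = solve-∀ ℚ-ring
            column-sum : ∀ μ → degree μ ≡ j × weightFrom 2 μ ≡ v → ∑[ k ∈ upTo (suc e) ] a k * (Qᵖ ls k * (ρ⁽ k ⁾ μ * T μ)) ≡ V μ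
            column-sum μ (d≡j , w≡v) = collect d≡j (ℕ.+-cancelʳ-≡ (2 ℕ.* j) (weightFrom 0 μ) e
              (trans (cong (λ d → weightFrom 0 μ ℕ.+ 2 ℕ.* d) (sym d≡j)) (trans (sym (weight-excess μ)) w≡v)))
              where
              b : ℕ → ℚ
              b k = ⟦ even (e ∸ k) ⟧ * M ^ suc (e ∸ k) * (Qᵖ ls k * ρ⁽ k ⁾ μ)
              collect : degree μ ≡ j → weightFrom 0 μ ≡ e → ∑[ k ∈ upTo (suc e) ] a k * (Qᵖ ls k * (ρ⁽ k ⁾ μ * T μ)) ≡ V μ
              collect refl refl = begin
                ∑[ k ∈ upTo (suc e) ] a k * (Qᵖ ls k * (ρ⁽ k ⁾ μ * T μ))
                  ≡⟨ ∑-cong (upTo (suc e)) (λ k → ring ⟦ even (e ∸ k) ⟧ (M ^ suc (e ∸ k)) (T₀ ^ j) (Qᵖ ls k) (ρ⁽ k ⁾ μ) (T μ)) ⟩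
                ∑[ k ∈ upTo (suc e) ] T₀ ^ j * b k * T μ
                  ≡⟨ ∑-*ʳ (T μ) (λ k → T₀ ^ j * b k) (upTo (suc e)) ⟩
                (∑[ k ∈ upTo (suc e) ] T₀ ^ j * b k) * T μ
                  ≡⟨ cong (_* T μ) (trans (∑-*ˡ (T₀ ^ j) b (upTo (suc e))) (cong (T₀ ^ j *_) (parity-sum μ))) ⟩
                T₀ ^ j * (M ^ suc e * particle-sum c m (exp ΔU μ) ls) * T μ
                  ≡⟨ particle-sum-V μ ⟩
                V μ ∎

        -- The factor m^(i+1) t^j is m^(i+j+1) r^j with r = t/m, and the restriction to even i
        -- reflects the vanishing of Eisenstein series of odd index. Regrouping by excess reaches
        -- every monomial once; the sum over monomials is then Taylor's formula in the p_ℓ.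
        ρ-sum : ∑[ i ∈ upTo N ] ∑[ j ∈ upTo N ] ⟦ even i ⟧ * (M ^ suc i * T₀ ^ j) * polyAt q (ρ i j f) ≡
          rowdiff (λ y → shifted (y + M) - shifted y) ½ ls + (∑[ s ∈ upTo m ] shifted (fromℕ s + ½))
        ρ-sum = begin
          ∑[ i ∈ upTo N ] ∑[ j ∈ upTo N ] ⟦ even i ⟧ * (M ^ suc i * T₀ ^ j) * polyAt q (ρ i j f)
            ≡⟨ ∑-swap (λ i j → ⟦ even i ⟧ * (M ^ suc i * T₀ ^ j) * polyAt q (ρ i j f)) (upTo N) (upTo N) ⟩
          ∑[ j ∈ upTo N ] ∑[ i ∈ upTo N ] ⟦ even i ⟧ * (M ^ suc i * T₀ ^ j) * polyAt q (ρ i j f)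
            ≡⟨ ∑-cong (upTo N) (λ j → ∑-cong (upTo N) (λ i → trans
                 (cong (⟦ even i ⟧ * (M ^ suc i * T₀ ^ j) *_) (polyAt-ρ i j))
                 (trans (sym (∑-*ˡ (⟦ even i ⟧ * (M ^ suc i * T₀ ^ j)) (λ k → Qᵖ ls k * S j (i ℕ.+ 2 ℕ.* j ℕ.+ k) k) (upTo (suc (weightBound f)))))
                   (sym (∑-upTo-extend (F j i) W<N (λ {k} W<k → F-vanishes j i k (ℕ.<-≤-trans W<k (ℕ.m≤n+m k i)))))))) ⟩
          ∑[ j ∈ upTo N ] ∑[ i ∈ upTo N ] ∑ (upTo N) (F j i)
            ≡⟨ ∑-cong (upTo N) (λ j → trans (∑-square N (F j) (λ i k N≤i+k → F-vanishes j i k (ℕ.<-≤-trans W<N N≤i+k))) (∑-cong (upTo N) (diagonal j))) ⟩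
          ∑[ j ∈ upTo N ] ∑[ e ∈ upTo N ] ∑ (monomials j (e ℕ.+ 2 ℕ.* j)) V
            ≡⟨ ∑-all-monomials N L L V V-stable (λ μ N≤w → trans (cong (_* particle-ℰ μ) (T-vanishes μ (ℕ.<-≤-trans W<N N≤w))) (ℚ.*-zeroˡ (particle-ℰ μ)))
                 (ℕ.≤-trans (ℕ.m≤m+n N (2 ℕ.* N)) (ℕ.m≤m+n (3 ℕ.* N) (size f))) (ℕ.m≤m+n (3 ℕ.* N) (size f)) ⟩
          ∑ (lists L L) V
            ≡⟨ V-lists L L (ℕ.m≤n+m (size f) (3 ℕ.* N)) (ℕ.m≤n+m (size f) (3 ℕ.* N)) ⟩
          rowdiff (λ y → shifted (y + M) - shifted y) ½ ls + (∑[ s ∈ upTo m ] shifted (fromℕ s + ½)) ∎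
          where
          open ≡-Reasoning
          -- `3 ℕ.* N` leaves room for all weights e + 2 j, and `size f` for all variables and
          -- exponents of f in Taylor's formula.
          L : ℕ
          L = 3 ℕ.* N ℕ.+ size f

  -- Maya diagrams as words, read from the highest position downwards: true is a
  -- particle, false a hole, with only holes above and only particles below.

  Word : Set
  Word = List Bool

  zeros ones : Word → ℕ
  zeros []          = 0
  zeros (false ∷ w) = suc (zeros w)
  zeros (true ∷ w)  = zeros w
  ones []           = 0
  ones (false ∷ w)  = ones w
  ones (true ∷ w)   = suc (ones w)

  -- The part of a particle is the number of holes below it; particles below the last hole give
  -- trailing zero parts.
  decode : Word → List ℕ
  decode []          = []
  decode (false ∷ w) = decode w
  decode (true ∷ w)  = zeros w ∷ decode w

  bit : Word → ℕ → Bool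
  bit []      i       = false
  bit (b ∷ w) zero    = b
  bit (b ∷ w) (suc i) = bit w i

  psum : Series → Word → ℚ
  psum ψ []      = 0ℚ
  psum ψ (b ∷ w) = ⟦ b ⟧ * ψ 0 + psum (ψ ∘ suc) w

  length≡zeros+ones : ∀ w → length w ≡ zeros w ℕ.+ ones w
  length≡zeros+ones []          = refl
  length≡zeros+ones (false ∷ w) = cong suc (length≡zeros+ones w)
  length≡zeros+ones (true ∷ w)  = trans (cong suc (length≡zeros+ones w)) (sym (ℕ.+-suc (zeros w) (ones w)))

  psum-bit : ∀ ψ w → psum ψ w ≡ ∑[ i ∈ upTo (length w) ] ⟦ bit w i ⟧ * ψ i
  psum-bit ψ []      = refl
  psum-bit ψ (b ∷ w) = trans (cong (⟦ b ⟧ * ψ 0 +_) (psum-bit (ψ ∘ suc) w)) (sym (∑-upTo-suc (length w) (λ i → ⟦ bit (b ∷ w) i ⟧ * ψ i)))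

  psum-cong : ∀ {ψ χ} w → (∀ i → ψ i ≡ χ i) → psum ψ w ≡ psum χ w
  psum-cong []      h = refl
  psum-cong (b ∷ w) h = cong₂ _+_ (cong (⟦ b ⟧ *_) (h 0)) (psum-cong w (h ∘ suc))

  -- A particle at index k with i particles above it has k - i holes above it, so its part is λᵢ =
  -- zeros w - (k - i) and λᵢ - i - c = zeros w - c - k.
  psum-decode : ∀ θ c w → psum (λ i → θ (fromℕ (zeros w) - c - fromℕ i)) w ≡
    rowdiff θ c (decode w) + (∑[ i ∈ upTo (ones w) ] θ (- (c + fromℕ i)))
  psum-decode θ c []          = refl
  psum-decode θ c (false ∷ w) = begin
    0ℚ * θ (fromℕ (suc (zeros w)) - c - 0ℚ) + psum (λ i → θ (fromℕ (suc (zeros w)) - c - fromℕ (suc i))) w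
      ≡⟨ trans (cong (_+ psum (λ i → θ (fromℕ (suc (zeros w)) - c - fromℕ (suc i))) w) (ℚ.*-zeroˡ (θ (fromℕ (suc (zeros w)) - c - 0ℚ)))) (ℚ.+-identityˡ _) ⟩
    psum (λ i → θ (fromℕ (suc (zeros w)) - c - fromℕ (suc i))) w
      ≡⟨ psum-cong w (λ i → cong θ (trans (cong₂ (λ x y → x - c - y) (fromℕ-suc (zeros w)) (fromℕ-suc i)) (ring (fromℕ (zeros w)) c (fromℕ i)))) ⟩
    psum (λ i → θ (fromℕ (zeros w) - c - fromℕ i)) w
      ≡⟨ psum-decode θ c w ⟩
    rowdiff θ c (decode w) + (∑[ i ∈ upTo (ones w) ] θ (- (c + fromℕ i))) ∎
    where
    open ≡-Reasoning
    ring : ∀ z c i → 1ℚ + z - c - (1ℚ + i) ≡ z - c - i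
    ring = solve-∀ ℚ-ring
  psum-decode θ c (true ∷ w)  = begin
    1ℚ * θ (fromℕ (zeros w) - c - 0ℚ) + psum (λ i → θ (fromℕ (zeros w) - c - fromℕ (suc i))) w
      ≡⟨ cong₂ _+_ (trans (ℚ.*-identityˡ _) (cong θ (ℚ.+-identityʳ _)))
           (trans (psum-cong w (λ i → cong θ (trans (cong (λ x → fromℕ (zeros w) - c - x) (fromℕ-suc i)) (ring₁ (fromℕ (zeros w)) c (fromℕ i))))) (psum-decode θ (c + 1ℚ) w)) ⟩
    θ (fromℕ (zeros w) - c) + (rowdiff θ (c + 1ℚ) (decode w) + (∑[ i ∈ upTo (ones w) ] θ (- (c + 1ℚ + fromℕ i))))
      ≡⟨ ring₂ (θ (fromℕ (zeros w) - c)) (θ (- c)) (rowdiff θ (c + 1ℚ) (decode w)) (∑[ i ∈ upTo (ones w) ] θ (- (c + 1ℚ + fromℕ i))) ⟩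
    rowdiff θ c (zeros w ∷ decode w) + (θ (- c) + (∑[ i ∈ upTo (ones w) ] θ (- (c + 1ℚ + fromℕ i))))
      ≡⟨ cong (rowdiff θ c (zeros w ∷ decode w) +_) (cong₂ _+_ (cong (λ x → θ (- x)) (sym (ℚ.+-identityʳ c)))
           (∑-cong (upTo (ones w)) (λ i → cong (λ x → θ (- x)) (trans (ℚ.+-assoc c 1ℚ (fromℕ i)) (cong (c +_) (sym (fromℕ-suc i))))))) ⟩
    rowdiff θ c (zeros w ∷ decode w) + (θ (- (c + 0ℚ)) + (∑[ i ∈ upTo (ones w) ] θ (- (c + fromℕ (suc i)))))
      ≡⟨ cong (rowdiff θ c (zeros w ∷ decode w) +_) (∑-upTo-suc (ones w) (λ i → θ (- (c + fromℕ i)))) ⟨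
    rowdiff θ c (zeros w ∷ decode w) + (∑[ i ∈ upTo (suc (ones w)) ] θ (- (c + fromℕ i))) ∎
    where
    open ≡-Reasoning
    ring₁ : ∀ z c i → z - c - (1ℚ + i) ≡ z - (c + 1ℚ) - i
    ring₁ = solve-∀ ℚ-ring
    ring₂ : ∀ a b x y → a + (x + y) ≡ ((a - b) + x) + (b + y)
    ring₂ = solve-∀ ℚ-ring

  sum-rowdiff : ∀ c ls → fromℕ (sum ls) ≡ rowdiff id c ls
  sum-rowdiff c []       = refl
  sum-rowdiff c (l ∷ ls) = trans (fromℕ-+ l (sum ls)) (cong₂ _+_ (ring (fromℕ l) c) (sum-rowdiff (c + 1ℚ) ls))
    where
    ring : ∀ l c → l ≡ (l - c) - (- c)
    ring = solve-∀ ℚ-ring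

  -- At most i holes lie above the particle, so its part is at least zeros w - i. Small partitions
  -- thus leave the top of the word empty.
  particle-bound : ∀ w i → bit w i ≡ true → zeros w ≤ i ℕ.+ sum (decode w)
  particle-bound (true ∷ w)  zero    eq = ℕ.m≤m+n (zeros w) _
  particle-bound (false ∷ w) (suc i) eq = s≤s (particle-bound w i eq)
  particle-bound (true ∷ w)  (suc i) eq = ℕ.≤-trans (ℕ.m≤m+n (zeros w) _) (ℕ.m≤n+m _ (suc i))

  hole⇒zeros : ∀ w i → i < length w → bit w i ≡ false → 1 ≤ zeros w
  hole⇒zeros (false ∷ w) i       i<l       eq = s≤s z≤n
  hole⇒zeros (true ∷ w)  (suc i) (s≤s i<l) eq = hole⇒zeros w i i<l eq

  -- Particles above the hole have positive parts, hence are at most |λ| many; the others lie among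
  -- the places below it. Small partitions thus leave the bottom of the word filled.
  hole-bound : ∀ w i → i < length w → bit w i ≡ false → ones w ≤ length w ∸ suc i ℕ.+ sum (decode w)
  hole-bound (false ∷ w) zero    i<l       eq = ℕ.≤-trans (ℕ.≤-trans (ℕ.m≤n+m (ones w) (zeros w)) (ℕ.≤-reflexive (sym (length≡zeros+ones w)))) (ℕ.m≤m+n (length w) _)
  hole-bound (false ∷ w) (suc i) (s≤s i<l) eq = hole-bound w i i<l eq
  hole-bound (true ∷ w)  (suc i) (s≤s i<l) eq = ℕ.≤-trans (s≤s (hole-bound w i i<l eq))
    (ℕ.≤-trans (ℕ.≤-reflexive (sym (ℕ.+-suc (length w ∸ suc i) _))) (ℕ.+-monoʳ-≤ (length w ∸ suc i) (ℕ.+-monoˡ-≤ _ (hole⇒zeros w i i<l eq))))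

  -- Moving a particle

  flip : ℕ → Word → Word
  flip i       []      = []
  flip zero    (b ∷ w) = not b ∷ w
  flip (suc i) (b ∷ w) = b ∷ flip i w

  length-flip : ∀ i w → length (flip i w) ≡ length w
  length-flip i       []      = refl
  length-flip zero    (b ∷ w) = refl
  length-flip (suc i) (b ∷ w) = cong suc (length-flip i w)

  bit-flip : ∀ i w → i < length w → bit (flip i w) i ≡ not (bit w i)
  bit-flip zero    (b ∷ w) _         = refl
  bit-flip (suc i) (b ∷ w) (s≤s i<l) = bit-flip i w i<l

  bit-flip-other : ∀ i j w → i ≢ j → bit (flip i w) j ≡ bit w j
  bit-flip-other i       j       []      i≢j = refl
  bit-flip-other zero    zero    (b ∷ w) i≢j = contradiction refl i≢j
  bit-flip-other zero    (suc j) (b ∷ w) i≢j = refl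
  bit-flip-other (suc i) zero    (b ∷ w) i≢j = refl
  bit-flip-other (suc i) (suc j) (b ∷ w) i≢j = bit-flip-other i j w (i≢j ∘ cong suc)

  psum-flip : ∀ ψ i w → i < length w → psum ψ (flip i w) ≡ psum ψ w + (⟦ not (bit w i) ⟧ - ⟦ bit w i ⟧) * ψ i
  psum-flip ψ zero    (b ∷ w) _         = ring ⟦ not b ⟧ ⟦ b ⟧ (ψ 0) (psum (ψ ∘ suc) w)
    where
    ring : ∀ a b x y → a * x + y ≡ b * x + y + (a - b) * x
    ring = solve-∀ ℚ-ring
  psum-flip ψ (suc i) (b ∷ w) (s≤s i<l) = trans (cong (⟦ b ⟧ * ψ 0 +_) (psum-flip (ψ ∘ suc) i w i<l)) (sym (ℚ.+-assoc (⟦ b ⟧ * ψ 0) _ _))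

  words : ℕ → List Word
  words zero    = [] ∷ []
  words (suc K) = map (false ∷_) (words K) ++ map (true ∷_) (words K)

  ∑-words-suc : ∀ K (F : Word → ℚ) → ∑ (words (suc K)) F ≡ ∑ (words K) (F ∘ (false ∷_)) + ∑ (words K) (F ∘ (true ∷_))
  ∑-words-suc K F = trans (∑-++ F (map (false ∷_) (words K)) _) (cong₂ _+_ (∑-map F (false ∷_) (words K)) (∑-map F (true ∷_) (words K)))

  ∑-words-flip : ∀ K i (F : Word → ℚ) → ∑ (words K) (F ∘ flip i) ≡ ∑ (words K) F
  ∑-words-flip zero    i       F = refl
  ∑-words-flip (suc K) zero    F = trans (∑-words-suc K (F ∘ flip zero)) (trans (ℚ.+-comm (∑ (words K) (F ∘ (true ∷_))) _) (sym (∑-words-suc K F)))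
  ∑-words-flip (suc K) (suc i) F = trans (∑-words-suc K (F ∘ flip (suc i)))
    (trans (cong₂ _+_ (∑-words-flip K i (F ∘ (false ∷_))) (∑-words-flip K i (F ∘ (true ∷_)))) (sym (∑-words-suc K F)))

  words-length : ∀ K {w} → w ∈ words K → length w ≡ K
  words-length zero    (here refl) = refl
  words-length (suc K) w∈ with ∈-++⁻ (map (false ∷_) (words K)) w∈
  ... | inj₁ w∈ˡ with ∈-map⁻ (false ∷_) w∈ˡ
  ...   | v , v∈ , refl = cong suc (words-length K v∈)
  words-length (suc K) w∈ | inj₂ w∈ʳ with ∈-map⁻ (true ∷_) w∈ʳ
  ...   | v , v∈ , refl = cong suc (words-length K v∈)

  -- Two flips instead of an exchange of letters: defined on all words, and a bijection because each
  -- flip is one.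
  move : ℕ → ℕ → Word → Word
  move m i w = flip i (flip (i ℕ.+ m) w)

  module _ (m i : ℕ) (w : Word) (1≤m : 1 ≤ m) (i+m<l : i ℕ.+ m < length w) where

    private
      i≢i+m : i ≢ i ℕ.+ m
      i≢i+m = ℕ.<⇒≢ (ℕ.≤-trans (ℕ.≤-reflexive (ℕ.+-comm 1 i)) (ℕ.+-monoʳ-≤ i 1≤m))

      i<l : i < length (flip (i ℕ.+ m) w)
      i<l = ℕ.≤-<-trans (ℕ.m≤m+n i m) (ℕ.<-≤-trans i+m<l (ℕ.≤-reflexive (sym (length-flip (i ℕ.+ m) w))))

    bit-move-to : bit (move m i w) i ≡ not (bit w i)
    bit-move-to = trans (bit-flip i (flip (i ℕ.+ m) w) i<l) (cong not (bit-flip-other (i ℕ.+ m) i w (i≢i+m ∘ sym)))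

    bit-move-from : bit (move m i w) (i ℕ.+ m) ≡ not (bit w (i ℕ.+ m))
    bit-move-from = trans (bit-flip-other i (i ℕ.+ m) (flip (i ℕ.+ m) w) i≢i+m) (bit-flip (i ℕ.+ m) w i+m<l)

    psum-move : ∀ ψ → bit w i ≡ false → bit w (i ℕ.+ m) ≡ true → psum ψ (move m i w) ≡ psum ψ w + (ψ i - ψ (i ℕ.+ m))
    psum-move ψ hole particle = begin
      psum ψ (move m i w)
        ≡⟨ psum-flip ψ i (flip (i ℕ.+ m) w) i<l ⟩
      psum ψ (flip (i ℕ.+ m) w) + (⟦ not (bit (flip (i ℕ.+ m) w) i) ⟧ - ⟦ bit (flip (i ℕ.+ m) w) i ⟧) * ψ i
        ≡⟨ cong₂ (λ x b → x + (⟦ not b ⟧ - ⟦ b ⟧) * ψ i) (psum-flip ψ (i ℕ.+ m) w i+m<l) (trans (bit-flip-other (i ℕ.+ m) i w (i≢i+m ∘ sym)) hole) ⟩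
      psum ψ w + (⟦ not (bit w (i ℕ.+ m)) ⟧ - ⟦ bit w (i ℕ.+ m) ⟧) * ψ (i ℕ.+ m) + (1ℚ - 0ℚ) * ψ i
        ≡⟨ cong (λ b → psum ψ w + (⟦ not b ⟧ - ⟦ b ⟧) * ψ (i ℕ.+ m) + (1ℚ - 0ℚ) * ψ i) particle ⟩
      psum ψ w + (0ℚ - 1ℚ) * ψ (i ℕ.+ m) + (1ℚ - 0ℚ) * ψ i
        ≡⟨ ring (psum ψ w) (ψ (i ℕ.+ m)) (ψ i) ⟩
      psum ψ w + (ψ i - ψ (i ℕ.+ m)) ∎
      where
      open ≡-Reasoning
      ring : ∀ p x y → p + (0ℚ - 1ℚ) * x + (1ℚ - 0ℚ) * y ≡ p + (y - x)
      ring = solve-∀ ℚ-ring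

    length-move : length (move m i w) ≡ length w
    length-move = trans (length-flip i (flip (i ℕ.+ m) w)) (length-flip (i ℕ.+ m) w)

  ones-psum : ∀ w → fromℕ (ones w) ≡ psum (λ _ → 1ℚ) w
  ones-psum []          = refl
  ones-psum (false ∷ w) = trans (ones-psum w) (sym (trans (cong (_+ psum (λ _ → 1ℚ) w) (ℚ.*-zeroˡ 1ℚ)) (ℚ.+-identityˡ _)))
  ones-psum (true ∷ w)  = trans (fromℕ-suc (ones w)) (cong (1ℚ +_) (ones-psum w))

  -- Both flips permute `words K`, and together they carry the condition hole above particle to
  -- particle above hole.
  ∑-words-move : ∀ K m i (G : Word → ℚ) → 1 ≤ m → i ℕ.+ m < K →
    ∑[ w ∈ words K ] ⟦ not (bit w i) ∧ bit w (i ℕ.+ m) ⟧ * G (move m i w) ≡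
    ∑[ w ∈ words K ] ⟦ bit w i ∧ not (bit w (i ℕ.+ m)) ⟧ * G w
  ∑-words-move K m i G 1≤m i+m<K = begin
    ∑[ w ∈ words K ] ⟦ not (bit w i) ∧ bit w (i ℕ.+ m) ⟧ * G (move m i w)
      ≡⟨ ∑-cong∈ (words K) (λ {w} w∈ → cong (λ b → ⟦ b ⟧ * G (move m i w)) (cong₂ _∧_
           (sym (bit-move-to m i w 1≤m (bound w∈)))
           (sym (trans (cong not (bit-move-from m i w 1≤m (bound w∈))) (not-involutive (bit w (i ℕ.+ m))))))) ⟩
    ∑ (words K) (F ∘ flip i ∘ flip (i ℕ.+ m))
      ≡⟨ ∑-words-flip K (i ℕ.+ m) (F ∘ flip i) ⟩
    ∑ (words K) (F ∘ flip i)
      ≡⟨ ∑-words-flip K i F ⟩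
    ∑ (words K) F ∎
    where
    open ≡-Reasoning
    F : Word → ℚ
    F w = ⟦ bit w i ∧ not (bit w (i ℕ.+ m)) ⟧ * G w
    bound : ∀ {w} → w ∈ words K → i ℕ.+ m < length w
    bound w∈ = ℕ.<-≤-trans i+m<K (ℕ.≤-reflexive (sym (words-length K w∈)))

  pos : ℕ → ℕ → ℚ
  pos Z i = fromℕ Z - ½ - fromℕ i

  pos-+ : ∀ Z i m → pos Z (i ℕ.+ m) ≡ pos Z i - fromℕ m
  pos-+ Z i m = trans (cong (λ x → fromℕ Z - ½ - x) (fromℕ-+ i m)) (ring (fromℕ Z) (fromℕ i) (fromℕ m))
    where
    ring : ∀ z i m → z - ½ - (i + m) ≡ z - ½ - i - m
    ring = solve-∀ ℚ-ring

  vacuum : (ℚ → ℚ) → ℕ → ℚ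
  vacuum θ n = ∑[ i ∈ upTo n ] θ (- (½ + fromℕ i))

  psum-pos : ∀ θ w → psum (θ ∘ pos (zeros w)) w ≡ rowdiff θ ½ (decode w) + vacuum θ (ones w)
  psum-pos θ w = psum-decode θ ½ w

  module _ (m i : ℕ) (w : Word) (1≤m : 1 ≤ m) (i+m<l : i ℕ.+ m < length w)
           (hole : bit w i ≡ false) (particle : bit w (i ℕ.+ m) ≡ true) where

    private
      w′ : Word
      w′ = move m i w

    ones-move : ones w′ ≡ ones w
    ones-move = fromℕ-injective (begin
      fromℕ (ones w′)                       ≡⟨ ones-psum w′ ⟩
      psum (λ _ → 1ℚ) w′                    ≡⟨ psum-move m i w 1≤m i+m<l (λ _ → 1ℚ) hole particle ⟩
      psum (λ _ → 1ℚ) w + (1ℚ - 1ℚ)         ≡⟨ ℚ.+-identityʳ _ ⟩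
      psum (λ _ → 1ℚ) w                     ≡⟨ ones-psum w ⟨
      fromℕ (ones w)                        ∎)
      where open ≡-Reasoning

    zeros-move : zeros w′ ≡ zeros w
    zeros-move = ℕ.+-cancelʳ-≡ (ones w) (zeros w′) (zeros w) (begin
      zeros w′ ℕ.+ ones w     ≡⟨ cong (zeros w′ ℕ.+_) ones-move ⟨
      zeros w′ ℕ.+ ones w′    ≡⟨ length≡zeros+ones w′ ⟨
      length w′               ≡⟨ length-move m i w 1≤m i+m<l ⟩
      length w                ≡⟨ length≡zeros+ones w ⟩
      zeros w ℕ.+ ones w      ∎)
      where open ≡-Reasoning

    -- In `psum-pos` the vacuum term depends only on the number of particles, which the move
    -- preserves; so `rowdiff` changes exactly as the sum over particles does.
    rowdiff-move : ∀ θ → let x = pos (zeros w) i in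
      rowdiff θ ½ (decode w′) ≡ rowdiff θ ½ (decode w) + (θ x - θ (x - fromℕ m))
    rowdiff-move θ = begin
      R w′                                                   ≡⟨ ring₁ (R w′) (vacuum θ (ones w)) ⟩
      R w′ + vacuum θ (ones w) - vacuum θ (ones w)           ≡⟨ cong (λ n → R w′ + vacuum θ n - vacuum θ (ones w)) ones-move ⟨
      R w′ + vacuum θ (ones w′) - vacuum θ (ones w)          ≡⟨ cong (_- vacuum θ (ones w)) (psum-pos θ w′) ⟨
      psum (θ ∘ pos (zeros w′)) w′ - vacuum θ (ones w)       ≡⟨ cong (λ z → psum (θ ∘ pos z) w′ - vacuum θ (ones w)) zeros-move ⟩
      psum (θ ∘ pos Z) w′ - vacuum θ (ones w)                ≡⟨ cong (_- vacuum θ (ones w)) (psum-move m i w 1≤m i+m<l (θ ∘ pos Z) hole particle) ⟩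
      psum (θ ∘ pos Z) w + (θ (pos Z i) - θ (pos Z (i ℕ.+ m))) - vacuum θ (ones w)
        ≡⟨ cong₂ (λ p y → p + (θ (pos Z i) - θ y) - vacuum θ (ones w)) (psum-pos θ w) (pos-+ Z i m) ⟩
      R w + vacuum θ (ones w) + (θ (pos Z i) - θ (pos Z i - fromℕ m)) - vacuum θ (ones w)
        ≡⟨ ring₂ (R w) (vacuum θ (ones w)) (θ (pos Z i) - θ (pos Z i - fromℕ m)) ⟩
      R w + (θ (pos Z i) - θ (pos Z i - fromℕ m)) ∎
      where
      open ≡-Reasoning
      Z : ℕ
      Z = zeros w
      R : Word → ℚ
      R v = rowdiff θ ½ (decode v)
      ring₁ : ∀ x y → x ≡ x + y - y
      ring₁ = solve-∀ ℚ-ring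
      ring₂ : ∀ x y z → x + y + z - y ≡ x + z
      ring₂ = solve-∀ ℚ-ring

    -- The case θ = id of `rowdiff-move`: the size is the first power sum.
    sum-move : sum (decode w′) ≡ sum (decode w) ℕ.+ m
    sum-move = fromℕ-injective (begin
      fromℕ (sum (decode w′))                                ≡⟨ sum-rowdiff ½ (decode w′) ⟩
      rowdiff id ½ (decode w′)                               ≡⟨ rowdiff-move id ⟩
      rowdiff id ½ (decode w) + (x - (x - fromℕ m))          ≡⟨ ring (rowdiff id ½ (decode w)) x (fromℕ m) ⟩
      rowdiff id ½ (decode w) + fromℕ m                      ≡⟨ cong (_+ fromℕ m) (sum-rowdiff ½ (decode w)) ⟨
      fromℕ (sum (decode w)) + fromℕ m                       ≡⟨ fromℕ-+ (sum (decode w)) m ⟨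
      fromℕ (sum (decode w) ℕ.+ m)                           ∎)
      where
      open ≡-Reasoning
      x : ℚ
      x = pos (zeros w) i
      ring : ∀ r x m → r + (x - (x - m)) ≡ r + m
      ring = solve-∀ ℚ-ring

  -- The sum over the particles of h(x + m) - h(x), regularised, is a finite sum
  -- over the x at which exactly one of x and x - m is occupied.
  module _ (h : ℚ → ℚ) (m O′ : ℕ) (w : Word)
           (top : ∀ {i} → i < m → bit w i ≡ false)
           (bottom : ∀ {i} → i < m → bit w (zeros w ℕ.+ O′ ℕ.+ i) ≡ true)
           (ones≡ : ones w ≡ m ℕ.+ O′) where

    private
      Z J : ℕ
      Z = zeros w
      J = Z ℕ.+ O′
      M : ℚ
      M = fromℕ m
      φ : ℕ → ℚ
      φ i = h (pos Z i)
      θ : ℚ → ℚ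
      θ y = h (y + M) - h y
      b : ℕ → ℚ
      b i = ⟦ bit w i ⟧

      length≡ : length w ≡ m ℕ.+ J
      length≡ = trans (length≡zeros+ones w) (trans (cong (Z ℕ.+_) ones≡) (ring Z m O′))
        where
        ring : ∀ z m o → z ℕ.+ (m ℕ.+ o) ≡ m ℕ.+ (z ℕ.+ o)
        ring = ℕ-solve-∀

      -- The m highest places are empty, so shifting the index by m discards nothing.
      raised : ∑[ i ∈ upTo (length w) ] b i * h (pos Z i + M) ≡ ∑[ i ∈ upTo J ] b (i ℕ.+ m) * φ i
      raised = begin
        ∑[ i ∈ upTo (length w) ] b i * h (pos Z i + M)
          ≡⟨ cong (λ n → ∑[ i ∈ upTo n ] b i * h (pos Z i + M)) length≡ ⟩
        ∑[ i ∈ upTo (m ℕ.+ J) ] b i * h (pos Z i + M)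
          ≡⟨ ∑-upTo-+ m J (λ i → b i * h (pos Z i + M)) ⟩
        (∑[ i ∈ upTo m ] b i * h (pos Z i + M)) + (∑[ i ∈ upTo J ] b (m ℕ.+ i) * h (pos Z (m ℕ.+ i) + M))
          ≡⟨ cong₂ _+_ (∑-upTo-0 m (λ {i} i<m → trans (cong (λ c → ⟦ c ⟧ * h (pos Z i + M)) (top i<m)) (ℚ.*-zeroˡ (h (pos Z i + M)))))
               (∑-cong (upTo J) (λ i → cong₂ (λ k x → b k * h x) (ℕ.+-comm m i)
                 (trans (cong (λ k → pos Z k + M) (ℕ.+-comm m i)) (trans (cong (_+ M) (pos-+ Z i m)) (ring (pos Z i) M))))) ⟩
        0ℚ + (∑[ i ∈ upTo J ] b (i ℕ.+ m) * φ i)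
          ≡⟨ ℚ.+-identityˡ _ ⟩
        ∑[ i ∈ upTo J ] b (i ℕ.+ m) * φ i ∎
        where
        open ≡-Reasoning
        ring : ∀ x m → x - m + m ≡ x
        ring = solve-∀ ℚ-ring

      H : ℕ → ℚ
      H i = h (- (½ + fromℕ i))

      tail : ℚ
      tail = ∑[ i ∈ upTo m ] H (O′ ℕ.+ i)

      -- The m lowest places are filled and are split off as `tail`: places m further down lie
      -- outside the word.
      unraised : ∑[ i ∈ upTo (length w) ] b i * φ i ≡ (∑[ i ∈ upTo J ] b i * φ i) + tail
      unraised = begin
        ∑[ i ∈ upTo (length w) ] b i * φ i
          ≡⟨ cong (λ n → ∑[ i ∈ upTo n ] b i * φ i) (trans length≡ (ℕ.+-comm m J)) ⟩
        ∑[ i ∈ upTo (J ℕ.+ m) ] b i * φ i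
          ≡⟨ ∑-upTo-+ J m (λ i → b i * φ i) ⟩
        (∑[ i ∈ upTo J ] b i * φ i) + (∑[ i ∈ upTo m ] b (J ℕ.+ i) * φ (J ℕ.+ i))
          ≡⟨ cong ((∑[ i ∈ upTo J ] b i * φ i) +_) (∑-upTo-cong m (λ {i} i<m → trans
               (cong (λ c → ⟦ c ⟧ * φ (J ℕ.+ i)) (bottom i<m)) (trans (ℚ.*-identityˡ (φ (J ℕ.+ i))) (cong h (deep i))))) ⟩
        (∑[ i ∈ upTo J ] b i * φ i) + tail ∎
        where
        open ≡-Reasoning
        ring : ∀ z k → z - ½ - (z + k) ≡ - (½ + k)
        ring = solve-∀ ℚ-ring
        deep : ∀ i → pos Z (J ℕ.+ i) ≡ - (½ + fromℕ (O′ ℕ.+ i))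
        deep i = trans (cong (λ x → fromℕ Z - ½ - x) (trans (cong fromℕ (ℕ.+-assoc Z O′ i)) (fromℕ-+ Z (O′ ℕ.+ i)))) (ring (fromℕ Z) (fromℕ (O′ ℕ.+ i)))

      -- In the vacuum the shift by m telescopes: h survives at ½, ..., m - ½ above the sea, and
      -- what it loses at the bottom is `tail`.
      sea : vacuum θ (ones w) + tail ≡ ∑[ s ∈ upTo m ] h (fromℕ s + ½)
      sea = begin
        vacuum θ (ones w) + tail
          ≡⟨ cong (_+ tail) (∑-- (λ i → h (- (½ + fromℕ i) + M)) H (upTo (ones w))) ⟩
        (∑[ i ∈ upTo (ones w) ] h (- (½ + fromℕ i) + M)) - ∑ (upTo (ones w)) H + tail
          ≡⟨ cong₂ (λ x y → x - y + tail)
               (trans (cong (λ n → ∑[ i ∈ upTo n ] h (- (½ + fromℕ i) + M)) ones≡)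
                 (trans (∑-upTo-+ m O′ (λ i → h (- (½ + fromℕ i) + M)))
                   (cong ((∑[ i ∈ upTo m ] h (- (½ + fromℕ i) + M)) +_) (∑-cong (upTo O′) (λ i → cong h (trans (cong (λ x → - (½ + x) + M) (fromℕ-+ m i)) (ring₁ M (fromℕ i))))))))
               (trans (cong (λ n → ∑ (upTo n) H) (trans ones≡ (ℕ.+-comm m O′))) (∑-upTo-+ O′ m H)) ⟩
        (∑[ i ∈ upTo m ] h (- (½ + fromℕ i) + M)) + ∑ (upTo O′) H - (∑ (upTo O′) H + tail) + tail
          ≡⟨ ring₂ (∑[ i ∈ upTo m ] h (- (½ + fromℕ i) + M)) (∑ (upTo O′) H) tail ⟩
        ∑[ i ∈ upTo m ] h (- (½ + fromℕ i) + M)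
          ≡⟨ ∑-upTo-reverse m (λ i → h (- (½ + fromℕ i) + M)) ⟩
        ∑[ i ∈ upTo m ] h (- (½ + fromℕ (m ∸ suc i)) + M)
          ≡⟨ ∑-upTo-cong m (λ {i} i<m → cong h (trans (cong (λ x → - (½ + x) + M) (trans (fromℕ-∸ i<m) (cong (λ x → M - x) (fromℕ-suc i)))) (ring₃ M (fromℕ i)))) ⟩
        ∑[ s ∈ upTo m ] h (fromℕ s + ½) ∎
        where
        open ≡-Reasoning
        ring₁ : ∀ m i → - (½ + (m + i)) + m ≡ - (½ + i)
        ring₁ = solve-∀ ℚ-ring
        ring₂ : ∀ x y t → x + y - (y + t) + t ≡ x
        ring₂ = solve-∀ ℚ-ring
        ring₃ : ∀ m i → - (½ + (m - (1ℚ + i))) + m ≡ i + ½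
        ring₃ = solve-∀ ℚ-ring

    particle-exchange : rowdiff θ ½ (decode w) + (∑[ s ∈ upTo m ] h (fromℕ s + ½)) ≡
      (∑[ i ∈ upTo J ] ⟦ not (bit w i) ∧ bit w (i ℕ.+ m) ⟧ * φ i) - (∑[ i ∈ upTo J ] ⟦ bit w i ∧ not (bit w (i ℕ.+ m)) ⟧ * φ i)
    particle-exchange = begin
      R + (∑[ s ∈ upTo m ] h (fromℕ s + ½))                  ≡⟨ cong (R +_) sea ⟨
      R + (vacuum θ (ones w) + tail)                         ≡⟨ ℚ.+-assoc R (vacuum θ (ones w)) tail ⟨
      R + vacuum θ (ones w) + tail                           ≡⟨ cong (_+ tail) (psum-pos θ w) ⟨
      psum (θ ∘ pos Z) w + tail
        ≡⟨ cong (_+ tail) (trans (psum-bit (θ ∘ pos Z) w) (trans (∑-cong (upTo (length w)) (λ i → ring₁ (b i) (h (pos Z i + M)) (φ i)))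
             (∑-- (λ i → b i * h (pos Z i + M)) (λ i → b i * φ i) (upTo (length w))))) ⟩
      (∑[ i ∈ upTo (length w) ] b i * h (pos Z i + M)) - (∑[ i ∈ upTo (length w) ] b i * φ i) + tail
        ≡⟨ cong₂ (λ x y → x - y + tail) raised unraised ⟩
      (∑[ i ∈ upTo J ] b (i ℕ.+ m) * φ i) - ((∑[ i ∈ upTo J ] b i * φ i) + tail) + tail
        ≡⟨ ring₂ (∑[ i ∈ upTo J ] b (i ℕ.+ m) * φ i) (∑[ i ∈ upTo J ] b i * φ i) tail ⟩
      (∑[ i ∈ upTo J ] b (i ℕ.+ m) * φ i) - (∑[ i ∈ upTo J ] b i * φ i)
        ≡⟨ ∑-- (λ i → b (i ℕ.+ m) * φ i) (λ i → b i * φ i) (upTo J) ⟨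
      ∑[ i ∈ upTo J ] (b (i ℕ.+ m) * φ i - b i * φ i)
        -- Where x and x - m are both occupied or both empty, the two contributions cancel.
        ≡⟨ ∑-cong (upTo J) (λ i → exclusive (bit w i) (bit w (i ℕ.+ m)) (φ i)) ⟩
      ∑[ i ∈ upTo J ] (⟦ not (bit w i) ∧ bit w (i ℕ.+ m) ⟧ * φ i - ⟦ bit w i ∧ not (bit w (i ℕ.+ m)) ⟧ * φ i)
        ≡⟨ ∑-- (λ i → ⟦ not (bit w i) ∧ bit w (i ℕ.+ m) ⟧ * φ i) (λ i → ⟦ bit w i ∧ not (bit w (i ℕ.+ m)) ⟧ * φ i) (upTo J) ⟩
      (∑[ i ∈ upTo J ] ⟦ not (bit w i) ∧ bit w (i ℕ.+ m) ⟧ * φ i) - (∑[ i ∈ upTo J ] ⟦ bit w i ∧ not (bit w (i ℕ.+ m)) ⟧ * φ i) ∎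
      where
      open ≡-Reasoning
      R : ℚ
      R = rowdiff θ ½ (decode w)
      ring₁ : ∀ b x y → b * (x - y) ≡ b * x - b * y
      ring₁ = solve-∀ ℚ-ring
      ring₂ : ∀ x y t → x - (y + t) + t ≡ x - y
      ring₂ = solve-∀ ℚ-ring
      exclusive : ∀ b c x → ⟦ c ⟧ * x - ⟦ b ⟧ * x ≡ ⟦ not b ∧ c ⟧ * x - ⟦ b ∧ not c ⟧ * x
      exclusive true  true  x = trans (ℚ.+-inverseʳ (1ℚ * x)) (sym (ℚ.+-inverseʳ (0ℚ * x)))
      exclusive true  false x = refl
      exclusive false true  x = refl
      exclusive false false x = refl

  -- For r = 1, x - m occupied and x empty, this is the value of f after the particle at x - m has moved to x.
  jumped : 𝓡 → ℕ → ℚ → List ℕ → ℚ → ℚ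
  jumped f m r ls x = polyAt (λ i → Qᵖ ls (suc i) + 1/ i ! * (r * (x ^ i - (x - fromℕ m) ^ i))) f

  -- Raising, lowering and the telescoping sum

  config? : ∀ O s w → Dec (ones w ≡ O × sum (decode w) ≡ s)
  config? O s w = (ones w ℕ.≟ O) ×-dec (sum (decode w) ℕ.≟ s)

  ∑-config : ∀ {O s w x y} → (ones w ≡ O → sum (decode w) ≡ s → x ≡ y) →
    ⟦ does (config? O s w) ⟧ * x ≡ ⟦ does (config? O s w) ⟧ * y
  ∑-config {O} {s} {w} {x} {y} h = lemma (config? O s w)
    where
    lemma : (d : Dec (ones w ≡ O × sum (decode w) ≡ s)) → ⟦ does d ⟧ * x ≡ ⟦ does d ⟧ * y
    lemma (yes (p , q)) = cong (1ℚ *_) (h p q)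
    lemma (no _)        = trans (ℚ.*-zeroˡ x) (sym (ℚ.*-zeroˡ y))

  zeros≡ : ∀ {Z O w} → w ∈ words (Z ℕ.+ O) → ones w ≡ O → zeros w ≡ Z
  zeros≡ {Z} {O} {w} w∈ o = ℕ.+-cancelʳ-≡ O (zeros w) Z
    (trans (cong (zeros w ℕ.+_) (sym o)) (trans (sym (length≡zeros+ones w)) (words-length (Z ℕ.+ O) w∈)))

  top-holes : ∀ {m} w → sum (decode w) ℕ.+ m ≤ zeros w → ∀ {i} → i < m → bit w i ≡ false
  top-holes {m} w s+m≤Z {i} i<m with bit w i in eq
  ... | false = refl
  ... | true  = contradiction (particle-bound w i eq)
    (ℕ.<⇒≱ (ℕ.<-≤-trans (ℕ.+-monoˡ-< (sum (decode w)) i<m) (ℕ.≤-trans (ℕ.≤-reflexive (ℕ.+-comm m _)) s+m≤Z)))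

  bottom-particles : ∀ {m O′} w → ones w ≡ m ℕ.+ O′ → sum (decode w) ℕ.+ m ≤ ones w →
    ∀ {i} → i < m → bit w (zeros w ℕ.+ O′ ℕ.+ i) ≡ true
  bottom-particles {m} {O′} w o s+m≤O {i} i<m with bit w (zeros w ℕ.+ O′ ℕ.+ i) in eq
  ... | true  = refl
  ... | false = contradiction (hole-bound w (zeros w ℕ.+ O′ ℕ.+ i) (ℕ.<-≤-trans (ℕ.+-monoʳ-< J i<m) (ℕ.≤-reflexive (sym length≡))) eq)
    (ℕ.<⇒≱ (ℕ.<-≤-trans (ℕ.+-monoˡ-< (sum (decode w)) below) (ℕ.≤-trans (ℕ.≤-reflexive (ℕ.+-comm m _)) s+m≤O)))
    where
    J : ℕ
    J = zeros w ℕ.+ O′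
    length≡ : length w ≡ J ℕ.+ m
    length≡ = trans (length≡zeros+ones w) (trans (cong (zeros w ℕ.+_) (trans o (ℕ.+-comm m O′))) (sym (ℕ.+-assoc (zeros w) O′ m)))
    below : length w ∸ suc (J ℕ.+ i) < m
    below = ℕ.≤-<-trans (ℕ.≤-reflexive (trans (cong₂ _∸_ length≡ (sym (ℕ.+-suc J i))) (ℕ.[m+n]∸[m+o]≡n∸o J m (suc i)))) (ℕ.∸-monoʳ-< (s≤s z≤n) i<m)

  module _ (f : 𝓡) (Z O m O′ : ℕ) (1≤m : 1 ≤ m) (m+O′≡O : m ℕ.+ O′ ≡ O) where

    private
      J : ℕ
      J = Z ℕ.+ O′

      W : List Word
      W = words (Z ℕ.+ O)

      𝟙 : ℕ → Word → ℚ
      𝟙 s w = ⟦ does (config? O s w) ⟧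

      up down : Word → ℕ → ℚ
      up   w i = ⟦ not (bit w i) ∧ bit w (i ℕ.+ m) ⟧
      down w i = ⟦ bit w i ∧ not (bit w (i ℕ.+ m)) ⟧

      g : ℚ → Word → ℕ → ℚ
      g r w i = jumped f m r (decode w) (pos Z i)

      index-bound : ∀ {i} → i < J → i ℕ.+ m < Z ℕ.+ O
      index-bound {i} i<J = ℕ.<-≤-trans (ℕ.+-monoˡ-< m i<J) (ℕ.≤-reflexive
        (trans (ℕ.+-assoc Z O′ m) (cong (Z ℕ.+_) (trans (ℕ.+-comm O′ m) m+O′≡O))))

      index-bound-length : ∀ {i w} → i < J → w ∈ W → i ℕ.+ m < length w
      index-bound-length i<J w∈ = ℕ.<-≤-trans (index-bound i<J) (ℕ.≤-reflexive (sym (words-length (Z ℕ.+ O) w∈)))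

    -- The sums of A_r and of B_r over the words that stand for partitions of s.
    raisable lowerable : ℚ → ℕ → ℚ
    raisable  r s = ∑[ w ∈ W ] 𝟙 s w * (∑[ i ∈ upTo J ] up w i * g r w i)
    lowerable r s = ∑[ w ∈ W ] 𝟙 s w * (∑[ i ∈ upTo J ] down w i * g r w i)

    private
      exchange-sums : ∀ s (u h : Word → ℕ → ℚ) →
        ∑[ w ∈ W ] 𝟙 s w * (∑[ i ∈ upTo J ] u w i * h w i) ≡ ∑[ i ∈ upTo J ] ∑[ w ∈ W ] u w i * (𝟙 s w * h w i)
      exchange-sums s u h = trans
        (∑-cong W (λ w → trans (sym (∑-*ˡ (𝟙 s w) (λ i → u w i * h w i) (upTo J))) (∑-cong (upTo J) (λ i → ring (𝟙 s w) (u w i) (h w i)))))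
        (∑-swap (λ w i → u w i * (𝟙 s w * h w i)) W (upTo J))
        where
        ring : ∀ x y z → x * (y * z) ≡ y * (x * z)
        ring = solve-∀ ℚ-ring

      up-cong : ∀ {w i x y} → (bit w i ≡ false → bit w (i ℕ.+ m) ≡ true → x ≡ y) → up w i * x ≡ up w i * y
      up-cong {w} {i} {x} {y} h = lemma (bit w i) (bit w (i ℕ.+ m)) refl refl
        where
        zero-cong : 0ℚ * x ≡ 0ℚ * y
        zero-cong = trans (ℚ.*-zeroˡ x) (sym (ℚ.*-zeroˡ y))
        lemma : ∀ b c → bit w i ≡ b → bit w (i ℕ.+ m) ≡ c → ⟦ not b ∧ c ⟧ * x ≡ ⟦ not b ∧ c ⟧ * y
        lemma true  c     _ _ = zero-cong
        lemma false false _ _ = zero-cong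
        lemma false true  p q = cong (1ℚ *_) (h p q)

      -- The move itself adds one copy of the increment to the power sums, so r + 1 copies before it
      -- amount to r copies after it.
      jumped-move : ∀ r i w → i ℕ.+ m < length w → bit w i ≡ false → bit w (i ℕ.+ m) ≡ true → zeros w ≡ Z →
        g (r + 1ℚ) w i ≡ g r (move m i w) i
      jumped-move r i w i+m<l hole particle refl = polyAt-cong f (λ k → trans
        (ring (1/ k !) (rowdiff (_^ k) ½ (decode w)) (β (suc k)) r (pos Z i ^ k - (pos Z i - fromℕ m) ^ k))
        (cong (λ R → 1/ k ! * R + β (suc k) + 1/ k ! * (r * (pos Z i ^ k - (pos Z i - fromℕ m) ^ k)))
          (sym (rowdiff-move m i w 1≤m i+m<l hole particle (_^ k)))))
        where
        ring : ∀ e R b r d → e * R + b + e * ((r + 1ℚ) * d) ≡ e * (R + d) + b + e * (r * d)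
        ring = solve-∀ ℚ-ring

      𝟙-move : ∀ s i w → i ℕ.+ m < length w → bit w i ≡ false → bit w (i ℕ.+ m) ≡ true → 𝟙 s w ≡ 𝟙 (s ℕ.+ m) (move m i w)
      𝟙-move s i w i+m<l hole particle = cong ⟦_⟧ (does-⇔ (config? O s w) (config? O (s ℕ.+ m) (move m i w))
        (λ (o , e) → trans (ones-move m i w 1≤m i+m<l hole particle) o , trans sum≡ (cong (ℕ._+ m) e))
        (λ (o , e) → trans (sym (ones-move m i w 1≤m i+m<l hole particle)) o , ℕ.+-cancelʳ-≡ m _ s (trans (sym sum≡) e)))
        where
        sum≡ : sum (decode (move m i w)) ≡ sum (decode w) ℕ.+ m
        sum≡ = sum-move m i w 1≤m i+m<l hole particle

    raisable≡lowerable : ∀ r s → raisable (r + 1ℚ) s ≡ lowerable r (s ℕ.+ m)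
    raisable≡lowerable r s = begin
      raisable (r + 1ℚ) s
        ≡⟨ exchange-sums s up (g (r + 1ℚ)) ⟩
      ∑[ i ∈ upTo J ] ∑[ w ∈ W ] up w i * (𝟙 s w * g (r + 1ℚ) w i)
        ≡⟨ ∑-upTo-cong J (λ {i} i<J → trans
             (∑-cong∈ W (λ {w} w∈ → up-cong {w} {i} (λ hole particle → trans
               (∑-config {O} {s} {w} (λ o _ → jumped-move r i w (index-bound-length i<J w∈) hole particle (zeros≡ {Z} w∈ o)))
               (cong (_* g r (move m i w) i) (𝟙-move s i w (index-bound-length i<J w∈) hole particle)))))
             (∑-words-move (Z ℕ.+ O) m i (λ v → 𝟙 (s ℕ.+ m) v * g r v i) 1≤m (index-bound i<J))) ⟩
      ∑[ i ∈ upTo J ] ∑[ w ∈ W ] down w i * (𝟙 (s ℕ.+ m) w * g r w i)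
        ≡⟨ exchange-sums (s ℕ.+ m) down (g r) ⟨
      lowerable r (s ℕ.+ m) ∎
      where open ≡-Reasoning

    -- A lowerable configuration is the image of another under a move, and then its size is at least
    -- m.
    lowerable-vanishes : ∀ r {s} → s < m → lowerable r s ≡ 0ℚ
    lowerable-vanishes r {s} s<m = begin
      lowerable r s
        ≡⟨ exchange-sums s down (g r) ⟩
      ∑[ i ∈ upTo J ] ∑[ w ∈ W ] down w i * (𝟙 s w * g r w i)
        ≡⟨ ∑-upTo-0 J (λ {i} i<J → trans
             (sym (∑-words-move (Z ℕ.+ O) m i (λ v → 𝟙 s v * g r v i) 1≤m (index-bound i<J)))
             (∑-0 W (λ {w} w∈ → trans
               (up-cong {w} {i} {y = 0ℚ} (λ hole particle → trans
                 (cong (λ b → ⟦ b ⟧ * g r (move m i w) i) (dec-false (config? O s (move m i w)) (λ (_ , e) → ℕ.<⇒≱ s<m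
                   (ℕ.≤-trans (ℕ.m≤n+m m (sum (decode w))) (ℕ.≤-reflexive (trans (sym (sum-move m i w 1≤m (index-bound-length i<J w∈) hole particle)) e))))))
                 (ℚ.*-zeroˡ (g r (move m i w) i))))
               (ℚ.*-zeroʳ (up w i))))) ⟩
      0ℚ ∎
      where open ≡-Reasoning

    -- The regularised particle sum for A_r - B_r, in the form in which `ρ-sum` delivers it.
    balance : ℚ → ℕ → ℚ
    balance r s = ∑[ w ∈ W ] 𝟙 s w *
      (rowdiff (λ y → jumped f m r (decode w) (y + fromℕ m) - jumped f m r (decode w) y) ½ (decode w)
        + (∑[ i ∈ upTo m ] jumped f m r (decode w) (fromℕ i + ½)))

    -- The two bounds guarantee m holes at the top and m particles at the bottom of every word in
    -- the sum, as `particle-exchange` demands.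
    balance≡ : ∀ r s → s ℕ.+ m ≤ Z → s ℕ.+ m ≤ O → balance r s ≡ raisable r s - lowerable r s
    balance≡ r s s+m≤Z s+m≤O = begin
      balance r s
        ≡⟨ ∑-cong∈ W (λ {w} w∈ → ∑-config {O} {s} {w} (λ o e → lemma w (zeros≡ {Z} w∈ o) o e s+m≤Z s+m≤O)) ⟩
      ∑[ w ∈ W ] 𝟙 s w * ((∑[ i ∈ upTo J ] up w i * g r w i) - (∑[ i ∈ upTo J ] down w i * g r w i))
        ≡⟨ ∑-cong W (λ w → ring (𝟙 s w) (∑[ i ∈ upTo J ] up w i * g r w i) (∑[ i ∈ upTo J ] down w i * g r w i)) ⟩
      ∑[ w ∈ W ] (𝟙 s w * (∑[ i ∈ upTo J ] up w i * g r w i) - 𝟙 s w * (∑[ i ∈ upTo J ] down w i * g r w i))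
        ≡⟨ ∑-- (λ w → 𝟙 s w * (∑[ i ∈ upTo J ] up w i * g r w i)) (λ w → 𝟙 s w * (∑[ i ∈ upTo J ] down w i * g r w i)) W ⟩
      raisable r s - lowerable r s ∎
      where
      open ≡-Reasoning
      ring : ∀ x y z → x * (y - z) ≡ x * y - x * z
      ring = solve-∀ ℚ-ring
      lemma : ∀ w → zeros w ≡ Z → ones w ≡ O → sum (decode w) ≡ s → s ℕ.+ m ≤ Z → s ℕ.+ m ≤ O → _
      lemma w refl o refl z≥ o≥ = particle-exchange (jumped f m r (decode w)) m O′ w (top-holes w z≥)
        (bottom-particles w (trans o (sym m+O′≡O)) (ℕ.≤-trans o≥ (ℕ.≤-reflexive (sym o)))) (trans o (sym m+O′≡O))

    balance-cong : ∀ {r r′} s → r ≡ r′ → balance r s ≡ balance r′ s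
    balance-cong s refl = refl

    -- Every raised configuration is counted again, lowered, one step later.
    telescope : ∀ c → fromℕ m * c ≡ 1ℚ → ∀ n r → n ≤ Z → n ≤ O →
      ∑[ d ∈ upTo n ] ⟦ does (m ∣? suc d) ⟧ * balance (r + fromℕ (suc d) * c) (n ∸ suc d) ≡ lowerable r n
    telescope c mc≡1 n r n≤Z n≤O = go n (<-wellFounded n) r n≤Z n≤O
      where
      open ≡-Reasoning
      F : ℚ → ℕ → ℕ → ℚ
      -- The terms of the telescope are those with d + 1 a multiple of m. Summing over all d with an
      -- indicator prepares the exchange with the divisor sums.
      F r n d = ⟦ does (m ∣? suc d) ⟧ * balance (r + fromℕ (suc d) * c) (n ∸ suc d)

      not-multiple : ∀ r n d → suc d < m → F r n d ≡ 0ℚ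
      not-multiple r n d 1+d<m = trans
        (cong (λ b → ⟦ b ⟧ * balance (r + fromℕ (suc d) * c) (n ∸ suc d)) (dec-false (m ∣? suc d) (λ m∣1+d → ℕ.<⇒≱ 1+d<m (∣⇒≤ m∣1+d))))
        (ℚ.*-zeroˡ (balance (r + fromℕ (suc d) * c) (n ∸ suc d)))

      -- Of 1, ..., m only m itself is a multiple of m, and there (d + 1) c = 1; `suc j` for m lets
      -- this last term split off.
      below : ∀ r n j → suc j ≡ m → ∑ (upTo m) (F r (m ℕ.+ n)) ≡ balance (r + 1ℚ) n
      below r n j refl = begin
        ∑ (upTo (suc j)) (F r (suc j ℕ.+ n))
          ≡⟨ ∑-upTo-snoc j (F r (suc j ℕ.+ n)) ⟩
        ∑ (upTo j) (F r (suc j ℕ.+ n)) + F r (suc j ℕ.+ n) j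
          ≡⟨ cong₂ _+_ (∑-upTo-0 j (λ {d} d<j → not-multiple r (suc j ℕ.+ n) d (s≤s d<j)))
               (cong₂ (λ b s → ⟦ b ⟧ * balance (r + fromℕ (suc j) * c) s) (dec-true (suc j ∣? suc j) ∣-refl) (ℕ.m+n∸m≡n (suc j) n)) ⟩
        0ℚ + 1ℚ * balance (r + fromℕ (suc j) * c) n
          ≡⟨ trans (ℚ.+-identityˡ _) (ℚ.*-identityˡ (balance (r + fromℕ (suc j) * c) n)) ⟩
        balance (r + fromℕ (suc j) * c) n
          ≡⟨ balance-cong n (cong (r +_) mc≡1) ⟩
        balance (r + 1ℚ) n ∎

      step : ∀ r n d → F r (m ℕ.+ n) (m ℕ.+ d) ≡ F (r + 1ℚ) n d
      step r n d = cong₂ _*_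
        (cong ⟦_⟧ (does-⇔ (m ∣? suc (m ℕ.+ d)) (m ∣? suc d)
          (λ h → ∣m+n∣m⇒∣n (subst (m ∣_) (sym (ℕ.+-suc m d)) h) ∣-refl)
          (λ h → subst (m ∣_) (ℕ.+-suc m d) (∣m∣n⇒∣m+n ∣-refl h))))
        (trans (balance-cong (m ℕ.+ n ∸ suc (m ℕ.+ d)) shift≡) (cong (balance (r + 1ℚ + fromℕ (suc d) * c))
          (trans (cong (m ℕ.+ n ∸_) (sym (ℕ.+-suc m d))) (ℕ.[m+n]∸[m+o]≡n∸o m n (suc d)))))
        where
        ring : ∀ r m d c → r + (m + d) * c ≡ r + m * c + d * c
        ring = solve-∀ ℚ-ring
        shift≡ : r + fromℕ (suc (m ℕ.+ d)) * c ≡ r + 1ℚ + fromℕ (suc d) * c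
        shift≡ = trans (cong (λ x → r + x * c) (trans (cong fromℕ (sym (ℕ.+-suc m d))) (fromℕ-+ m (suc d))))
          (trans (ring r (fromℕ m) (fromℕ (suc d)) c) (cong (λ x → r + x + fromℕ (suc d) * c) mc≡1))

      go : ∀ n → Acc _<_ n → ∀ r → n ≤ Z → n ≤ O → ∑ (upTo n) (F r n) ≡ lowerable r n
      go n (acc rec) r n≤Z n≤O = split (m ℕ.≤? n)
        where
        split : Dec (m ≤ n) → ∑ (upTo n) (F r n) ≡ lowerable r n
        split (no m≰n)  = trans (∑-upTo-0 n (λ {d} d<n → not-multiple r n d (ℕ.≤-<-trans d<n (ℕ.≰⇒> m≰n)))) (sym (lowerable-vanishes r (ℕ.≰⇒> m≰n)))
        split (yes m≤n) = begin
          ∑ (upTo n) (F r n)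
            ≡⟨ cong (λ k → ∑ (upTo k) (F r k)) (ℕ.m+[n∸m]≡n m≤n) ⟨
          ∑ (upTo (m ℕ.+ n′)) (F r (m ℕ.+ n′))
            ≡⟨ ∑-upTo-+ m n′ (F r (m ℕ.+ n′)) ⟩
          ∑ (upTo m) (F r (m ℕ.+ n′)) + (∑[ d ∈ upTo n′ ] F r (m ℕ.+ n′) (m ℕ.+ d))
            ≡⟨ cong₂ _+_ (below r n′ (ℕ.pred m) (ℕ.suc-pred m {{ℕ.>-nonZero 1≤m}})) (∑-cong (upTo n′) (step r n′)) ⟩
          balance (r + 1ℚ) n′ + ∑ (upTo n′) (F (r + 1ℚ) n′)
            -- The remaining terms are the same sum for r + 1 and n - m. By induction they equal the
            -- very lowerable sum that the first balance subtracts.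
            ≡⟨ cong₂ _+_ (balance≡ (r + 1ℚ) n′ (ℕ.≤-trans (ℕ.≤-reflexive n′+m≡n) n≤Z) (ℕ.≤-trans (ℕ.≤-reflexive n′+m≡n) n≤O))
                 (go n′ (rec (ℕ.∸-monoʳ-< 1≤m m≤n)) (r + 1ℚ) (ℕ.≤-trans (ℕ.m∸n≤m n m) n≤Z) (ℕ.≤-trans (ℕ.m∸n≤m n m) n≤O)) ⟩
          (raisable (r + 1ℚ) n′ - lowerable (r + 1ℚ) n′) + lowerable (r + 1ℚ) n′
            ≡⟨ ring (raisable (r + 1ℚ) n′) (lowerable (r + 1ℚ) n′) ⟩
          raisable (r + 1ℚ) n′
            ≡⟨ trans (raisable≡lowerable r n′) (cong (lowerable r) n′+m≡n) ⟩
          lowerable r n ∎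
          where
          n′ : ℕ
          n′ = n ∸ m
          n′+m≡n : n′ ℕ.+ m ≡ n
          n′+m≡n = ℕ.m∸n+n≡m m≤n
          ring : ∀ x y → (x - y) + y ≡ x
          ring = solve-∀ ℚ-ring

  -- Hook lengths

  count : ℕ → List ℕ → ℕ
  count j ls = length (filter (j ℕ.<?_) ls)

  count-∷ : ∀ {j l} ls → j < l → count j (l ∷ ls) ≡ suc (count j ls)
  count-∷ {j} ls j<l = cong length (List.filter-accept (j ℕ.<?_) j<l)

  count-none : ∀ {j ls} → All (_≤ j) ls → count j ls ≡ 0
  count-none {j} h = cong length (List.filter-none (j ℕ.<?_) (All.map ℕ.≤⇒≯ h))

  -- The leg is counted among the later rows only, which gives a recursion on the list without row
  -- indices.
  hookSum : (ℕ → ℚ) → List ℕ → ℚ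
  hookSum g []       = 0ℚ
  hookSum g (l ∷ ls) = (∑[ j ∈ upTo l ] g ((l ∸ suc j) ℕ.+ count j ls ℕ.+ 1)) + hookSum g ls

  Decreasing : List ℕ → Set
  Decreasing = Linked _≥_

  decreasing⇒≤ : ∀ {l ls} → Decreasing (l ∷ ls) → All (_≤ l) ls
  decreasing⇒≤ {l} {[]}     _         = []
  decreasing⇒≤ {l} {k ∷ ls} (l≥k ∷ d) = l≥k ∷ All.map (λ i≤k → ℕ.≤-trans i≤k l≥k) (decreasing⇒≤ d)

  decreasing-tail : ∀ {l ls} → Decreasing (l ∷ ls) → Decreasing ls
  decreasing-tail {ls = []}    _       = []
  decreasing-tail {ls = _ ∷ _} (_ ∷ d) = d

  decreasing-∷ : ∀ {l ls} → All (_≤ l) ls → Decreasing ls → Decreasing (l ∷ ls)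
  decreasing-∷ []        []  = [-]
  decreasing-∷ (k≤l ∷ _) [-] = k≤l ∷ [-]
  decreasing-∷ (k≤l ∷ _) (h ∷ d) = k≤l ∷ h ∷ d

  -- In a decreasing list every row above row i also exceeds j, so subtracting `suc (toℕ i)` from
  -- the column leaves just the rows below.
  hookSum-allFin : ∀ g ls → Decreasing ls →
    ∑[ i ∈ allFin (length ls) ] (∑[ j ∈ upTo (lookup ls i) ] g ((lookup ls i ∸ suc j) ℕ.+ (count j ls ∸ suc (toℕ i)) ℕ.+ 1)) ≡ hookSum g ls
  hookSum-allFin g []       d = refl
  hookSum-allFin g (l ∷ ls) d = begin
    ∑ (allFin (suc (length ls))) S                      ≡⟨ ∑-allFin-suc (length ls) S ⟩
    S Fin.zero + ∑ (allFin (length ls)) (S ∘ Fin.suc)   ≡⟨ cong₂ _+_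
      (∑-upTo-cong l (λ {j} j<l → cong (λ c → g ((l ∸ suc j) ℕ.+ (c ∸ 1) ℕ.+ 1)) (count-∷ ls j<l)))
      (∑-cong (allFin (length ls)) (λ i → ∑-upTo-cong (lookup ls i) (λ {j} j<k → cong (λ c → g ((lookup ls i ∸ suc j) ℕ.+ (c ∸ suc (suc (toℕ i))) ℕ.+ 1))
        (count-∷ ls (ℕ.<-≤-trans j<k (All.lookup (decreasing⇒≤ d) (∈-lookup i))))))) ⟩
    (∑[ j ∈ upTo l ] g ((l ∸ suc j) ℕ.+ count j ls ℕ.+ 1)) +
      (∑[ i ∈ allFin (length ls) ] ∑[ j ∈ upTo (lookup ls i) ] g ((lookup ls i ∸ suc j) ℕ.+ (count j ls ∸ suc (toℕ i)) ℕ.+ 1))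
                                                        ≡⟨ cong ((∑[ j ∈ upTo l ] g ((l ∸ suc j) ℕ.+ count j ls ℕ.+ 1)) +_) (hookSum-allFin g ls (decreasing-tail d)) ⟩
    hookSum g (l ∷ ls)                                  ∎
    where
    open ≡-Reasoning
    S : Fin (suc (length ls)) → ℚ
    S i = ∑[ j ∈ upTo (lookup (l ∷ ls) i) ] g ((lookup (l ∷ ls) i ∸ suc j) ℕ.+ (count j (l ∷ ls) ∸ suc (toℕ i)) ℕ.+ 1)

  T̃-hookSum : ∀ p μ → T̃ p μ ≡ hookSum (λ h → fromℕ h ^ (p ∸ 1)) (parts μ) + ½ * ζ⁻ p
  T̃-hookSum p μ = cong (_+ ½ * ζ⁻ p) (hookSum-allFin (λ h → fromℕ h ^ (p ∸ 1)) (parts μ) (decreasing μ))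

  -- Hooks read off from a word

  decode-≤ : ∀ w → All (_≤ zeros w) (decode w)
  decode-≤ []          = []
  decode-≤ (false ∷ w) = All.map ℕ.m≤n⇒m≤1+n (decode-≤ w)
  decode-≤ (true ∷ w)  = ℕ.≤-refl ∷ decode-≤ w

  -- The hooks in the row of a particle correspond to the holes below it.
  row-hooks : ∀ g o w →
    ∑[ j ∈ upTo (zeros w) ] g ((zeros w ∸ suc j) ℕ.+ count j (decode w) ℕ.+ o) ≡ ∑[ i ∈ upTo (length w) ] ⟦ not (bit w i) ⟧ * g (o ℕ.+ i)
  row-hooks g o []          = refl
  row-hooks g o (false ∷ w) = begin
    ∑ (upTo (suc z)) S                                            ≡⟨ ∑-upTo-snoc z S ⟩
    ∑ (upTo z) S + S z                                            ≡⟨ ℚ.+-comm (∑ (upTo z) S) (S z) ⟩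
    S z + ∑ (upTo z) S                                            ≡⟨ cong₂ _+_
      (trans (cong₂ (λ x y → g (x ℕ.+ y ℕ.+ o)) (ℕ.n∸n≡0 z) (count-none (decode-≤ w))) (trans (cong g (sym (ℕ.+-identityʳ o))) (sym (ℚ.*-identityˡ (g (o ℕ.+ 0))))))
      (∑-upTo-cong z (λ {j} j<z → cong g (trans (cong (λ x → x ℕ.+ count j (decode w) ℕ.+ o) (ℕ.+-∸-assoc 1 j<z)) (sym (ℕ.+-suc _ o))))) ⟩
    T 0 + (∑[ j ∈ upTo z ] g ((z ∸ suc j) ℕ.+ count j (decode w) ℕ.+ suc o)) ≡⟨ cong (T 0 +_) (row-hooks g (suc o) w) ⟩
    T 0 + (∑[ i ∈ upTo (length w) ] ⟦ not (bit w i) ⟧ * g (suc o ℕ.+ i))     ≡⟨ cong (T 0 +_) (∑-cong (upTo (length w)) (λ i → cong (λ k → ⟦ not (bit w i) ⟧ * g k) (sym (ℕ.+-suc o i)))) ⟩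
    T 0 + ∑ (upTo (length w)) (T ∘ suc)                           ≡⟨ ∑-upTo-suc (length w) T ⟨
    ∑ (upTo (suc (length w))) T                                   ∎
    where
    open ≡-Reasoning
    z : ℕ
    z = zeros w
    S T : ℕ → ℚ
    S j = g ((suc z ∸ suc j) ℕ.+ count j (decode w) ℕ.+ o)
    T i = ⟦ not (bit (false ∷ w) i) ⟧ * g (o ℕ.+ i)
  row-hooks g o (true ∷ w)  = begin
    ∑[ j ∈ upTo z ] g ((z ∸ suc j) ℕ.+ count j (z ∷ decode w) ℕ.+ o)         ≡⟨ ∑-upTo-cong z (λ {j} j<z → cong g (trans (cong (λ c → (z ∸ suc j) ℕ.+ c ℕ.+ o) (count-∷ (decode w) j<z))
                                                                                 (trans (cong (ℕ._+ o) (ℕ.+-suc (z ∸ suc j) _)) (sym (ℕ.+-suc _ o))))) ⟩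
    ∑[ j ∈ upTo z ] g ((z ∸ suc j) ℕ.+ count j (decode w) ℕ.+ suc o)         ≡⟨ row-hooks g (suc o) w ⟩
    ∑[ i ∈ upTo (length w) ] ⟦ not (bit w i) ⟧ * g (suc o ℕ.+ i)             ≡⟨ ∑-cong (upTo (length w)) (λ i → cong (λ k → ⟦ not (bit w i) ⟧ * g k) (sym (ℕ.+-suc o i))) ⟩
    ∑ (upTo (length w)) (T ∘ suc)                                            ≡⟨ trans (cong (_+ ∑ (upTo (length w)) (T ∘ suc)) (ℚ.*-zeroˡ (g (o ℕ.+ 0)))) (ℚ.+-identityˡ _) ⟨
    T 0 + ∑ (upTo (length w)) (T ∘ suc)                                      ≡⟨ ∑-upTo-suc (length w) T ⟨
    ∑ (upTo (suc (length w))) T                                              ∎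
    where
    open ≡-Reasoning
    z : ℕ
    z = zeros w
    T : ℕ → ℚ
    T i = ⟦ not (bit (true ∷ w) i) ⟧ * g (o ℕ.+ i)

  -- Hooks of length d + 1 are pairs of a particle and a hole d + 1 places below it. The induction
  -- adds the pairs that start at the first letter, which `row-hooks` identifies with the first row.
  hookSum-decode : ∀ g w → hookSum g (decode w) ≡
    ∑[ d ∈ upTo (length w) ] ∑[ i ∈ upTo (length w ∸ suc d) ] ⟦ bit w i ∧ not (bit w (i ℕ.+ suc d)) ⟧ * g (suc d)
  hookSum-decode g []      = refl
  hookSum-decode g (b ∷ w) = sym (begin
    ∑[ d ∈ upTo (suc L) ] ∑[ i ∈ upTo (L ∸ d) ] F d i
      ≡⟨ ∑-upTo-snoc L (λ d → ∑[ i ∈ upTo (L ∸ d) ] F d i) ⟩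
    (∑[ d ∈ upTo L ] ∑[ i ∈ upTo (L ∸ d) ] F d i) + (∑[ i ∈ upTo (L ∸ L) ] F L i)
      ≡⟨ trans (cong (λ n → (∑[ d ∈ upTo L ] ∑[ i ∈ upTo (L ∸ d) ] F d i) + ∑ (upTo n) (F L)) (ℕ.n∸n≡0 L)) (ℚ.+-identityʳ _) ⟩
    ∑[ d ∈ upTo L ] ∑[ i ∈ upTo (L ∸ d) ] F d i
      ≡⟨ ∑-upTo-cong L (λ {d} d<L → trans (cong (λ n → ∑ (upTo n) (F d)) (ℕ.+-∸-assoc 1 d<L)) (∑-upTo-suc (L ∸ suc d) (F d))) ⟩
    ∑[ d ∈ upTo L ] (F d 0 + (∑[ i ∈ upTo (L ∸ suc d) ] F d (suc i)))
      ≡⟨ ∑-+ (λ d → F d 0) (λ d → ∑[ i ∈ upTo (L ∸ suc d) ] F d (suc i)) (upTo L) ⟩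
    (∑[ d ∈ upTo L ] ⟦ b ∧ not (bit w d) ⟧ * g (suc d)) + (∑[ d ∈ upTo L ] ∑[ i ∈ upTo (L ∸ suc d) ] ⟦ bit w i ∧ not (bit w (i ℕ.+ suc d)) ⟧ * g (suc d))
      ≡⟨ cong ((∑[ d ∈ upTo L ] ⟦ b ∧ not (bit w d) ⟧ * g (suc d)) +_) (hookSum-decode g w) ⟨
    (∑[ d ∈ upTo L ] ⟦ b ∧ not (bit w d) ⟧ * g (suc d)) + hookSum g (decode w)
      ≡⟨ head b ⟩
    hookSum g (decode (b ∷ w)) ∎)
    where
    open ≡-Reasoning
    L : ℕ
    L = length w
    F : ℕ → ℕ → ℚ
    F d i = ⟦ bit (b ∷ w) i ∧ not (bit (b ∷ w) (i ℕ.+ suc d)) ⟧ * g (suc d)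
    head : ∀ b → (∑[ d ∈ upTo L ] ⟦ b ∧ not (bit w d) ⟧ * g (suc d)) + hookSum g (decode w) ≡ hookSum g (decode (b ∷ w))
    head true  = cong (_+ hookSum g (decode w)) (sym (row-hooks g 1 w))
    head false = trans (cong (_+ hookSum g (decode w)) (∑-0 (upTo L) (λ {d} _ → ℚ.*-zeroˡ (g (suc d))))) (ℚ.+-identityˡ _)

  -- Trailing zero parts

  PadInvariant : (List ℕ → ℚ) → Set
  PadInvariant F = ∀ k ls → F (ls ++ replicate k 0) ≡ F ls

  rowdiff-pad : ∀ θ c → PadInvariant (rowdiff θ c)
  rowdiff-pad θ c zero    []       = refl
  rowdiff-pad θ c (suc k) []       = trans (cong₂ _+_ (trans (cong (λ x → θ x - θ (- c)) (ℚ.+-identityˡ (- c))) (ℚ.+-inverseʳ (θ (- c)))) (rowdiff-pad θ (c + 1ℚ) k [])) (ℚ.+-identityˡ 0ℚ)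
  rowdiff-pad θ c k       (l ∷ ls) = cong ((θ (fromℕ l - c) - θ (- c)) +_) (rowdiff-pad θ (c + 1ℚ) k ls)

  count-pad : ∀ j k ls → count j (ls ++ replicate k 0) ≡ count j ls
  count-pad j k ls = begin
    length (filter (j ℕ.<?_) (ls ++ replicate k 0))                        ≡⟨ cong length (List.filter-++ (j ℕ.<?_) ls (replicate k 0)) ⟩
    length (filter (j ℕ.<?_) ls ++ filter (j ℕ.<?_) (replicate k 0))       ≡⟨ List.length-++ (filter (j ℕ.<?_) ls) ⟩
    count j ls ℕ.+ count j (replicate k 0)                                 ≡⟨ cong (count j ls ℕ.+_) (count-none (All.replicate⁺ k z≤n)) ⟩
    count j ls ℕ.+ 0                                                       ≡⟨ ℕ.+-identityʳ (count j ls) ⟩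
    count j ls                                                             ∎
    where open ≡-Reasoning

  hookSum-pad : ∀ g → PadInvariant (hookSum g)
  hookSum-pad g zero    []       = refl
  hookSum-pad g (suc k) []       = trans (ℚ.+-identityˡ _) (hookSum-pad g k [])
  hookSum-pad g k       (l ∷ ls) = cong₂ _+_ (∑-cong (upTo l) (λ j → cong (λ c → g ((l ∸ suc j) ℕ.+ c ℕ.+ 1)) (count-pad j k ls))) (hookSum-pad g k ls)

  Qᵖ-pad : ∀ i → PadInvariant (λ ls → Qᵖ ls i)
  Qᵖ-pad zero    k ls = refl
  Qᵖ-pad (suc i) k ls = cong (λ r → 1/ i ! * r + β (suc i)) (rowdiff-pad (_^ i) ½ k ls)

  -- Partitions of s as words

  IsPartition : List ℕ → Set
  IsPartition ls = Decreasing ls × All (0 <_) ls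

  isPartition? : Decidable IsPartition
  isPartition? ls = linked? ℕ._≥?_ ls ×-dec All.all? (0 ℕ.<?_) ls

  -- Passing to the underlying lists avoids any comparison of the proofs stored in `Partition`.
  map-parts : ∀ xs → map parts (mapMaybe partition? xs) ≡ filter isPartition? xs
  map-parts []       = refl
  map-parts (x ∷ xs) with linked? ℕ._≥?_ x | All.all? (0 ℕ.<?_) x
  ... | yes d | yes p = cong (x ∷_) (map-parts xs)
  ... | yes d | no _  = map-parts xs
  ... | no _  | _     = map-parts xs

  candidates : ℕ → List (List ℕ)
  candidates s = filter (λ ls → sum ls ℕ.≟ s) (concatMap (λ l → lists l s) (upTo (suc s)))

  partitionLists : ℕ → List (List ℕ)
  partitionLists s = filter isPartition? (candidates s)

  ∑-partitions : ∀ s (F : List ℕ → ℚ) → ∑ (partitions s) (F ∘ parts) ≡ ∑ (partitionLists s) F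
  ∑-partitions s F = trans (sym (∑-map F parts (partitions s))) (cong (λ xs → ∑ xs F) (map-parts (candidates s)))

  lists-length : ∀ l b {ls} → ls ∈ lists l b → length ls ≡ l
  lists-length zero    b (here refl) = refl
  lists-length (suc l) b ls∈ with ∈-cartesianProductWith⁻ _∷_ (upTo (suc b)) (lists l b) ls∈
  ... | x , xs , _ , xs∈ , refl = cong suc (lists-length l b xs∈)

  lists-unique : ∀ l b → Unique (lists l b)
  lists-unique zero    b = [] ∷ []
  lists-unique (suc l) b = Unique.cartesianProductWith⁺ _∷_ List.∷-injective (Unique.upTo⁺ (suc b)) (lists-unique l b)

  ∈-lists : ∀ {b} ls → All (_≤ b) ls → ls ∈ lists (length ls) b
  ∈-lists []       _            = here refl
  ∈-lists (x ∷ ls) (x≤b ∷ ls≤b) = ∈-cartesianProductWith⁺ _∷_ (∈-upTo⁺ (s≤s x≤b)) (∈-lists ls ls≤b)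

  partitionLists-unique : ∀ s → Unique (partitionLists s)
  partitionLists-unique s = Unique.filter⁺ isPartition? (Unique.filter⁺ (λ ls → sum ls ℕ.≟ s) (Unique.concat⁺ {xss = map (λ l → lists l s) (upTo (suc s))}
    (All.map⁺ (All.tabulate {xs = upTo (suc s)} (λ {l} _ → lists-unique l s)))
    (AllPairs.map⁺ (AllPairs.applyUpTo⁺₁ id (suc s) (λ i<j _ (∈i , ∈j) → ℕ.<⇒≢ i<j (trans (sym (lists-length _ s ∈i)) (lists-length _ s ∈j)))))))

  length≤sum : ∀ {ls} → All (0 <_) ls → length ls ≤ sum ls
  length≤sum []      = z≤n
  length≤sum (p ∷ h) = ℕ.+-mono-≤ p (length≤sum h)

  parts≤sum : ∀ ls → All (_≤ sum ls) ls
  parts≤sum []       = []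
  parts≤sum (l ∷ ls) = ℕ.m≤m+n l (sum ls) ∷ All.map (λ h → ℕ.≤-trans h (ℕ.m≤n+m (sum ls) l)) (parts≤sum ls)

  ∈-partitionLists⁺ : ∀ {s ls} → IsPartition ls → sum ls ≡ s → ls ∈ partitionLists s
  ∈-partitionLists⁺ {s} {ls} (d , p) refl = ∈-filter⁺ isPartition? (∈-filter⁺ (λ ls → sum ls ℕ.≟ s)
    (∈-concatMap⁺ (λ l → lists l s) (Any.map (λ { refl → ∈-lists ls (parts≤sum ls) }) (∈-upTo⁺ (s≤s (length≤sum p))))) refl) (d , p)

  ∈-partitionLists⁻ : ∀ {s ls} → ls ∈ partitionLists s → IsPartition ls × sum ls ≡ s
  ∈-partitionLists⁻ {s} ls∈ with ∈-filter⁻ isPartition? {xs = candidates s} ls∈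
  ... | ls∈′ , p = p , proj₂ (∈-filter⁻ (λ ls → sum ls ℕ.≟ s) {xs = concatMap (λ l → lists l s) (upTo (suc s))} ls∈′)

  words-unique : ∀ K → Unique (words K)
  words-unique zero    = [] ∷ []
  words-unique (suc K) = Unique.++⁺ (Unique.map⁺ List.∷-injectiveʳ (words-unique K)) (Unique.map⁺ List.∷-injectiveʳ (words-unique K)) disjoint
    where
    disjoint : ∀ {w} → ¬ (w ∈ map (false ∷_) (words K) × w ∈ map (true ∷_) (words K))
    disjoint (p , q) with ∈-map⁻ (false ∷_) p | ∈-map⁻ (true ∷_) q
    ... | _ , _ , refl | _ , _ , ()

  ∈-words : ∀ w → w ∈ words (length w)
  ∈-words []          = here refl
  ∈-words (false ∷ w) = ∈-++⁺ˡ (∈-map⁺ (false ∷_) (∈-words w))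
  ∈-words (true ∷ w)  = ∈-++⁺ʳ (map (false ∷_) (words (length w))) (∈-map⁺ (true ∷_) (∈-words w))

  -- The bijection between words and partitions

  strip : List ℕ → List ℕ
  strip = filter (0 ℕ.<?_)

  zero-parts : ∀ {ls} → All (_≤ 0) ls → ls ≡ replicate (length ls) 0
  zero-parts []            = refl
  zero-parts (z≤n ∷ h)     = cong (0 ∷_) (zero-parts h)

  strip-pad : ∀ ls → Decreasing ls → ∃ λ k → ls ≡ strip ls ++ replicate k 0
  strip-pad []           d = 0 , refl
  strip-pad (zero ∷ ls)  d = suc (length ls) ,
    trans (cong (0 ∷_) (zero-parts (decreasing⇒≤ d))) (cong (_++ replicate (suc (length ls)) 0) (sym (List.filter-none (0 ℕ.<?_) (All.map ℕ.≤⇒≯ (z≤n ∷ decreasing⇒≤ d)))))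
  strip-pad (suc l ∷ ls) d with strip-pad ls (decreasing-tail d)
  ... | k , eq = k , cong (suc l ∷_) eq

  strip-sum : ∀ ls → sum (strip ls) ≡ sum ls
  strip-sum []           = refl
  strip-sum (zero ∷ ls)  = strip-sum ls
  strip-sum (suc l ∷ ls) = cong (suc l ℕ.+_) (strip-sum ls)

  decode-decreasing : ∀ w → Decreasing (decode w)
  decode-decreasing []          = []
  decode-decreasing (false ∷ w) = decode-decreasing w
  decode-decreasing (true ∷ w)  = decreasing-∷ (decode-≤ w) (decode-decreasing w)

  length-decode : ∀ w → length (decode w) ≡ ones w
  length-decode []          = refl
  length-decode (false ∷ w) = length-decode w
  length-decode (true ∷ w)  = cong suc (length-decode w)

  -- If one word starts with a hole and the other with a particle, equal lengths and equal numbers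
  -- of parts give the tail of the second one hole more than the tail of the first. Its first part
  -- then exceeds every part of the first word.
  decode-injective : ∀ w v → length w ≡ length v → decode w ≡ decode v → w ≡ v
  decode-injective []          []          l e = refl
  decode-injective (false ∷ w) (false ∷ v) l e = cong (false ∷_) (decode-injective w v (ℕ.suc-injective l) e)
  decode-injective (true ∷ w)  (true ∷ v)  l e = cong (true ∷_) (decode-injective w v (ℕ.suc-injective l) (List.∷-injectiveʳ e))
  decode-injective (false ∷ w) (true ∷ v)  l e = contradiction e (decode-differs w v (ℕ.suc-injective l))
    where
    decode-differs : ∀ w v → length w ≡ length v → decode w ≢ zeros v ∷ decode v
    decode-differs w v l e = ℕ.<⇒≱ (ℕ.≤-reflexive 1+zeros) (All.head (subst (All (_≤ zeros w)) e (decode-≤ w)))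
      where
      ones≡ : ones w ≡ suc (ones v)
      ones≡ = trans (sym (length-decode w)) (trans (cong length e) (cong suc (length-decode v)))
      1+zeros : suc (zeros w) ≡ zeros v
      1+zeros = ℕ.+-cancelʳ-≡ (ones v) (suc (zeros w)) (zeros v) (trans (sym (ℕ.+-suc (zeros w) (ones v)))
        (trans (cong (zeros w ℕ.+_) (sym ones≡)) (trans (sym (length≡zeros+ones w)) (trans l (length≡zeros+ones v)))))
  decode-injective (true ∷ w)  (false ∷ v) l e = sym (decode-injective (false ∷ v) (true ∷ w) (sym l) (sym e))

  pad : ℕ → List ℕ → List ℕ
  pad O ls = ls ++ replicate (O ∸ length ls) 0

  strip-decode : ∀ w → pad (ones w) (strip (decode w)) ≡ decode w
  strip-decode w with strip-pad (decode w) (decode-decreasing w)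
  ... | k , eq = trans (cong (λ n → S ++ replicate n 0) k≡) (sym eq)
    where
    S : List ℕ
    S = strip (decode w)
    k≡ : ones w ∸ length S ≡ k
    k≡ = trans (cong (_∸ length S) (trans (sym (length-decode w)) (trans (cong length eq) (trans (List.length-++ S) (cong (length S ℕ.+_) (List.length-replicate k))))))
      (ℕ.m+n∸m≡n (length S) k)

  -- Here z counts the holes still to be placed; all but l of them lie above the particle with part
  -- l.
  encode : ℕ → List ℕ → Word
  encode z []       = replicate z false
  encode z (l ∷ ls) = replicate (z ∸ l) false ++ true ∷ encode l ls

  decode-holes : ∀ k w → decode (replicate k false ++ w) ≡ decode w
  decode-holes zero    w = refl
  decode-holes (suc k) w = decode-holes k w

  zeros-holes : ∀ k w → zeros (replicate k false ++ w) ≡ k ℕ.+ zeros w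
  zeros-holes zero    w = refl
  zeros-holes (suc k) w = cong suc (zeros-holes k w)

  zeros-encode : ∀ z ls → All (_≤ z) ls → Decreasing ls → zeros (encode z ls) ≡ z
  zeros-encode z []       _         d = trans (cong zeros (sym (List.++-identityʳ (replicate z false)))) (trans (zeros-holes z []) (ℕ.+-identityʳ z))
  zeros-encode z (l ∷ ls) (l≤z ∷ _) d = trans (zeros-holes (z ∸ l) _) (trans (cong (z ∸ l ℕ.+_) (zeros-encode l ls (decreasing⇒≤ d) (decreasing-tail d))) (ℕ.m∸n+n≡m l≤z))

  decode-encode : ∀ z ls → All (_≤ z) ls → Decreasing ls → decode (encode z ls) ≡ ls
  decode-encode z []       _         d = trans (cong decode (sym (List.++-identityʳ (replicate z false)))) (decode-holes z [])
  decode-encode z (l ∷ ls) (l≤z ∷ _) d = trans (decode-holes (z ∸ l) _)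
    (cong₂ _∷_ (zeros-encode l ls (decreasing⇒≤ d) (decreasing-tail d)) (decode-encode l ls (decreasing⇒≤ d) (decreasing-tail d)))

  decreasing-pad : ∀ k {ls} → Decreasing ls → Decreasing (ls ++ replicate k 0)
  decreasing-pad zero    []              = []
  decreasing-pad (suc k) []              = decreasing-∷ (All.replicate⁺ k z≤n) (decreasing-pad k [])
  decreasing-pad zero    [-]             = [-]
  decreasing-pad (suc k) [-]             = z≤n ∷ decreasing-pad (suc k) []
  decreasing-pad k       (h ∷ d)         = h ∷ decreasing-pad k d

  sum-pad : ∀ k ls → sum (ls ++ replicate k 0) ≡ sum ls
  sum-pad zero    []       = refl
  sum-pad (suc k) []       = sum-pad k []
  sum-pad k       (l ∷ ls) = cong (l ℕ.+_) (sum-pad k ls)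

  map-unique : ∀ {A B : Set} {P : A → Set} (f : A → B) → (∀ {x y} → P x → P y → f x ≡ f y → x ≡ y) →
    ∀ {xs} → All P xs → Unique xs → Unique (map f xs)
  map-unique f inj []       []       = []
  map-unique f inj (p ∷ ps) (x≢ ∷ u) = All.map⁺ (All.zipWith (λ (q , x≢y) → x≢y ∘ inj p q) (ps , x≢)) ∷ map-unique f inj ps u

  module _ (Z O s : ℕ) (s≤Z : s ≤ Z) (s≤O : s ≤ O) where

    private
      configs : List Word
      configs = filter (config? O s) (words (Z ℕ.+ O))

      wordPartitions : List (List ℕ)
      wordPartitions = map (strip ∘ decode) configs

      ∈-configs⁻ : ∀ {w} → w ∈ configs → length w ≡ Z ℕ.+ O × ones w ≡ O × sum (decode w) ≡ s
      ∈-configs⁻ w∈ with ∈-filter⁻ (config? O s) {xs = words (Z ℕ.+ O)} w∈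
      ... | w∈′ , o , e = words-length (Z ℕ.+ O) w∈′ , o , e

      wordPartitions-unique : Unique wordPartitions
      wordPartitions-unique = map-unique (strip ∘ decode) injective (All.tabulate ∈-configs⁻) (Unique.filter⁺ (config? O s) (words-unique (Z ℕ.+ O)))
        where
        injective : ∀ {w v} → length w ≡ Z ℕ.+ O × ones w ≡ O × sum (decode w) ≡ s → length v ≡ Z ℕ.+ O × ones v ≡ O × sum (decode v) ≡ s →
          strip (decode w) ≡ strip (decode v) → w ≡ v
        injective {w} {v} (lw , ow , _) (lv , ov , _) e = decode-injective w v (trans lw (sym lv))
          (trans (sym (strip-decode w)) (trans (cong₂ pad (trans ow (sym ov)) e) (strip-decode v)))

      to : ∀ {ls} → ls ∈ partitionLists s → ls ∈ wordPartitions
      to {ls} ls∈ with ∈-partitionLists⁻ {s} ls∈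
      ... | (d , p) , refl = subst (_∈ wordPartitions) strip≡ (∈-map⁺ (strip ∘ decode) w∈configs)
        where
        w : Word
        w = encode Z (pad O ls)
        pad-≤ : All (_≤ Z) (pad O ls)
        pad-≤ = All.++⁺ (All.map (λ h → ℕ.≤-trans h s≤Z) (parts≤sum ls)) (All.replicate⁺ (O ∸ length ls) z≤n)
        decode≡ : decode w ≡ pad O ls
        decode≡ = decode-encode Z (pad O ls) pad-≤ (decreasing-pad (O ∸ length ls) d)
        ones≡ : ones w ≡ O
        ones≡ = trans (sym (length-decode w)) (trans (cong length decode≡) (trans (List.length-++ ls)
          (trans (cong (length ls ℕ.+_) (List.length-replicate (O ∸ length ls))) (ℕ.m+[n∸m]≡n (ℕ.≤-trans (length≤sum p) s≤O)))))
        length≡ : length w ≡ Z ℕ.+ O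
        length≡ = trans (length≡zeros+ones w) (cong₂ ℕ._+_ (zeros-encode Z (pad O ls) pad-≤ (decreasing-pad (O ∸ length ls) d)) ones≡)
        w∈configs : w ∈ configs
        w∈configs = ∈-filter⁺ (config? O s) (subst (λ K → w ∈ words K) length≡ (∈-words w)) (ones≡ , trans (cong sum decode≡) (sum-pad (O ∸ length ls) ls))
        strip≡ : strip (decode w) ≡ ls
        strip≡ = trans (cong strip decode≡) (trans (List.filter-++ (0 ℕ.<?_) ls (replicate (O ∸ length ls) 0))
          (trans (cong₂ _++_ (List.filter-all (0 ℕ.<?_) p) (List.filter-none (0 ℕ.<?_) (All.map ℕ.≤⇒≯ (All.replicate⁺ (O ∸ length ls) z≤n)))) (List.++-identityʳ ls)))

      from : ∀ {ls} → ls ∈ wordPartitions → ls ∈ partitionLists s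
      from ls∈ with ∈-map⁻ (strip ∘ decode) ls∈
      ... | w , w∈ , refl = ∈-partitionLists⁺
        (Linked.filter⁺ (0 ℕ.<?_) (λ p q → ℕ.≤-trans q p) (decode-decreasing w) , All.all-filter (0 ℕ.<?_) (decode w))
        (trans (strip-sum (decode w)) (proj₂ (proj₂ (∈-configs⁻ w∈))))

    -- The bounds s ≤ Z and s ≤ O accommodate the largest part and the number of parts. Both lists
    -- are free of repetitions and have the same members, hence agree up to order.
    ∑-partitions-words : ∀ F → PadInvariant F →
      ∑ (partitions s) (F ∘ parts) ≡ ∑[ w ∈ words (Z ℕ.+ O) ] ⟦ does (config? O s w) ⟧ * F (decode w)
    ∑-partitions-words F F-pad = begin
      ∑ (partitions s) (F ∘ parts)       ≡⟨ ∑-partitions s F ⟩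
      ∑ (partitionLists s) F             ≡⟨ ∑-↭ F (∼bag⇒↭ (unique∧set⇒bag (partitionLists-unique s) wordPartitions-unique (mk⇔ to from))) ⟩
      ∑ wordPartitions F                 ≡⟨ ∑-map F (strip ∘ decode) configs ⟩
      ∑ configs (F ∘ strip ∘ decode)     ≡⟨ ∑-filter (config? O s) (F ∘ strip ∘ decode) (words (Z ℕ.+ O)) ⟩
      ∑[ w ∈ words (Z ℕ.+ O) ] ⟦ does (config? O s w) ⟧ * F (strip (decode w))
        ≡⟨ ∑-cong (words (Z ℕ.+ O)) (λ w → cong (⟦ does (config? O s w) ⟧ *_)
             (trans (sym (F-pad (ones w ∸ length (strip (decode w))) (strip (decode w)))) (cong F (strip-decode w)))) ⟩
      ∑[ w ∈ words (Z ℕ.+ O) ] ⟦ does (config? O s w) ⟧ * F (decode w) ∎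
      where open ≡-Reasoning

  -- Hook lengths are bounded by the size

  hole-depth : ∀ w k → k < length w → bit w k ≡ false → k < zeros w ℕ.+ sum (decode w)
  hole-depth (false ∷ w) zero    _         _  = s≤s z≤n
  hole-depth (false ∷ w) (suc k) (s≤s k<l) eq = s≤s (hole-depth w k k<l eq)
  hole-depth (true ∷ w)  (suc k) (s≤s k<l) eq = ℕ.≤-trans (s≤s (hole-depth w k k<l eq)) (ℕ.+-monoˡ-≤ _ (hole⇒zeros w k k<l eq))

  -- Letters above the particle may be dropped. With the particle in front its part is the number of
  -- holes below, and `hole-depth` is the claim.
  hook-bound : ∀ w i d → i ℕ.+ suc d < length w → bit w i ≡ true → bit w (i ℕ.+ suc d) ≡ false → d < sum (decode w)
  hook-bound (true ∷ w)  zero    d (s≤s lt) p h = hole-depth w d lt h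
  hook-bound (false ∷ w) (suc i) d (s≤s lt) p h = hook-bound w i d lt p h
  hook-bound (true ∷ w)  (suc i) d (s≤s lt) p h = ℕ.≤-trans (hook-bound w i d lt p h) (ℕ.m≤n+m _ (zeros w))

  -- Cuts the hook lengths off at n and makes the range of i that of `lowerable` with Z = O = n and
  -- m = d + 1.
  hookSum-word : ∀ g n w → length w ≡ n ℕ.+ n → sum (decode w) ≡ n →
    hookSum g (decode w) ≡ ∑[ d ∈ upTo n ] g (suc d) * (∑[ i ∈ upTo (n ℕ.+ (n ∸ suc d)) ] ⟦ bit w i ∧ not (bit w (i ℕ.+ suc d)) ⟧)
  hookSum-word g n w length≡ sum≡ = begin
    hookSum g (decode w)                              ≡⟨ hookSum-decode g w ⟩
    ∑[ d ∈ upTo (length w) ] ∑ (upTo (length w ∸ suc d)) (F d)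
      ≡⟨ ∑-upTo-extend (λ d → ∑ (upTo (length w ∸ suc d)) (F d)) (ℕ.≤-trans (ℕ.m≤m+n n n) (ℕ.≤-reflexive (sym length≡))) (λ {d} n≤d → ∑-upTo-0 (length w ∸ suc d) (vanish d n≤d)) ⟩
    ∑[ d ∈ upTo n ] ∑ (upTo (length w ∸ suc d)) (F d)
      ≡⟨ ∑-upTo-cong n (λ {d} d<n → trans (cong (λ k → ∑ (upTo k) (F d)) (trans (cong (_∸ suc d) length≡) (ℕ.+-∸-assoc n d<n)))
           (trans (∑-*ʳ (g (suc d)) _ (upTo (n ℕ.+ (n ∸ suc d)))) (ℚ.*-comm _ (g (suc d))))) ⟩
    ∑[ d ∈ upTo n ] g (suc d) * (∑[ i ∈ upTo (n ℕ.+ (n ∸ suc d)) ] ⟦ bit w i ∧ not (bit w (i ℕ.+ suc d)) ⟧) ∎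
    where
    open ≡-Reasoning
    F : ℕ → ℕ → ℚ
    F d i = ⟦ bit w i ∧ not (bit w (i ℕ.+ suc d)) ⟧ * g (suc d)
    bound : ∀ {i k l} → i < l ∸ k → i ℕ.+ k < l
    bound {i} {k} {l} i< = ℕ.<-≤-trans (ℕ.+-monoˡ-< k i<) (ℕ.≤-reflexive (ℕ.m∸n+n≡m (ℕ.<⇒≤ (ℕ.m∸n≢0⇒n<m {l} {k} (ℕ.m<n⇒n≢0 i<)))))
    vanish : ∀ d → n ≤ d → ∀ {i} → i < length w ∸ suc d → F d i ≡ 0ℚ
    vanish d n≤d {i} i< with bit w i in p | bit w (i ℕ.+ suc d) in h
    ... | true  | false = contradiction (hook-bound w i d (bound i<) p h) (ℕ.≤⇒≯ (ℕ.≤-trans (ℕ.≤-reflexive sum≡) n≤d))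
    ... | true  | true  = ℚ.*-zeroˡ (g (suc d))
    ... | false | _     = ℚ.*-zeroˡ (g (suc d))

  polyAt-pad : ∀ g → PadInvariant (λ ls → polyAt (Qᵖ ls ∘ suc) g)
  polyAt-pad g k ls = polyAt-cong g (λ i → Qᵖ-pad (suc i) k ls)

  -- Divisor sums and Eisenstein series

  fromℕ-sum : ∀ ns → fromℕ (sum ns) ≡ ∑[ n ∈ ns ] fromℕ n
  fromℕ-sum []       = refl
  fromℕ-sum (n ∷ ns) = trans (fromℕ-+ n (sum ns)) (cong (fromℕ n +_) (fromℕ-sum ns))

  -- Divisors of n are at most n, so the range may be any N ≥ n; one range for all coefficients
  -- allows the sum over divisors to be moved outside.
  σ-sum : ∀ r n {N} → n ≤ N → .{{_ : NonZero n}} →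
    fromℕ (σ r n) ≡ ∑[ d ∈ upTo N ] ⟦ does (suc d ∣? n) ⟧ * fromℕ (suc d) ^ r
  σ-sum r n {N} n≤N = begin
    fromℕ (σ r n)
      ≡⟨ fromℕ-sum (map (ℕ._^ r) (filter (_∣? n) (map suc (upTo n)))) ⟩
    ∑ (map (ℕ._^ r) (filter (_∣? n) (map suc (upTo n)))) fromℕ
      ≡⟨ ∑-map fromℕ (ℕ._^ r) (filter (_∣? n) (map suc (upTo n))) ⟩
    ∑[ d ∈ filter (_∣? n) (map suc (upTo n)) ] fromℕ (d ℕ.^ r)
      ≡⟨ trans (∑-filter (_∣? n) (λ d → fromℕ (d ℕ.^ r)) (map suc (upTo n))) (∑-map _ suc (upTo n)) ⟩
    ∑[ d ∈ upTo n ] ⟦ does (suc d ∣? n) ⟧ * fromℕ (suc d ℕ.^ r)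
      ≡⟨ ∑-cong (upTo n) (λ d → cong (⟦ does (suc d ∣? n) ⟧ *_) (fromℕ-^ (suc d) r)) ⟩
    ∑[ d ∈ upTo n ] ⟦ does (suc d ∣? n) ⟧ * fromℕ (suc d) ^ r
      ≡⟨ ∑-upTo-extend (λ d → ⟦ does (suc d ∣? n) ⟧ * fromℕ (suc d) ^ r) n≤N (λ {d} n≤d → trans
           (cong (λ b → ⟦ b ⟧ * fromℕ (suc d) ^ r) (dec-false (suc d ∣? n) (λ 1+d∣n → ℕ.<⇒≱ (s≤s n≤d) (∣⇒≤ 1+d∣n)))) (ℚ.*-zeroˡ (fromℕ (suc d) ^ r))) ⟨
    ∑[ d ∈ upTo N ] ⟦ does (suc d ∣? n) ⟧ * fromℕ (suc d) ^ r ∎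
    where open ≡-Reasoning

  𝐷-iterate : ∀ j k n → G⁽ j ⁾ k n ≡ fromℕ n ^ j * G k n
  𝐷-iterate zero    k n = sym (ℚ.*-identityˡ (G k n))
  𝐷-iterate (suc j) k n = trans (cong (fromℕ n *_) (𝐷-iterate j k n)) (sym (ℚ.*-assoc (fromℕ n) (fromℕ n ^ j) (G k n)))

  1/ℕ-double : ∀ k → 1/ℕ (2 ℕ.* suc k) ≡ ½ * 1/ℕ (suc k)
  1/ℕ-double k = begin
    x                                            ≡⟨ ring₁ x y (fromℕ (suc k)) ⟩
    (½ * (fromℕ 2 * x)) * 1ℚ                     ≡⟨ cong ((½ * (fromℕ 2 * x)) *_) (fromℕ*1/ℕ (suc k)) ⟨
    (½ * (fromℕ 2 * x)) * (fromℕ (suc k) * y)    ≡⟨ ring₂ (fromℕ 2) x (fromℕ (suc k)) y ⟩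
    ½ * (fromℕ 2 * fromℕ (suc k) * x) * y        ≡⟨ cong (λ z → ½ * (z * x) * y) (fromℕ-* 2 (suc k)) ⟨
    ½ * (fromℕ (2 ℕ.* suc k) * x) * y            ≡⟨ cong (λ z → ½ * z * y) (fromℕ*1/ℕ (2 ℕ.* suc k)) ⟩
    ½ * 1ℚ * y                                   ≡⟨ cong (_* y) (ℚ.*-identityʳ ½) ⟩
    ½ * y                                        ∎
    where
    open ≡-Reasoning
    x y : ℚ
    x = 1/ℕ (2 ℕ.* suc k)
    y = 1/ℕ (suc k)
    ring₁ : ∀ x y s → x ≡ (½ * ((1ℚ + 1ℚ) * x)) * 1ℚ
    ring₁ = solve-∀ ℚ-ring
    ring₂ : ∀ t x s y → (½ * (t * x)) * (s * y) ≡ ½ * (t * s * x) * y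
    ring₂ = solve-∀ ℚ-ring

  ⊛-zeroˡ : ∀ {a} b → a ≗ 0ˢ → a ⊛ b ≗ 0ˢ
  ⊛-zeroˡ b h n = ∑-0 (upTo (suc n)) (λ {i} _ → trans (cong (_* b (n ∸ i)) (h i)) (ℚ.*-zeroˡ (b (n ∸ i))))

  ρ-[] : ∀ i j f → weightBound f < i ⊎ weightBound f < j → ρ i j f ≡ []
  ρ-[] i j f h = empty (upTo (suc (weightBound f))) (λ k → ρ-summand-vanishes i j k f (ℕ.<-≤-trans (bound h) (ℕ.m≤m+n _ k)))
    where
    bound : weightBound f < i ⊎ weightBound f < j → weightBound f < i ℕ.+ 2 ℕ.* j
    bound (inj₁ W<i) = ℕ.<-≤-trans W<i (ℕ.m≤m+n i _)
    bound (inj₂ W<j) = ℕ.<-≤-trans W<j (ℕ.≤-trans (ℕ.m≤m+n j _) (ℕ.m≤n+m _ i))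
    empty : ∀ {g : ℕ → 𝓡} ks → (∀ k → g k ≡ []) → concatMap g ks ≡ []
    empty []       h = refl
    empty (k ∷ ks) h = cong₂ _++_ (h k) (empty ks h)

  -- The operators of degree zero

  weight-of-degree-zero : ∀ w m → degree m ≡ 0 → weightFrom w m ≡ 0
  weight-of-degree-zero w []         eq = refl
  weight-of-degree-zero w (zero ∷ m) eq = cong₂ ℕ._+_ (ℕ.*-zeroʳ w) (weight-of-degree-zero (suc w) m eq)

  -- A monomial of degree 0 has weight 0, so the list of monomials is empty unless i = k = 0.
  polyAt-ρ₀-degree-zero : ∀ ls f i k → i ℕ.+ k ≢ 0 →
    ∑[ μ ∈ monomials 0 (i ℕ.+ 0 ℕ.+ k) ] ρ⁽ k ⁾ μ * polyAt (Qᵖ ls ∘ suc) (∂/∂p^ μ f) ≡ 0ℚ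
  polyAt-ρ₀-degree-zero ls f i k i+k≢0 = ∑-0 (monomials 0 w) (λ {μ} μ∈ → contradiction
    (trans (sym (cong (ℕ._+ k) (ℕ.+-identityʳ i))) (zero-weight μ (proj₂ (∈-filter⁻ (monomial? 0 w) {xs = lists w 0} μ∈)))) i+k≢0)
    where
    w : ℕ
    w = i ℕ.+ 0 ℕ.+ k
    zero-weight : ∀ μ → degree μ ≡ 0 × weightFrom 2 μ ≡ w → w ≡ 0
    zero-weight μ (d , e) = trans (sym e) (weight-of-degree-zero 2 μ d)

  polyAt-ρ₀₀ : ∀ ls f → polyAt (Qᵖ ls ∘ suc) (ρ 0 0 f) ≡ polyAt (Qᵖ ls ∘ suc) f
  polyAt-ρ₀₀ ls f = begin
    -- `polyAt-ρ` lives in a module over m, c and t; the values 1, 1 and 0 meet its condition m c =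
    -- 1.
    polyAt (Qᵖ ls ∘ suc) (ρ 0 0 f)       ≡⟨ polyAt-ρ 1 1ℚ refl ls f 0 0 0 ⟩
    ∑ (upTo (suc (weightBound f))) F     ≡⟨ ∑-upTo-suc (weightBound f) F ⟩
    F 0 + ∑ (upTo (weightBound f)) (F ∘ suc) ≡⟨ cong (F 0 +_) (∑-0 (upTo (weightBound f)) (λ {k} _ →
      trans (cong (Qᵖ ls (suc k) *_) (polyAt-ρ₀-degree-zero ls f 0 (suc k) (λ ()))) (ℚ.*-zeroʳ (Qᵖ ls (suc k))))) ⟩
    -- The only monomial left is 1, at which ρ^(0) computes to the integral of 1 over a unit
    -- interval.
    1ℚ * (1ℚ * polyAt (Qᵖ ls ∘ suc) f + 0ℚ) + 0ℚ ≡⟨ ring (polyAt (Qᵖ ls ∘ suc) f) ⟩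
    polyAt (Qᵖ ls ∘ suc) f               ∎
    where
    open ≡-Reasoning
    F : ℕ → ℚ
    F k = Qᵖ ls k * (∑[ μ ∈ monomials 0 k ] ρ⁽ k ⁾ μ * polyAt (Qᵖ ls ∘ suc) (∂/∂p^ μ f))
    ring : ∀ x → 1ℚ * (1ℚ * x + 0ℚ) + 0ℚ ≡ x
    ring = solve-∀ ℚ-ring

  polyAt-ρ₀-suc : ∀ ls f i → polyAt (Qᵖ ls ∘ suc) (ρ (suc i) 0 f) ≡ 0ℚ
  polyAt-ρ₀-suc ls f i = trans (polyAt-ρ 1 1ℚ refl ls f 0 (suc i) 0) (∑-0 (upTo (suc (weightBound f))) (λ {k} _ →
    trans (cong (Qᵖ ls k *_) (polyAt-ρ₀-degree-zero ls f (suc i) k (λ ()))) (ℚ.*-zeroʳ (Qᵖ ls k))))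

  -- Comparison of the coefficients of q^n, with `suc p` for the odd exponent

  module _ (f : 𝓡) (p : ℕ) (p-odd : even (suc p) ≡ false) where

    private
      W N : ℕ
      W = weightBound f
      N = suc W

      S : 𝓡 → Series
      S g n = ∑[ μ ∈ partitions n ] eval g μ

      hookPower : ℕ → ℚ
      hookPower h = fromℕ h ^ p

      Eis : ℕ → ℕ → Series
      Eis i j = G⁽ j ⁾ (suc p ℕ.+ i ℕ.+ 1)

      S-words : ∀ {n s} g → s ≤ n → S g s ≡ ∑[ w ∈ words (n ℕ.+ n) ] ⟦ does (config? n s w) ⟧ * polyAt (Qᵖ (decode w) ∘ suc) g
      S-words {n} {s} g s≤n = trans (∑-cong (partitions s) (eval-Qᵖ g))
        (∑-partitions-words n n s s≤n s≤n (λ ls → polyAt (Qᵖ ls ∘ suc) g) (polyAt-pad g))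

      even-index : ∀ i → even (suc (suc p ℕ.+ i)) ≡ even i
      even-index zero    = trans (even-suc (suc p ℕ.+ 0)) (cong not (trans (cong even (ℕ.+-identityʳ (suc p))) p-odd))
      even-index (suc i) = trans (cong (even ∘ suc) (ℕ.+-suc (suc p) i))
        (trans (even-suc (suc (suc p ℕ.+ i))) (trans (cong not (even-index i)) (sym (even-suc i))))

      Eis-suc : ∀ i j t → Eis i j (suc t) ≡ fromℕ (suc t) ^ j * (⟦ even i ⟧ * fromℕ (σ (suc p ℕ.+ i) (suc t)))
      Eis-suc i j t = trans (𝐷-iterate j (suc p ℕ.+ i ℕ.+ 1) (suc t)) (cong (fromℕ (suc t) ^ j *_) (trans
        (cong (λ k → G k (suc t)) (ℕ.+-comm (suc p ℕ.+ i) 1))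
        (trans (indicator (even (suc (suc p ℕ.+ i)))) (cong (λ b → ⟦ b ⟧ * fromℕ (σ (suc p ℕ.+ i) (suc t))) (even-index i)))))
        where
        indicator : ∀ b → (if b then fromℕ (σ (suc p ℕ.+ i) (suc t)) else 0ℚ) ≡ ⟦ b ⟧ * fromℕ (σ (suc p ℕ.+ i) (suc t))
        indicator true  = sym (ℚ.*-identityˡ (fromℕ (σ (suc p ℕ.+ i) (suc t))))
        indicator false = sym (ℚ.*-zeroˡ (fromℕ (σ (suc p ℕ.+ i) (suc t))))

      -- Both sides are -B/(2k) at k = `suc (suc p)`: the zeta value is normalised so as to be twice
      -- the constant term of the Eisenstein series.
      Eis-zero : Eis 0 0 0 ≡ ½ * ζ⁻ (suc p)
      Eis-zero = begin
        G (suc p ℕ.+ 0 ℕ.+ 1) 0                              ≡⟨ cong (λ k → G k 0) (trans (ℕ.+-comm (suc p ℕ.+ 0) 1) (cong suc (ℕ.+-identityʳ (suc p)))) ⟩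
        G (suc (suc p)) 0                                    ≡⟨ cong (if_then - (B * 1/ℕ (2 ℕ.* suc (suc p))) else 0ℚ) (trans (even-suc (suc p)) (cong not p-odd)) ⟩
        - (B * 1/ℕ (2 ℕ.* suc (suc p)))                      ≡⟨ cong (λ x → - (B * x)) (1/ℕ-double (suc p)) ⟩
        - (B * (½ * 1/ℕ (suc (suc p))))                      ≡⟨ ring B (1/ℕ (suc (suc p))) ⟩
        ½ * ζ⁻ (suc p)                                       ∎
        where
        open ≡-Reasoning
        B : ℚ
        B = bernoulli (suc (suc p))
        ring : ∀ b x → - (b * (½ * x)) ≡ ½ * - (b * x)
        ring = solve-∀ ℚ-ring

      Eis-suc-zero : ∀ i j → Eis i (suc j) 0 ≡ 0ℚ
      Eis-suc-zero i j = ℚ.*-zeroˡ (Eis i j 0)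

      -- A factor q d/dq kills the constant term, which leaves j = 0; there `polyAt-ρ₀-suc` and
      -- `polyAt-ρ₀₀` apply.
      constant-part : ∀ n → ∑[ i ∈ upTo N ] ∑[ j ∈ upTo N ] Eis i j 0 * S (ρ i j f) n ≡ ½ * ζ⁻ (suc p) * S f n
      constant-part n = begin
        ∑ (upTo N) R                         ≡⟨ ∑-upTo-suc W R ⟩
        R 0 + ∑ (upTo W) (R ∘ suc)           ≡⟨ cong₂ _+_ (row 0) (∑-0 (upTo W) (λ {i} _ → trans (row (suc i)) (trans
                                                  (cong (Eis (suc i) 0 0 *_) (∑-0 (partitions n) (λ {μ} _ → trans (eval-Qᵖ (ρ (suc i) 0 f) μ) (polyAt-ρ₀-suc (parts μ) f i))))
                                                  (ℚ.*-zeroʳ (Eis (suc i) 0 0))))) ⟩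
        Eis 0 0 0 * S (ρ 0 0 f) n + 0ℚ       ≡⟨ ℚ.+-identityʳ _ ⟩
        Eis 0 0 0 * S (ρ 0 0 f) n            ≡⟨ cong₂ _*_ Eis-zero (∑-cong (partitions n) (λ μ → trans (eval-Qᵖ (ρ 0 0 f) μ) (trans (polyAt-ρ₀₀ (parts μ) f) (sym (eval-Qᵖ f μ))))) ⟩
        ½ * ζ⁻ (suc p) * S f n               ∎
        where
        open ≡-Reasoning
        R : ℕ → ℚ
        R i = ∑[ j ∈ upTo N ] Eis i j 0 * S (ρ i j f) n
        row : ∀ i → R i ≡ Eis i 0 0 * S (ρ i 0 f) n
        row i = trans (∑-upTo-suc W (λ j → Eis i j 0 * S (ρ i j f) n))
          (trans (cong (Eis i 0 0 * S (ρ i 0 f) n +_) (∑-0 (upTo W) (λ {j} _ → trans (cong (_* S (ρ i (suc j) f) n) (Eis-suc-zero i j)) (ℚ.*-zeroˡ (S (ρ i (suc j) f) n)))))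
            (ℚ.+-identityʳ (Eis i 0 0 * S (ρ i 0 f) n)))

      coefficient : ℕ → ℕ → ℕ → ℕ → ℚ
      coefficient d t i j = ⟦ even i ⟧ * (fromℕ (suc d) ^ suc i * fromℕ (suc t) ^ j)

      -- Here Z = O = n, m = d + 1 and r = (t + 1)/m, so `coefficient` is the factor in `ρ-sum` and
      -- the inner double sum is a `balance`. `telescope` is used from r = 0.
      divisor-part : ∀ n d (d<n : d < n) →
        ∑[ t ∈ upTo n ] ⟦ does (suc d ∣? suc t) ⟧ * (∑[ i ∈ upTo N ] ∑[ j ∈ upTo N ] coefficient d t i j * S (ρ i j f) (n ∸ suc t)) ≡
        lowerable f n n (suc d) (n ∸ suc d) (s≤s z≤n) (ℕ.m+[n∸m]≡n d<n) 0ℚ n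
      divisor-part n d d<n = trans
        (∑-cong (upTo n) (λ t → cong (⟦ does (suc d ∣? suc t) ⟧ *_) (balanced t)))
        (telescope f n n m (n ∸ m) (s≤s z≤n) (ℕ.m+[n∸m]≡n d<n) c mc≡1 n 0ℚ ℕ.≤-refl ℕ.≤-refl)
        where
        open ≡-Reasoning
        m : ℕ
        m = suc d
        c : ℚ
        c = 1/ℕ m
        mc≡1 : fromℕ m * c ≡ 1ℚ
        mc≡1 = fromℕ*1/ℕ m
        bal : ℚ → ℕ → ℚ
        bal = balance f n n m (n ∸ m) (s≤s z≤n) (ℕ.m+[n∸m]≡n d<n)
        ring : ∀ x y z → x * (y * z) ≡ y * (x * z)
        ring = solve-∀ ℚ-ring
        balanced : ∀ t → ∑[ i ∈ upTo N ] ∑[ j ∈ upTo N ] coefficient d t i j * S (ρ i j f) (n ∸ suc t) ≡ bal (0ℚ + fromℕ (suc t) * c) (n ∸ suc t)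
        balanced t = begin
          ∑[ i ∈ upTo N ] ∑[ j ∈ upTo N ] coefficient d t i j * S (ρ i j f) s
            ≡⟨ ∑-cong (upTo N) (λ i → trans (∑-cong (upTo N) (λ j → trans
                 (cong (coefficient d t i j *_) (S-words (ρ i j f) (ℕ.m∸n≤m n (suc t))))
                 (trans (sym (∑-*ˡ (coefficient d t i j) (λ w → 𝟙 w * Fʷ i j w) (words (n ℕ.+ n))))
                   (∑-cong (words (n ℕ.+ n)) (λ w → ring (coefficient d t i j) (𝟙 w) (Fʷ i j w))))))
                 (∑-swap (λ j w → 𝟙 w * (coefficient d t i j * Fʷ i j w)) (upTo N) (words (n ℕ.+ n)))) ⟩
          ∑[ i ∈ upTo N ] ∑[ w ∈ words (n ℕ.+ n) ] ∑[ j ∈ upTo N ] 𝟙 w * (coefficient d t i j * Fʷ i j w)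
            ≡⟨ ∑-swap (λ i w → ∑[ j ∈ upTo N ] 𝟙 w * (coefficient d t i j * Fʷ i j w)) (upTo N) (words (n ℕ.+ n)) ⟩
          ∑[ w ∈ words (n ℕ.+ n) ] ∑[ i ∈ upTo N ] ∑[ j ∈ upTo N ] 𝟙 w * (coefficient d t i j * Fʷ i j w)
            ≡⟨ ∑-cong (words (n ℕ.+ n)) (λ w → trans
                 (∑-cong (upTo N) (λ i → ∑-*ˡ (𝟙 w) (λ j → coefficient d t i j * Fʷ i j w) (upTo N)))
                 (trans (∑-*ˡ (𝟙 w) (λ i → ∑[ j ∈ upTo N ] coefficient d t i j * Fʷ i j w) (upTo N))
                   (cong (𝟙 w *_) (ρ-sum m c mc≡1 (decode w) f (suc t) N ℕ.≤-refl)))) ⟩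
          bal (fromℕ (suc t) * c) s
            ≡⟨ balance-cong f n n m (n ∸ m) (s≤s z≤n) (ℕ.m+[n∸m]≡n d<n) s (sym (ℚ.+-identityˡ (fromℕ (suc t) * c))) ⟩
          bal (0ℚ + fromℕ (suc t) * c) s ∎
          where
          s : ℕ
          s = n ∸ suc t
          𝟙 : Word → ℚ
          𝟙 w = ⟦ does (config? n s w) ⟧
          Fʷ : ℕ → ℕ → Word → ℚ
          Fʷ i j w = polyAt (Qᵖ (decode w) ∘ suc) (ρ i j f)

      jumped-0 : ∀ m ls x → jumped f m 0ℚ ls x ≡ polyAt (Qᵖ ls ∘ suc) f
      jumped-0 m ls x = polyAt-cong f (λ i → ring (Qᵖ ls (suc i)) (1/ i !) (x ^ i - (x - fromℕ m) ^ i))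
        where
        ring : ∀ q e y → q + e * (0ℚ * y) ≡ q
        ring = solve-∀ ℚ-ring

      -- For r = 0 nothing is added to the power sums, so `lowerable` counts the hooks of length d +
      -- 1 of the partitions of n, weighted by f.
      hook-part : ∀ n → ∑[ μ ∈ partitions n ] hookSum hookPower (parts μ) * eval f μ ≡
        ∑[ d ∈ upTo n ] hookPower (suc d) *
          (∑[ t ∈ upTo n ] ⟦ does (suc d ∣? suc t) ⟧ * (∑[ i ∈ upTo N ] ∑[ j ∈ upTo N ] coefficient d t i j * S (ρ i j f) (n ∸ suc t)))
      hook-part n = begin
        ∑[ μ ∈ partitions n ] hookSum hookPower (parts μ) * eval f μ
          ≡⟨ trans (∑-cong (partitions n) (λ μ → cong (hookSum hookPower (parts μ) *_) (eval-Qᵖ f μ)))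
               (∑-partitions-words n n n ℕ.≤-refl ℕ.≤-refl (λ ls → hookSum hookPower ls * polyAt (Qᵖ ls ∘ suc) f)
                 (λ k ls → cong₂ _*_ (hookSum-pad hookPower k ls) (polyAt-pad f k ls))) ⟩
        ∑[ w ∈ words (n ℕ.+ n) ] 𝟙 w * (hookSum hookPower (decode w) * Fʷ w)
          ≡⟨ ∑-cong∈ (words (n ℕ.+ n)) (λ {w} w∈ → ∑-config {n} {n} {w} (λ _ e →
               trans (cong (_* Fʷ w) (hookSum-word hookPower n w (words-length (n ℕ.+ n) w∈) e)) (sym (∑-*ʳ (Fʷ w) (λ d → hookPower (suc d) * D′ d w) (upTo n))))) ⟩
        ∑[ w ∈ words (n ℕ.+ n) ] 𝟙 w * (∑[ d ∈ upTo n ] hookPower (suc d) * D′ d w * Fʷ w)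
          ≡⟨ trans (∑-cong (words (n ℕ.+ n)) (λ w → sym (∑-*ˡ (𝟙 w) (λ d → hookPower (suc d) * D′ d w * Fʷ w) (upTo n))))
               (∑-swap (λ w d → 𝟙 w * (hookPower (suc d) * D′ d w * Fʷ w)) (words (n ℕ.+ n)) (upTo n)) ⟩
        ∑[ d ∈ upTo n ] ∑[ w ∈ words (n ℕ.+ n) ] 𝟙 w * (hookPower (suc d) * D′ d w * Fʷ w)
          ≡⟨ ∑-upTo-cong n (λ {d} d<n → trans (trans
               (∑-cong (words (n ℕ.+ n)) (λ w → trans (ring (𝟙 w) (hookPower (suc d)) (D′ d w) (Fʷ w))
                 (cong (λ z → hookPower (suc d) * (𝟙 w * z)) (trans (sym (∑-*ʳ (Fʷ w) (bits d w) (upTo (n ℕ.+ (n ∸ suc d)))))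
                   (∑-cong (upTo (n ℕ.+ (n ∸ suc d))) (λ i → cong (bits d w i *_) (sym (jumped-0 (suc d) (decode w) (pos n i)))))))))
               (∑-*ˡ (hookPower (suc d)) (λ w → 𝟙 w * (∑[ i ∈ upTo (n ℕ.+ (n ∸ suc d)) ] bits d w i * jumped f (suc d) 0ℚ (decode w) (pos n i))) (words (n ℕ.+ n))))
               (cong (hookPower (suc d) *_) (sym (divisor-part n d d<n)))) ⟩
        ∑[ d ∈ upTo n ] hookPower (suc d) *
          (∑[ t ∈ upTo n ] ⟦ does (suc d ∣? suc t) ⟧ * (∑[ i ∈ upTo N ] ∑[ j ∈ upTo N ] coefficient d t i j * S (ρ i j f) (n ∸ suc t))) ∎
        where
        open ≡-Reasoning
        𝟙 Fʷ : Word → ℚ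
        𝟙 w = ⟦ does (config? n n w) ⟧
        Fʷ w = polyAt (Qᵖ (decode w) ∘ suc) f
        bits : ℕ → Word → ℕ → ℚ
        bits d w i = ⟦ bit w i ∧ not (bit w (i ℕ.+ suc d)) ⟧
        D′ : ℕ → Word → ℚ
        D′ d w = ∑ (upTo (n ℕ.+ (n ∸ suc d))) (bits d w)
        ring : ∀ x y z v → x * (y * z * v) ≡ y * (x * (z * v))
        ring = solve-∀ ℚ-ring

      positive-part : ∀ n → ∑[ i ∈ upTo N ] ∑[ j ∈ upTo N ] ∑[ t ∈ upTo n ] Eis i j (suc t) * S (ρ i j f) (n ∸ suc t) ≡
        ∑[ d ∈ upTo n ] hookPower (suc d) *
          (∑[ t ∈ upTo n ] ⟦ does (suc d ∣? suc t) ⟧ * (∑[ i ∈ upTo N ] ∑[ j ∈ upTo N ] coefficient d t i j * S (ρ i j f) (n ∸ suc t)))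
      positive-part n = begin
        ∑[ i ∈ upTo N ] ∑[ j ∈ upTo N ] ∑[ t ∈ upTo n ] Eis i j (suc t) * Sₜ i j t
          ≡⟨ ∑-cong (upTo N) (λ i → ∑-cong (upTo N) (λ j → trans (∑-upTo-cong n (λ {t} t<n → expand i j t t<n)) (∑-swap (λ t d → E d t i j) (upTo n) (upTo n)))) ⟩
        ∑[ i ∈ upTo N ] ∑[ j ∈ upTo N ] ∑[ d ∈ upTo n ] ∑[ t ∈ upTo n ] E d t i j
          ≡⟨ trans (∑-cong (upTo N) (λ i → ∑-swap (λ j d → ∑[ t ∈ upTo n ] E d t i j) (upTo N) (upTo n)))
               (∑-swap (λ i d → ∑[ j ∈ upTo N ] ∑[ t ∈ upTo n ] E d t i j) (upTo N) (upTo n)) ⟩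
        ∑[ d ∈ upTo n ] ∑[ i ∈ upTo N ] ∑[ j ∈ upTo N ] ∑[ t ∈ upTo n ] E d t i j
          ≡⟨ ∑-cong (upTo n) (λ d → trans
               (∑-cong (upTo N) (λ i → ∑-swap (λ j t → E d t i j) (upTo N) (upTo n)))
               (∑-swap (λ i t → ∑[ j ∈ upTo N ] E d t i j) (upTo N) (upTo n))) ⟩
        ∑[ d ∈ upTo n ] ∑[ t ∈ upTo n ] ∑[ i ∈ upTo N ] ∑[ j ∈ upTo N ] E d t i j
          ≡⟨ ∑-cong (upTo n) (λ d → trans (∑-cong (upTo n) (λ t → trans
               (∑-cong (upTo N) (λ i → trans (∑-*ˡ (hookPower (suc d)) (λ j → ind d t * (coefficient d t i j * Sₜ i j t)) (upTo N))
                 (cong (hookPower (suc d) *_) (∑-*ˡ (ind d t) (λ j → coefficient d t i j * Sₜ i j t) (upTo N)))))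
               (trans (∑-*ˡ (hookPower (suc d)) (λ i → ind d t * (∑[ j ∈ upTo N ] coefficient d t i j * Sₜ i j t)) (upTo N))
                 (cong (hookPower (suc d) *_) (∑-*ˡ (ind d t) (λ i → ∑[ j ∈ upTo N ] coefficient d t i j * Sₜ i j t) (upTo N))))))
               (∑-*ˡ (hookPower (suc d)) (λ t → ind d t * (∑[ i ∈ upTo N ] ∑[ j ∈ upTo N ] coefficient d t i j * Sₜ i j t)) (upTo n))) ⟩
        ∑[ d ∈ upTo n ] hookPower (suc d) * (∑[ t ∈ upTo n ] ind d t * (∑[ i ∈ upTo N ] ∑[ j ∈ upTo N ] coefficient d t i j * Sₜ i j t)) ∎
        where
        open ≡-Reasoning
        Sₜ : ℕ → ℕ → ℕ → ℚ
        Sₜ i j t = S (ρ i j f) (n ∸ suc t)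
        ind : ℕ → ℕ → ℚ
        ind d t = ⟦ does (suc d ∣? suc t) ⟧
        E : ℕ → ℕ → ℕ → ℕ → ℚ
        E d t i j = hookPower (suc d) * (ind d t * (coefficient d t i j * Sₜ i j t))
        ring₁ : ∀ a b c x → a * (b * c) * x ≡ a * b * x * c
        ring₁ = solve-∀ ℚ-ring
        ring₂ : ∀ a b x d u v → a * b * x * (d * (u * v)) ≡ u * (d * (b * (v * a) * x))
        ring₂ = solve-∀ ℚ-ring
        expand : ∀ i j t → t < n → Eis i j (suc t) * Sₜ i j t ≡ ∑[ d ∈ upTo n ] E d t i j
        expand i j t t<n = begin
          Eis i j (suc t) * Sₜ i j t
            ≡⟨ cong (_* Sₜ i j t) (Eis-suc i j t) ⟩
          fromℕ (suc t) ^ j * (⟦ even i ⟧ * fromℕ (σ (suc p ℕ.+ i) (suc t))) * Sₜ i j t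
            ≡⟨ ring₁ (fromℕ (suc t) ^ j) ⟦ even i ⟧ (fromℕ (σ (suc p ℕ.+ i) (suc t))) (Sₜ i j t) ⟩
          fromℕ (suc t) ^ j * ⟦ even i ⟧ * Sₜ i j t * fromℕ (σ (suc p ℕ.+ i) (suc t))
            ≡⟨ cong (fromℕ (suc t) ^ j * ⟦ even i ⟧ * Sₜ i j t *_) (σ-sum (suc p ℕ.+ i) (suc t) t<n) ⟩
          fromℕ (suc t) ^ j * ⟦ even i ⟧ * Sₜ i j t * (∑[ d ∈ upTo n ] ind d t * fromℕ (suc d) ^ (suc p ℕ.+ i))
            ≡⟨ ∑-*ˡ (fromℕ (suc t) ^ j * ⟦ even i ⟧ * Sₜ i j t) (λ d → ind d t * fromℕ (suc d) ^ (suc p ℕ.+ i)) (upTo n) ⟨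
          ∑[ d ∈ upTo n ] fromℕ (suc t) ^ j * ⟦ even i ⟧ * Sₜ i j t * (ind d t * fromℕ (suc d) ^ (suc p ℕ.+ i))
            -- The exponent p + 1 + i of the divisor splits into p for the hook power and i + 1 for
            -- `coefficient`.
            ≡⟨ ∑-cong (upTo n) (λ d → trans
                 (cong (λ z → fromℕ (suc t) ^ j * ⟦ even i ⟧ * Sₜ i j t * (ind d t * z)) (trans (cong (fromℕ (suc d) ^_) (sym (ℕ.+-suc p i))) (^-+ (fromℕ (suc d)) p (suc i))))
                 (ring₂ (fromℕ (suc t) ^ j) ⟦ even i ⟧ (Sₜ i j t) (ind d t) (hookPower (suc d)) (fromℕ (suc d) ^ suc i))) ⟩
          ∑[ d ∈ upTo n ] E d t i j ∎

    -- The identity before division by Σ q^|λ|. In each convolution the constant term of the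
    -- Eisenstein factor goes to `constant-part` and the rest to `positive-part`.
    T̃-sum : ∀ n → ∑[ μ ∈ partitions n ] T̃ (suc p) μ * eval f μ ≡ ∑[ i ∈ upTo N ] ∑[ j ∈ upTo N ] (S (ρ i j f) ⊛ Eis i j) n
    T̃-sum n = begin
      ∑[ μ ∈ partitions n ] T̃ (suc p) μ * eval f μ
        ≡⟨ trans (∑-cong (partitions n) (λ μ → trans (cong (_* eval f μ) (T̃-hookSum (suc p) μ)) (ℚ.*-distribʳ-+ (eval f μ) (hookSum hookPower (parts μ)) (½ * ζ⁻ (suc p)))))
             (trans (∑-+ (λ μ → hookSum hookPower (parts μ) * eval f μ) (λ μ → ½ * ζ⁻ (suc p) * eval f μ) (partitions n))
               (cong ((∑[ μ ∈ partitions n ] hookSum hookPower (parts μ) * eval f μ) +_) (∑-*ˡ (½ * ζ⁻ (suc p)) (eval f) (partitions n)))) ⟩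
      (∑[ μ ∈ partitions n ] hookSum hookPower (parts μ) * eval f μ) + ½ * ζ⁻ (suc p) * S f n
        ≡⟨ cong₂ _+_ (trans (hook-part n) (sym (positive-part n))) (sym (constant-part n)) ⟩
      (∑[ i ∈ upTo N ] ∑[ j ∈ upTo N ] P i j) + (∑[ i ∈ upTo N ] ∑[ j ∈ upTo N ] C i j)
        ≡⟨ ∑-+ (λ i → ∑[ j ∈ upTo N ] P i j) (λ i → ∑[ j ∈ upTo N ] C i j) (upTo N) ⟨
      ∑[ i ∈ upTo N ] ((∑[ j ∈ upTo N ] P i j) + (∑[ j ∈ upTo N ] C i j))
        ≡⟨ ∑-cong (upTo N) (λ i → trans (sym (∑-+ (P i) (C i) (upTo N))) (∑-cong (upTo N) (λ j → trans (ℚ.+-comm (P i j) (C i j))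
             (trans (sym (∑-upTo-suc n (λ t → Eis i j t * S (ρ i j f) (n ∸ t)))) (⊛-comm (Eis i j) (S (ρ i j f)) n))))) ⟩
      ∑[ i ∈ upTo N ] ∑[ j ∈ upTo N ] (S (ρ i j f) ⊛ Eis i j) n ∎
      where
      open ≡-Reasoning
      P C : ℕ → ℕ → ℚ
      P i j = ∑[ t ∈ upTo n ] Eis i j (suc t) * S (ρ i j f) (n ∸ suc t)
      C i j = Eis i j 0 * S (ρ i j f) n

    -- Both sides of `T̃-sum` are multiplied by the reciprocal of Σ q^|λ|, which on the right is
    -- moved next to the sums of ρ_{i,j}(f) to form brackets. From N = weightBound f + 1 on,
    -- ρ_{i,j}(f) is the empty sum.
    bracket-expansion : IsFiniteSum (λ i j → ⟨ eval (ρ i j f) ⟩ ⊛ G⁽ j ⁾ (suc p ℕ.+ i ℕ.+ 1)) ⟨ (λ μ → T̃ (suc p) μ * eval f μ) ⟩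
    bracket-expansion = N , vanishing , expansion
      where
      open ≡-Reasoning
      P : Series
      P = recip (λ n → ∑[ μ ∈ partitions n ] 1ℚ)

      vanishing : ∀ i j → N ≤ i ⊎ N ≤ j → ⟨ eval (ρ i j f) ⟩ ⊛ Eis i j ≗ 0ˢ
      vanishing i j h = ⊛-zeroˡ (Eis i j) (⊛-zeroˡ P (λ n → ∑-0 (partitions n) (λ {μ} _ → cong (λ g → eval g μ) (ρ-[] i j f h))))

      reorder : ∀ i j → (S (ρ i j f) ⊛ Eis i j) ⊛ P ≗ ⟨ eval (ρ i j f) ⟩ ⊛ Eis i j
      reorder i j n = begin
        ((S (ρ i j f) ⊛ Eis i j) ⊛ P) n      ≡⟨ ⊛-assoc (S (ρ i j f)) (Eis i j) P n ⟩
        (S (ρ i j f) ⊛ (Eis i j ⊛ P)) n      ≡⟨ ⊛-cong {a = S (ρ i j f)} (λ _ → refl) (⊛-comm (Eis i j) P) n ⟩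
        (S (ρ i j f) ⊛ (P ⊛ Eis i j)) n      ≡⟨ ⊛-assoc (S (ρ i j f)) P (Eis i j) n ⟨
        ((S (ρ i j f) ⊛ P) ⊛ Eis i j) n      ∎

      expansion : ∀ n → ⟨ (λ μ → T̃ (suc p) μ * eval f μ) ⟩ n ≡ ∑[ i ∈ upTo N ] ∑[ j ∈ upTo N ] (⟨ eval (ρ i j f) ⟩ ⊛ Eis i j) n
      expansion n = begin
        ((λ k → ∑[ μ ∈ partitions k ] T̃ (suc p) μ * eval f μ) ⊛ P) n
          ≡⟨ ⊛-cong {b = P} T̃-sum (λ _ → refl) n ⟩
        ((λ k → ∑[ i ∈ upTo N ] ∑[ j ∈ upTo N ] (S (ρ i j f) ⊛ Eis i j) k) ⊛ P) n
          ≡⟨ ⊛-∑ˡ (upTo N) (λ i k → ∑[ j ∈ upTo N ] (S (ρ i j f) ⊛ Eis i j) k) P n ⟩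
        ∑[ i ∈ upTo N ] ((λ k → ∑[ j ∈ upTo N ] (S (ρ i j f) ⊛ Eis i j) k) ⊛ P) n
          ≡⟨ ∑-cong (upTo N) (λ i → trans (⊛-∑ˡ (upTo N) (λ j → S (ρ i j f) ⊛ Eis i j) P n) (∑-cong (upTo N) (λ j → reorder i j n))) ⟩
        ∑[ i ∈ upTo N ] ∑[ j ∈ upTo N ] (⟨ eval (ρ i j f) ⟩ ⊛ Eis i j) n ∎

  odd-bracket-expansion : ∀ f p → ¬ (2 ∣ p) → IsFiniteSum (λ i j → ⟨ eval (ρ i j f) ⟩ ⊛ G⁽ j ⁾ (p ℕ.+ i ℕ.+ 1)) ⟨ (λ μ → T̃ p μ * eval f μ) ⟩
  odd-bracket-expansion f zero    2∤p = contradiction (2 ∣0) 2∤p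
  odd-bracket-expansion f (suc p) 2∤p = bracket-expansion f p (dec-false (2 ∣? suc p) 2∤p)

open import Defs
open import Data.Nat using (ℕ; _+_)
open import Data.Nat.Divisibility using (_∣_)
open import Data.Rational using (_*_)
open import Relation.Nullary using (¬_)

theorem14p1 : (f : 𝓡) (p : ℕ) → ¬ (2 ∣ p) →
    IsFiniteSum (λ i j → ⟨ eval (ρ i j f) ⟩ ⊛ G⁽ j ⁾ (p + i + 1))
    ⟨ (λ μ → T̃ p μ * eval f μ) ⟩
theorem14p1 = Proof.odd-bracket-expansion
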